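{- Let $k\in\mathbb{N}$ and let $\{G^{(r)}\}$ be an admissible group ensemble of $k$-SUM density $\Delta<1$. Suppose there is an algorithm that runs in time $T(r)=\Omega(r/\Delta)$ and solves the decision $k$-SUM problem over $\{G^{(r)}\}$ with success probability $1-o(1)$. Then, for any constant $\gamma<1$, there is an algorithm that runs in time $\widetilde{O}(T(r))$ and solves the planted search $k$-SUM problem over $\{G^{(r)}\}$ with success probability at least $\gamma$.
   Context: All logarithms are base 2; algorithms may be randomized; $\widetilde O$ hides factors polylogarithmic in $r$. A group ensemble is a sequence $\{G^{(r)}\}_{r\ge1}$ of finite abelian groups written additively. Its $k$-SUM density is $\Delta_k=\lim_{r\to\infty}\Delta_k^{(r)}$, where $\Delta_k^{(r)}=\frac{k\log r}{\log|G^{(r)}|}$. It is admissible for $k$-SUM if: uniformly random elements of $G^{(r)}$ can be sampled in time $O(\log|G^{(r)}|\,\mathrm{polylog}\log|G^{(r)}|)$; the group operation of $G^{(r)}$ can be computed in time $O(\mathrm{polylog}|G^{(r)}|)$; and $\Delta_k$ exists, is finite, and $|\Delta_k^{(r)}-\Delta_k|/\Delta_k\le 1/\log|G^{(r)}|$ for all $r$. Distributions: $D_0^{(r)}$: $X=(X_1,\dots,X_r)$ with $X_i$ i.i.d. uniform in $G^{(r)}$. $D_1^{(r)}$: sample $X_1,\dots,X_r$ i.i.d. uniformly from $G^{(r)}$; choose a uniformly random $S\subseteq[r]$ with $|S|=k$; let $i=\min S$ and replace $X_i$ by $-\sum_{j\in S,j\ne i}X_j$; output $X$. An algorithm $A$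 solves decision $k$-SUM with success probability $\epsilon$ if for both $b\in\{0,1\}$, $\Pr_{X\sim D_b^{(r)}}[A(X)=b]\ge\epsilon$. An algorithm solves planted search $k$-SUM with success probability $\epsilon$ if, on input $X\sim D_1^{(r)}$, it outputs with probability at least $\epsilon$ (over $X$ and its coins) a set $S'\subseteq[r]$, $|S'|=k$, with $\sum_{i\in S'}X_i=0$. -}

module Defs where

open import Algebra.Bundles using (AbelianGroup)
import Algebra.Definitions.RawMonoid as RawMonoidDefinitions
open import Data.Bool.Base using (Bool; true; false; if_then_else_; _∧_)
open import Data.Fin.Base using (Fin; zero; suc; toℕ)
open import Data.Fin.Properties using () renaming (_≟_ to _≟ᶠ_)
open import Data.Fin.Subset using (Subset; inside; outside; ∣_∣; _-_)
open import Data.Integer.Base using (+_)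
open import Data.List.Base using (List; []; _∷_; length; map; _++_; filter)
import Data.List.Base as List
open import Data.Maybe.Base using (Maybe; just; nothing; maybe′)
import Data.Maybe.Base as Maybe
open import Data.Maybe.Relation.Unary.Any using (Any)
open import Data.Nat.Base using (ℕ; zero; suc; _+_; _*_; _∸_; _^_; _≤_; _≡ᵇ_)
import Data.Nat.DivMod as ℕ
open import Data.Nat.Logarithm using (⌊log₂_⌋)
open import Data.Nat.Properties using () renaming (_≟_ to _≟ⁿ_)
open import Data.Product.Base using (∃; ∃-syntax; Σ-syntax; _×_; _,_)
open import Data.Rational.Base as ℚ using (ℚ; 0ℚ; 1ℚ)
import Data.Rational.Properties as ℚ
open import Data.Vec.Base using (Vec; []; _∷_; lookup; tabulate; toList; _[_]≔_)
import Data.Vec.Base as Vec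
open import Function.Base using (_∘_)
open import Function.Bundles using (Inverse; Injection)
open import Function.Properties.Inverse using (Inverse⇒Injection)
open import Level using (0ℓ)
open import Relation.Binary.Definitions using (Decidable)
open import Relation.Binary.PropositionalEquality using (_≡_; setoid)
open import Relation.Nullary using (yes; no; does)
open import Relation.Nullary.Decidable using (via-injection)

------------------------------------------------------------------------
-- Real numbers

-- A real number is presented by a Cauchy sequence of rationals, and the
-- field operations act termwise.  Sequences are not required to be
-- Cauchy until a real number is quantified over (see ℝ); order and
-- limits only depend on the real number presented.

Seq : Set
Seq = ℕ → ℚ

Cauchy : Seq → Set
Cauchy x = ∀ ε → 0ℚ ℚ.< ε →
  ∃[ N ] ∀ m n → N ≤ m → N ≤ n → ℚ.∣ x m ℚ.- x n ∣ ℚ.≤ ε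

record ℝ : Set where
  field
    seq    : Seq
    cauchy : Cauchy seq

open ℝ public

infix  4 _≤ᴿ_ _<ᴿ_
infixl 6 _-ᴿ_
infixl 7 _*ᴿ_ _/ᴿ_ _÷₀_

_≤ᴿ_ : Seq → Seq → Set
x ≤ᴿ y = ∀ ε → 0ℚ ℚ.< ε → ∃[ N ] ∀ n → N ≤ n → x n ℚ.≤ y n ℚ.+ ε

_<ᴿ_ : Seq → Seq → Set
x <ᴿ y = Σ[ ε ∈ ℚ ] 0ℚ ℚ.< ε × ∃[ N ] ∀ n → N ≤ n → x n ℚ.+ ε ℚ.≤ y n

-- x / 0 = 0.  Every divisor below presents a positive real, so that
-- only finitely many terms are affected by this convention.
_÷₀_ : ℚ → ℚ → ℚ
p ÷₀ q with q ℚ.≟ 0ℚ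
... | yes _  = 0ℚ
... | no q≢0 = (p ℚ.÷ q) ⦃ ℚ.≢-nonZero q≢0 ⦄

fromℚ : ℚ → Seq
fromℚ q _ = q

fromℕ : ℕ → Seq
fromℕ n = fromℚ (+ n ℚ./ 1)

_-ᴿ_ _*ᴿ_ _/ᴿ_ : Seq → Seq → Seq
(x -ᴿ y) n = x n ℚ.- y n
(x *ᴿ y) n = x n ℚ.* y n
(x /ᴿ y) n = x n ÷₀ y n

absᴿ : Seq → Seq
absᴿ x n = ℚ.∣ x n ∣

-- log₂ n for n ≥ 1: since m · log₂ n = log₂ (n ^ m), the term
-- ⌊log₂ (n ^ m)⌋ / m is within 1 / m of log₂ n.
log : ℕ → Seq
log n i = + ⌊log₂ (n ^ suc i) ⌋ ℚ./ suc i

Converges : (ℕ → Seq) → Seq → Set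
Converges f ℓ = ∀ ε → 0ℚ ℚ.< ε →
  ∃[ R ] ∀ r → R ≤ r → absᴿ (f r -ᴿ ℓ) ≤ᴿ fromℚ ε

------------------------------------------------------------------------
-- Asymptotic bounds

-- Inside these bounds logarithms are rounded down to integers, which
-- changes them by at most a constant factor once they are at least 1.

_≼_ : (ℕ → ℕ) → (ℕ → ℕ) → Set
f ≼ g = ∃[ c ] ∃[ R ] ∀ r → R ≤ r → f r ≤ c * g r

_=Õ_ : (ℕ → ℕ) → (ℕ → ℕ) → Set
f =Õ g = ∃[ e ] f ≼ (λ r → g r * ⌊log₂ r ⌋ ^ e)

_=Ω_ : (ℕ → ℕ) → (ℕ → Seq) → Set
f =Ω g = Σ[ c ∈ ℚ ] 0ℚ ℚ.< c × ∃[ R ] ∀ r → R ≤ r →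
  fromℚ c *ᴿ g r ≤ᴿ fromℕ (f r)

------------------------------------------------------------------------
-- Finite probability distributions

-- unif n f draws i uniformly from Fin n and continues as f i.  (unif 0 f
-- carries no mass; it never occurs in the situations considered.)
data Dist (A : Set) : Set where
  ret  : A → Dist A
  unif : (n : ℕ) → (Fin n → Dist A) → Dist A

infixl 1 _>>=_

_>>=_ : {A B : Set} → Dist A → (A → Dist B) → Dist B
ret a    >>= k = k a
unif n f >>= k = unif n (λ i → f i >>= k)

Always : {A : Set} → (A → Set) → Dist A → Set
Always P (ret a)    = P a
Always P (unif n f) = ∀ i → Always P (f i)

Pr : Dist Bool → ℚ
Pr (ret b)          = if b then 1ℚ else 0ℚ
Pr (unif zero f)    = 0ℚ
Pr (unif (suc n) f) =
  (+ 1 ℚ./ suc n) ℚ.* sum (λ i → Pr (f i))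
  where open RawMonoidDefinitions ℚ.+-0-rawMonoid using (sum)

uniformFrom : {A : Set} → List A → Dist A
uniformFrom xs = unif (length xs) (λ i → ret (List.lookup xs i))

iid : {A : Set} (n : ℕ) → Dist A → Dist (Vec A n)
iid zero    d = ret []
iid (suc n) d = do
  x  ← d
  xs ← iid n d
  ret (x ∷ xs)

------------------------------------------------------------------------
-- Algorithms

-- The machine model is the random access machine with logarithmic cost:
-- memory cells hold arbitrary natural numbers, and every operation is
-- charged the bit lengths of all addresses and values involved.  It is
-- presented with structured control flow, and can draw a uniformly random
-- element of {0, …, v - 1} at the cost of the length of v.

Mem : Set
Mem = ℕ → ℕ

_[_↦_] : Mem → ℕ → ℕ → Mem
(m [ a ↦ v ]) b = if b ≡ᵇ a then v else m b

data Op : Set where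
  add sub mul div mod : Op

data Expr : Set where
  lit  : ℕ → Expr
  cell : Expr → Expr
  op   : Op → Expr → Expr → Expr

infixr 5 _⨾_

data Program : Set where
  skip   : Program
  store  : (address value : Expr) → Program
  random : (address bound : Expr) → Program
  _⨾_    : Program → Program → Program
  cond   : Expr → Program → Program → Program
  while  : Expr → Program → Program

-- Division and remainder by 0 give 0.
apply : Op → ℕ → ℕ → ℕ
apply add x y       = x + y
apply sub x y       = x ∸ y
apply mul x y       = x * y
apply div x zero    = 0
apply div x (suc y) = x ℕ./ suc y
apply mod x zero    = 0
apply mod x (suc y) = x ℕ.% suc y

eval : Expr → Mem → ℕ
eval (lit n)    m = n
eval (cell e)   m = m (eval e m)
eval (op o e f) m = apply o (eval e m) (eval f m)

bits : ℕ → ℕ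
bits n = suc ⌊log₂ n ⌋

cost : Expr → Mem → ℕ
cost (lit n)    m = bits n
cost (cell e)   m = cost e m + bits (eval e m) + bits (m (eval e m))
cost (op o e f) m = cost e m + cost f m + bits (eval e m) + bits (eval f m)

-- The first component is the time elapsed so far.
Config : Set
Config = ℕ × Mem

-- The outcome nothing means that the fuel was exhausted.
Outcome : Set
Outcome = Maybe Config

-- A random draw below 0 stores 0.
draw : ℕ → Dist ℕ
draw zero    = ret 0
draw (suc v) = unif (suc v) (λ i → ret (toℕ i))

andThen : Dist Outcome → (Config → Dist Outcome) → Dist Outcome
andThen d k = d >>= maybe′ k (ret nothing)

-- The first argument is fuel limiting the number of loop iterations.
-- Every loop test costs at least 1, so that fuel n never cuts off a
-- computation that takes time at most n.
exec : ℕ → Program → Config → Dist Outcome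
exec n skip         (t , m) = ret (just (suc t , m))
exec n (store a e)  (t , m) =
  ret (just ( t + cost a m + cost e m + bits (eval a m) + bits (eval e m)
            , m [ eval a m ↦ eval e m ]))
exec n (random a e) (t , m) = do
  v ← draw (eval e m)
  ret (just ( t + cost a m + cost e m + bits (eval a m) + bits (eval e m)
            , m [ eval a m ↦ v ]))
exec n (P ⨾ Q)      s       = andThen (exec n P s) (exec n Q)
exec n (cond e P Q) (t , m) with eval e m
... | zero  = exec n Q (t + cost e m , m)
... | suc _ = exec n P (t + cost e m , m)
exec zero    (while e P) s       = ret nothing
exec (suc n) (while e P) (t , m) with eval e m
... | zero  = ret (just (t + cost e m , m))
... | suc _ = andThen (exec n P (t + cost e m , m)) (exec n (while e P))

initial : List ℕ → Mem
initial []       _       = 0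
initial (x ∷ xs) zero    = x
initial (x ∷ xs) (suc a) = initial xs a

-- The input occupies the cells from 0 on; all other cells hold 0.
run : ℕ → Program → List ℕ → Dist Outcome
run n P xs = exec n P (0 , initial xs)

-- Worst case over all random choices.
HaltsWithin : Program → List ℕ → ℕ → Set
HaltsWithin P xs n =
  Always (Any (λ (t , _) → t ≤ n)) (run n P xs)

holds : (Mem → Bool) → Outcome → Bool
holds E = maybe′ (λ (_ , m) → E m) false

outputs : ℕ → Mem → Bool
outputs v m = m 0 ≡ᵇ v

------------------------------------------------------------------------
-- Group ensembles

-- The ensemble is indexed by r ≥ 1; the entry at 0 is never used.  code
-- is the representation of group elements on the machine.
record GroupEnsemble : Set₁ where
  field
    group : ℕ → AbelianGroup 0ℓ 0ℓ
    order : ℕ → ℕ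
    enum  : ∀ r → Inverse (AbelianGroup.setoid (group r)) (setoid (Fin (order r)))
    code  : ∀ r → Injection (AbelianGroup.setoid (group r)) (setoid ℕ)

  G : ℕ → Set
  G r = AbelianGroup.Carrier (group r)

  ⟦_⟧ : ∀ {r} → G r → ℕ
  ⟦_⟧ {r} = Injection.to (code r)

  uniform : ∀ r → Dist (G r)
  uniform r = unif (order r) (λ i → ret (Inverse.from (enum r) i))

  module _ {r : ℕ} where
    open AbelianGroup (group r) public
      using (_≈_)
      renaming (_∙_ to _⊕_; ε to 0ᴳ; _⁻¹ to ⊖_; rawMonoid to rawMonoidᴳ)

  infix 4 _≈?_

  _≈?_ : ∀ {r} → Decidable (_≈_ {r})
  _≈?_ {r} = via-injection (Inverse⇒Injection (enum r)) _≟ᶠ_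

  sumOver : ∀ {r} → Subset r → Vec (G r) r → G r
  sumOver {r} S X = sum (λ i → if lookup S i then lookup X i else 0ᴳ)
    where open RawMonoidDefinitions (rawMonoidᴳ {r}) using (sum)

  densityAt : ℕ → ℕ → Seq
  densityAt k r = (fromℕ k *ᴿ log r) /ᴿ log (order r)

record Admissible (k : ℕ) (𝓖 : GroupEnsemble) (Δ : ℝ) : Set where
  open GroupEnsemble 𝓖
  field
    sampler      : Program
    samplerTime  : ℕ → ℕ
    samplerBound : ∃[ e ] samplerTime ≼
      (λ r → ⌊log₂ order r ⌋ * ⌊log₂ ⌊log₂ order r ⌋ ⌋ ^ e)
    samplerHalts : ∀ r → 1 ≤ r → HaltsWithin sampler (r ∷ []) (samplerTime r)
    samplerExact : ∀ r → 1 ≤ r → (g : G r) →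
      Pr (do o ← run (samplerTime r) sampler (r ∷ [])
             ret (holds (outputs ⟦ g ⟧) o))
      ≡ Pr (do h ← uniform r
               ret (does (h ≈? g)))

    adder        : Program
    adderTime    : ℕ → ℕ
    adderBound   : ∃[ e ] adderTime ≼ (λ r → ⌊log₂ order r ⌋ ^ e)
    adderHalts   : ∀ r → 1 ≤ r → (g h : G r) →
      HaltsWithin adder (r ∷ ⟦ g ⟧ ∷ ⟦ h ⟧ ∷ []) (adderTime r)
    adderCorrect : ∀ r → 1 ≤ r → (g h : G r) →
      Always (λ o → holds (outputs ⟦ g ⊕ h ⟧) o ≡ true)
             (run (adderTime r) adder (r ∷ ⟦ g ⟧ ∷ ⟦ h ⟧ ∷ []))

    -- The next two fields make the divisions by log |G| and by Δ
    -- meaningful.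
    nontrivial   : ∀ r → 1 ≤ r → 2 ≤ order r
    positive     : fromℕ 0 <ᴿ seq Δ
    density      : Converges (densityAt k) (seq Δ)
    rate         : ∀ r → 1 ≤ r →
      absᴿ (densityAt k r -ᴿ seq Δ) /ᴿ seq Δ ≤ᴿ fromℕ 1 /ᴿ log (order r)

------------------------------------------------------------------------
-- The k-SUM problems

subsets : ∀ n → List (Subset n)
subsets zero    = [] ∷ []
subsets (suc n) = map (outside ∷_) (subsets n) ++ map (inside ∷_) (subsets n)

subsetsOfSize : ∀ k n → List (Subset n)
subsetsOfSize k n = filter (λ S → ∣ S ∣ ≟ⁿ k) (subsets n)

least : ∀ {n} → Subset n → Maybe (Fin n)
least []            = nothing
least (inside  ∷ S) = just zero
least (outside ∷ S) = Maybe.map suc (least S)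

module KSum (k : ℕ) (𝓖 : GroupEnsemble) where
  open GroupEnsemble 𝓖

  plant : ∀ {r} → Subset r → Vec (G r) r → Vec (G r) r
  plant S X with least S
  ... | nothing = X
  ... | just i  = X [ i ]≔ (⊖ sumOver (S - i) X)

  D₀ : ∀ r → Dist (Vec (G r) r)
  D₀ r = iid r (uniform r)

  -- Only meaningful for 1 ≤ k ≤ r.
  D₁ : ∀ r → Dist (Vec (G r) r)
  D₁ r = do
    X ← iid r (uniform r)
    S ← uniformFrom (subsetsOfSize k r)
    ret (plant S X)

  -- r is stored in cell 0 and the i-th group element in cell i (1 ≤ i ≤ r).
  encode : ∀ {r} → Vec (G r) r → List ℕ
  encode {r} X = r ∷ toList (Vec.map ⟦_⟧ X)

  -- A set S' ⊆ [r] is output as an indicator vector in cells 1, …, r.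
  decode : ∀ r → Mem → Subset r
  decode r m = tabulate (λ i → if m (suc (toℕ i)) ≡ᵇ 0 then outside else inside)

  solves : ∀ {r} → Vec (G r) r → Subset r → Bool
  solves X S′ = (∣ S′ ∣ ≡ᵇ k) ∧ does (sumOver S′ X ≈? 0ᴳ)

  RunsInTime : Program → (ℕ → ℕ) → Set
  RunsInTime P T = ∀ r → 1 ≤ r → (X : Vec (G r) r) →
    HaltsWithin P (encode X) (T r)

  -- Below, T is a bound on the running time of P, so that run (T r)
  -- yields the complete output distribution.  D₁ is defined for r ≥ k only.

  SolvesDecision : Program → (T : ℕ → ℕ) → (ε : ℕ → ℝ) → Set
  SolvesDecision P T ε = ∀ r → 1 ≤ r → k ≤ r →
      seq (ε r) ≤ᴿ fromℚ (Pr (do X ← D₀ r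
                                 o ← run (T r) P (encode X)
                                 ret (holds (outputs 0) o)))
    × seq (ε r) ≤ᴿ fromℚ (Pr (do X ← D₁ r
                                 o ← run (T r) P (encode X)
                                 ret (holds (outputs 1) o)))

  SolvesPlantedSearch : Program → (T : ℕ → ℕ) → (ε : ℕ → ℝ) → Set
  SolvesPlantedSearch P T ε = ∀ r → 1 ≤ r → k ≤ r →
      seq (ε r) ≤ᴿ fromℚ (Pr (do X ← D₁ r
                                 o ← run (T r) P (encode X)
                                 ret (holds (solves X ∘ decode r) o)))

-- Resample every input element independently with probability 1/2, run the
-- decision algorithm on the result, and, if it accepts, add 1 to the score
-- of every element that was resampled.  If an element of the planted set is
-- resampled, the new input is uniform and hence rarely accepted; if the
-- planted set is spared, the new input is distributed like the old one and
-- hence usually accepted.  So a single trial credits an element i with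
-- probability close to 0 if i is planted, and with probability at least
-- about 2 ^ -(k + 1) otherwise.  Over D trials in each of H = ⌊log₂ r⌋ + 1
-- rounds, the planted elements are exactly those with a score below H, up
-- to a small error probability.  As the decision error tends to 0 without
-- any rate, no union bound over the trials is available: the k planted
-- elements are handled by Markov's inequality, and the r - k others by an
-- exponential moment bound for those inputs that are decided well on
-- average over the resampling.

module Submission where

open import Defs
open import Algebra.Bundles using (AbelianGroup; CommutativeRing)
import Algebra.Properties.AbelianGroup as AbelianGroupProperties
import Algebra.Properties.CommutativeMonoid.Sum as CommutativeMonoidSum
import Algebra.Properties.Semiring.Sum as SemiringSum
open import Data.Bool.Base as Bool using (Bool; true; false; if_then_else_; _∧_; not)
import Data.Bool.Properties as Bool
open import Data.Empty using (⊥; ⊥-elim)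
open import Data.Fin.Base using (Fin; zero; suc; toℕ; fromℕ<)
open import Data.Fin.Permutation using (Permutation; permutation; _⟨$⟩ʳ_)
import Data.Fin.Properties as Fin
open import Data.Fin.Subset using (Subset; inside; outside; ∣_∣; _-_; _─_) renaming (⊥ to ∅)
open import Data.Integer.Base as ℤ using (+_; -[1+_]; +≤+)
import Data.Integer.Properties as ℤ
open import Data.List.Base as List using (List; []; _∷_; length)
open import Data.List.Membership.Propositional using (_∈_)
open import Data.List.Membership.Propositional.Properties
  using (∈-filter⁺; ∈-filter⁻; ∈-++⁺ˡ; ∈-++⁺ʳ; ∈-map⁺; ∈-lookup; ∈-cartesianProductWith⁺; ∈-allFin)
open import Data.List.Relation.Unary.Any as Any using (here; there)
open import Data.Maybe.Base using (Maybe; just; nothing; maybe′)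
import Data.Maybe.Relation.Unary.Any as Maybe
open import Data.Nat.Base
  using (ℕ; zero; suc; _+_; _*_; _∸_; _^_; _≤_; _<_; z≤n; s≤s; ⌊_/2⌋; _≡ᵇ_; _≤ᵇ_; _<ᵇ_; _⊔_; >-nonZero; NonZero)
import Data.Nat.DivMod as ℕ
open import Data.Nat.Induction using (<-rec)
open import Data.Nat.Logarithm
  using (⌊log₂_⌋; ⌊log₂⌋-mono-≤; ⌊log₂⌊n/2⌋⌋≡⌊log₂n⌋∸1; ⌊log₂[2^n]⌋≡n)
import Data.Nat.Properties as ℕ
open import Data.Nat.Tactic.RingSolver using (solve-∀)
open import Data.Product.Base using (∃-syntax; Σ-syntax; _×_; _,_; proj₁; proj₂)
open import Data.Rational.Base as ℚ using (ℚ; 0ℚ; 1ℚ; ½)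
import Data.Rational.Properties as ℚ
open import Data.Rational.Solver using (module +-*-Solver)
import Data.Rational.Unnormalised.Base as ℚᵘ
import Data.Rational.Unnormalised.Properties as ℚᵘ
open import Data.Sum.Base using (inj₁; inj₂)
open import Data.Unit.Base using (⊤; tt)
open import Data.Vec.Base as Vec using (Vec; []; _∷_; lookup; toList; zipWith; replicate; _[_]≔_)
import Data.Vec.Properties as Vec
open import Function.Base using (_∘_; id; _$_; case_of_)
open import Function.Bundles using (module Equivalence; module Injection; module Inverse)
open import Relation.Binary.PropositionalEquality
open import Relation.Nullary using (Dec; yes; no; does; ¬_)
open import Relation.Nullary.Decidable using (dec-true; dec-false; _×-dec_)

-- The number of trials per round, D = 7 * 2 ^ (k + 3), depends on k alone; only the number H of
-- rounds grows with r. For a planted element the expected total score is at most H * D times the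
-- decision error, and Markov's inequality at the threshold H cancels the factor H, so a decision
-- error tending to 0 at any speed is enough. For another element D trials shrink the mean of 2 ^ (-
-- score) by the factor 1/8, so its score stays below H with probability at most 2 ^ H * 8 ^ (- H) =
-- 4 ^ (- H), which the union over r < 2 ^ H elements turns into 2 ^ (- H). The rest concerns
-- machines. The decision algorithm and the sampler are black boxes that expect zeroed memory, may
-- write anywhere, and come without a clock; each run gets memory of its own. Positivity and
-- convergence of the density give log |G| = O(log r), so that samples cost polylog r, and Δ < 1
-- gives r = O(T), which pays for writing the inputs. The success probability has to reach γ for
-- every r, hence the table for all r below a fixed limit.

module ∑ = SemiringSum (CommutativeRing.semiring ℚ.+-*-commutativeRing)
open ∑ using (sum)

private variable
  A B C : Set

-- Rational arithmetic

ι : ℕ → ℚ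
ι n = + n ℚ./ 1

ι-+ : ∀ m n → ι (m + n) ≡ ι m ℚ.+ ι n
ι-+ m n = ℚ.toℚᵘ-injective (ℚᵘ.≃-trans (ℚ.toℚᵘ-fromℚᵘ (ℚᵘ.mkℚᵘ (+ (m + n)) 0))
  (ℚᵘ.≃-trans (ℚᵘ.*≡* (cong (ℤ._* + 1) (trans (ℤ.pos-+ m n) (sym (cong₂ ℤ._+_ (ℤ.*-identityʳ (+ m)) (ℤ.*-identityʳ (+ n)))))))
  (ℚᵘ.≃-sym (ℚᵘ.≃-trans (ℚ.toℚᵘ-homo-+ (ι m) (ι n))
    (ℚᵘ.+-cong (ℚ.toℚᵘ-fromℚᵘ (ℚᵘ.mkℚᵘ (+ m) 0)) (ℚ.toℚᵘ-fromℚᵘ (ℚᵘ.mkℚᵘ (+ n) 0)))))))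

ι-* : ∀ m n → ι (m * n) ≡ ι m ℚ.* ι n
ι-* m n = ℚ.toℚᵘ-injective (ℚᵘ.≃-trans (ℚ.toℚᵘ-fromℚᵘ (ℚᵘ.mkℚᵘ (+ (m * n)) 0))
  (ℚᵘ.≃-trans (ℚᵘ.*≡* (cong (ℤ._* + 1) (ℤ.pos-* m n)))
  (ℚᵘ.≃-sym (ℚᵘ.≃-trans (ℚ.toℚᵘ-homo-* (ι m) (ι n))
    (ℚᵘ.*-cong (ℚ.toℚᵘ-fromℚᵘ (ℚᵘ.mkℚᵘ (+ m) 0)) (ℚ.toℚᵘ-fromℚᵘ (ℚᵘ.mkℚᵘ (+ n) 0)))))))

ι-mono : ∀ {m n} → m ≤ n → ι m ℚ.≤ ι n
ι-mono {m} {n} m≤n = ℚ.toℚᵘ-cancel-≤ (begin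
  ℚ.toℚᵘ (ι m)       ≃⟨ ℚ.toℚᵘ-fromℚᵘ (ℚᵘ.mkℚᵘ (+ m) 0) ⟩
  ℚᵘ.mkℚᵘ (+ m) 0    ≤⟨ ℚᵘ.*≤* (ℤ.*-monoʳ-≤-nonNeg (+ 1) (+≤+ m≤n)) ⟩
  ℚᵘ.mkℚᵘ (+ n) 0    ≃⟨ ℚ.toℚᵘ-fromℚᵘ (ℚᵘ.mkℚᵘ (+ n) 0) ⟨
  ℚ.toℚᵘ (ι n)       ∎)
  where open ℚᵘ.≤-Reasoning

ι-cancel : ∀ {m n} → ι m ℚ.≤ ι n → m ≤ n
ι-cancel {m} {n} p = ℤ.drop‿+≤+ (subst₂ ℤ._≤_ (ℤ.*-identityʳ (+ m)) (ℤ.*-identityʳ (+ n)) (ℚᵘ.drop-*≤* q))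
  where
  open ℚᵘ.≤-Reasoning
  q : ℚᵘ.mkℚᵘ (+ m) 0 ℚᵘ.≤ ℚᵘ.mkℚᵘ (+ n) 0
  q = begin
    ℚᵘ.mkℚᵘ (+ m) 0    ≃⟨ ℚ.toℚᵘ-fromℚᵘ (ℚᵘ.mkℚᵘ (+ m) 0) ⟨
    ℚ.toℚᵘ (ι m)       ≤⟨ ℚ.toℚᵘ-mono-≤ p ⟩
    ℚ.toℚᵘ (ι n)       ≃⟨ ℚ.toℚᵘ-fromℚᵘ (ℚᵘ.mkℚᵘ (+ n) 0) ⟩
    ℚᵘ.mkℚᵘ (+ n) 0    ∎

/≡ι* : ∀ m n → + m ℚ./ suc n ≡ ι m ℚ.* (+ 1 ℚ./ suc n)
/≡ι* m n = ℚ.toℚᵘ-injective (ℚᵘ.≃-trans (ℚ.toℚᵘ-fromℚᵘ (ℚᵘ.mkℚᵘ (+ m) n))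
  (ℚᵘ.≃-trans (ℚᵘ.*≡* (trans (cong (λ x → + m ℤ.* + x) (cong suc (ℕ.+-identityʳ n))) (cong (ℤ._* + suc n) (sym (ℤ.*-identityʳ (+ m))))))
  (ℚᵘ.≃-sym (ℚᵘ.≃-trans (ℚ.toℚᵘ-homo-* (ι m) (+ 1 ℚ./ suc n))
    (ℚᵘ.*-cong (ℚ.toℚᵘ-fromℚᵘ (ℚᵘ.mkℚᵘ (+ m) 0)) (ℚ.toℚᵘ-fromℚᵘ (ℚᵘ.mkℚᵘ (+ 1) n)))))))

n/n≡1 : ∀ n → (+ 1 ℚ./ suc n) ℚ.* ι (suc n) ≡ 1ℚ
n/n≡1 n = trans (ℚ.*-comm (+ 1 ℚ./ suc n) (ι (suc n))) (trans (sym (/≡ι* (suc n) n))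
  (ℚ.toℚᵘ-injective (ℚᵘ.≃-trans (ℚ.toℚᵘ-fromℚᵘ (ℚᵘ.mkℚᵘ (+ suc n) n))
    (ℚᵘ.*≡* (trans (ℤ.*-identityʳ (+ suc n)) (sym (ℤ.*-identityˡ (+ suc n))))))))

0≤1/ : ∀ n → 0ℚ ℚ.≤ + 1 ℚ./ suc n
0≤1/ n = ℚ.nonNegative⁻¹ _ ⦃ ℚ.normalize-nonNeg 1 (suc n) ⦄

0≤ι : ∀ n → 0ℚ ℚ.≤ ι n
0≤ι n = ι-mono {0} {n} z≤n

0≤1 : 0ℚ ℚ.≤ 1ℚ
0≤1 = 0≤ι 1

*-monoˡ : ∀ {c p q} → 0ℚ ℚ.≤ c → p ℚ.≤ q → c ℚ.* p ℚ.≤ c ℚ.* q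
*-monoˡ {c} 0≤c p≤q = ℚ.*-monoˡ-≤-nonNeg c ⦃ ℚ.nonNegative 0≤c ⦄ p≤q

*-monoʳ : ∀ {c p q} → 0ℚ ℚ.≤ c → p ℚ.≤ q → p ℚ.* c ℚ.≤ q ℚ.* c
*-monoʳ {c} 0≤c p≤q = ℚ.*-monoʳ-≤-nonNeg c ⦃ ℚ.nonNegative 0≤c ⦄ p≤q

*-nonneg : ∀ {p q} → 0ℚ ℚ.≤ p → 0ℚ ℚ.≤ q → 0ℚ ℚ.≤ p ℚ.* q
*-nonneg {p} 0≤p 0≤q = ℚ.≤-trans (ℚ.≤-reflexive (sym (ℚ.*-zeroʳ p))) (*-monoˡ 0≤p 0≤q)

+-nonneg : ∀ {p q} → 0ℚ ℚ.≤ p → 0ℚ ℚ.≤ q → 0ℚ ℚ.≤ p ℚ.+ q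
+-nonneg {p} {q} 0≤p 0≤q = ℚ.≤-trans (ℚ.≤-reflexive (sym (ℚ.+-identityˡ 0ℚ))) (ℚ.+-mono-≤ 0≤p 0≤q)

𝟙 : Bool → ℚ
𝟙 b = if b then 1ℚ else 0ℚ

0≤𝟙 : ∀ b → 0ℚ ℚ.≤ 𝟙 b
0≤𝟙 true  = 0≤1
0≤𝟙 false = ℚ.≤-refl

𝟙≤1 : ∀ b → 𝟙 b ℚ.≤ 1ℚ
𝟙≤1 true  = ℚ.≤-refl
𝟙≤1 false = 0≤1

sum-mono : ∀ {n} {f g : Fin n → ℚ} → (∀ i → f i ℚ.≤ g i) → sum f ℚ.≤ sum g
sum-mono {zero}  f≤g = ℚ.≤-refl
sum-mono {suc n} f≤g = ℚ.+-mono-≤ (f≤g zero) (sum-mono (f≤g ∘ suc))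

sum-const : ∀ n c → sum {n} (λ _ → c) ≡ ι n ℚ.* c
sum-const zero    c = sym (ℚ.*-zeroˡ c)
sum-const (suc n) c = trans (cong (c ℚ.+_) (sum-const n c))
  (trans (cong (ℚ._+ ι n ℚ.* c) (sym (ℚ.*-identityˡ c)))
  (trans (sym (ℚ.*-distribʳ-+ c 1ℚ (ι n))) (cong (ℚ._* c) (sym (ι-+ 1 n)))))

sum-0 : ∀ {n} {f : Fin n → ℚ} → (∀ i → f i ≡ 0ℚ) → sum f ≡ 0ℚ
sum-0 {n} f≡0 = trans (∑.sum-cong-≗ f≡0) (trans (sum-const n 0ℚ) (ℚ.*-zeroʳ (ι n)))

sum-nonneg : ∀ {n} {f : Fin n → ℚ} → (∀ i → 0ℚ ℚ.≤ f i) → 0ℚ ℚ.≤ sum f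
sum-nonneg {n} 0≤f = ℚ.≤-trans (ℚ.≤-reflexive (sym (sum-0 {n} (λ _ → refl)))) (sum-mono 0≤f)

-- Expectations

mean : (n : ℕ) → (Fin n → ℚ) → ℚ
mean zero    f = 0ℚ
mean (suc n) f = (+ 1 ℚ./ suc n) ℚ.* sum f

mean-cong : ∀ n {f g : Fin n → ℚ} → (∀ i → f i ≡ g i) → mean n f ≡ mean n g
mean-cong zero    f≡g = refl
mean-cong (suc n) f≡g = cong ((+ 1 ℚ./ suc n) ℚ.*_) (∑.sum-cong-≗ f≡g)

mean-mono : ∀ n {f g : Fin n → ℚ} → (∀ i → f i ℚ.≤ g i) → mean n f ℚ.≤ mean n g
mean-mono zero    f≤g = ℚ.≤-refl
mean-mono (suc n) f≤g = *-monoˡ (0≤1/ n) (sum-mono f≤g)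

mean-+ : ∀ n (f g : Fin n → ℚ) → mean n (λ i → f i ℚ.+ g i) ≡ mean n f ℚ.+ mean n g
mean-+ zero    f g = sym (ℚ.+-identityˡ 0ℚ)
mean-+ (suc n) f g = trans (cong ((+ 1 ℚ./ suc n) ℚ.*_) (∑.∑-distrib-+ f g)) (ℚ.*-distribˡ-+ (+ 1 ℚ./ suc n) (sum f) (sum g))

x*[y*z]≡y*[x*z] : ∀ x y z → x ℚ.* (y ℚ.* z) ≡ y ℚ.* (x ℚ.* z)
x*[y*z]≡y*[x*z] x y z = trans (sym (ℚ.*-assoc x y z)) (trans (cong (ℚ._* z) (ℚ.*-comm x y)) (ℚ.*-assoc y x z))

mean-* : ∀ n c (f : Fin n → ℚ) → mean n (λ i → c ℚ.* f i) ≡ c ℚ.* mean n f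
mean-* zero    c f = sym (ℚ.*-zeroʳ c)
mean-* (suc n) c f = trans (cong ((+ 1 ℚ./ suc n) ℚ.*_) (sym (∑.*-distribˡ-sum c f)))
  (x*[y*z]≡y*[x*z] (+ 1 ℚ./ suc n) c (sum f))

mean-const : ∀ n c → mean (suc n) (λ _ → c) ≡ c
mean-const n c = trans (cong ((+ 1 ℚ./ suc n) ℚ.*_) (sum-const (suc n) c))
  (trans (sym (ℚ.*-assoc (+ 1 ℚ./ suc n) (ι (suc n)) c)) (trans (cong (ℚ._* c) (n/n≡1 n)) (ℚ.*-identityˡ c)))

mean-const≤ : ∀ n {c} → 0ℚ ℚ.≤ c → mean n (λ _ → c) ℚ.≤ c
mean-const≤ zero    0≤c = 0≤c
mean-const≤ (suc n) 0≤c = ℚ.≤-reflexive (mean-const n _)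

mean-comm : ∀ m n (f : Fin m → Fin n → ℚ) →
  mean m (λ i → mean n (f i)) ≡ mean n (λ j → mean m (λ i → f i j))
mean-comm zero    zero    f = refl
mean-comm zero    (suc n) f = sym (mean-const n 0ℚ)
mean-comm (suc m) zero    f = mean-const m 0ℚ
mean-comm (suc m) (suc n) f = begin
  a ℚ.* sum (λ i → b ℚ.* sum (f i))              ≡⟨ cong (a ℚ.*_) (∑.*-distribˡ-sum b (λ i → sum (f i))) ⟨
  a ℚ.* (b ℚ.* sum (λ i → sum (f i)))            ≡⟨ cong (λ s → a ℚ.* (b ℚ.* s)) (∑.∑-comm f) ⟩
  a ℚ.* (b ℚ.* sum (λ j → sum (λ i → f i j)))    ≡⟨ x*[y*z]≡y*[x*z] a b _ ⟩
  b ℚ.* (a ℚ.* sum (λ j → sum (λ i → f i j)))    ≡⟨ cong (b ℚ.*_) (∑.*-distribˡ-sum a (λ j → sum (λ i → f i j))) ⟩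
  b ℚ.* sum (λ j → a ℚ.* sum (λ i → f i j))      ∎
  where
  open ≡-Reasoning
  a = + 1 ℚ./ suc m
  b = + 1 ℚ./ suc n

mean-permute : ∀ n (f : Fin n → ℚ) (π : Permutation n n) → mean n f ≡ mean n (f ∘ (π ⟨$⟩ʳ_))
mean-permute zero    f π = refl
mean-permute (suc n) f π = cong ((+ 1 ℚ./ suc n) ℚ.*_) (∑.sum-permute f π)

E : {A : Set} → Dist A → (A → ℚ) → ℚ
E (ret a)    φ = φ a
E (unif n f) φ = mean n (λ i → E (f i) φ)

-- The empty draw `unif 0` has no mass, so a constant is its own expectation only where no such draw
-- occurs. Upper bounds by nonnegative constants hold for every `Dist`.
data Proper {A : Set} : Dist A → Set where
  ret  : ∀ a → Proper (ret a)
  unif : ∀ n {f} → (∀ i → Proper (f i)) → Proper (unif (suc n) f)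

Pr≡E : ∀ d → Pr d ≡ E d 𝟙
Pr≡E (ret b)          = refl
Pr≡E (unif zero f)    = refl
Pr≡E (unif (suc n) f) = cong ((+ 1 ℚ./ suc n) ℚ.*_) (∑.sum-cong-≗ (λ i → Pr≡E (f i)))

E-cong : ∀ (d : Dist A) {φ ψ} → (∀ a → φ a ≡ ψ a) → E d φ ≡ E d ψ
E-cong (ret a)    φ≡ψ = φ≡ψ a
E-cong (unif n f) φ≡ψ = mean-cong n (λ i → E-cong (f i) φ≡ψ)

E-mono-Always : ∀ {P : A → Set} (d : Dist A) {φ ψ} → Always P d →
  (∀ a → P a → φ a ℚ.≤ ψ a) → E d φ ℚ.≤ E d ψ
E-mono-Always (ret a)    Pd φ≤ψ = φ≤ψ a Pd
E-mono-Always (unif n f) Pd φ≤ψ = mean-mono n (λ i → E-mono-Always (f i) (Pd i) φ≤ψ)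

E-mono : ∀ (d : Dist A) {φ ψ} → (∀ a → φ a ℚ.≤ ψ a) → E d φ ℚ.≤ E d ψ
E-mono (ret a)    φ≤ψ = φ≤ψ a
E-mono (unif n f) φ≤ψ = mean-mono n (λ i → E-mono (f i) φ≤ψ)

E-+ : ∀ (d : Dist A) φ ψ → E d (λ a → φ a ℚ.+ ψ a) ≡ E d φ ℚ.+ E d ψ
E-+ (ret a)    φ ψ = refl
E-+ (unif n f) φ ψ = trans (mean-cong n (λ i → E-+ (f i) φ ψ)) (mean-+ n _ _)

E-* : ∀ (d : Dist A) c φ → E d (λ a → c ℚ.* φ a) ≡ c ℚ.* E d φ
E-* (ret a)    c φ = refl
E-* (unif n f) c φ = trans (mean-cong n (λ i → E-* (f i) c φ)) (mean-* n c _)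

E-0 : ∀ (d : Dist A) → E d (λ _ → 0ℚ) ≡ 0ℚ
E-0 d = trans (E-* d 0ℚ (λ _ → 0ℚ)) (ℚ.*-zeroˡ (E d (λ _ → 0ℚ)))

E-nonneg : ∀ (d : Dist A) {φ} → (∀ a → 0ℚ ℚ.≤ φ a) → 0ℚ ℚ.≤ E d φ
E-nonneg d 0≤φ = ℚ.≤-trans (ℚ.≤-reflexive (sym (E-0 d))) (E-mono d 0≤φ)

E-const : ∀ {d : Dist A} → Proper d → ∀ c → E d (λ _ → c) ≡ c
E-const (ret a)    c = refl
E-const (unif n p) c = trans (mean-cong (suc n) (λ i → E-const (p i) c)) (mean-const n c)

E-const≤ : ∀ (d : Dist A) {c} → 0ℚ ℚ.≤ c → E d (λ _ → c) ℚ.≤ c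
E-const≤ (ret a)    0≤c = ℚ.≤-refl
E-const≤ (unif n f) 0≤c = ℚ.≤-trans (mean-mono n (λ i → E-const≤ (f i) 0≤c)) (mean-const≤ n 0≤c)

E-≤const : ∀ (d : Dist A) {c φ} → 0ℚ ℚ.≤ c → (∀ a → φ a ℚ.≤ c) → E d φ ℚ.≤ c
E-≤const d 0≤c φ≤c = ℚ.≤-trans (E-mono d φ≤c) (E-const≤ d 0≤c)

E->>= : ∀ (d : Dist A) (k : A → Dist B) φ → E (d >>= k) φ ≡ E d (λ a → E (k a) φ)
E->>= (ret a)    k φ = refl
E->>= (unif n f) k φ = mean-cong n (λ i → E->>= (f i) k φ)

E-mean : ∀ (d : Dist A) n (φ : Fin n → A → ℚ) →
  E d (λ a → mean n (λ i → φ i a)) ≡ mean n (λ i → E d (φ i))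
E-mean (ret a)    n φ = refl
E-mean (unif m f) n φ = trans (mean-cong m (λ j → E-mean (f j) n φ)) (mean-comm m n _)

E-swap : ∀ (d : Dist A) (e : Dist B) (φ : A → B → ℚ) →
  E d (λ a → E e (φ a)) ≡ E e (λ b → E d (λ a → φ a b))
E-swap d (ret b)    φ = refl
E-swap d (unif n f) φ = trans (E-mean d n _) (mean-cong n (λ i → E-swap d (f i) φ))

E-sum : ∀ (d : Dist A) {n} (φ : Fin n → A → ℚ) →
  E d (λ a → sum (λ i → φ i a)) ≡ sum (λ i → E d (φ i))
E-sum d {zero}  φ = E-0 d
E-sum d {suc n} φ = trans (E-+ d (φ zero) _) (cong (E d (φ zero) ℚ.+_) (E-sum d (φ ∘ suc)))

Always-map : ∀ {P Q : A → Set} (d : Dist A) → (∀ a → P a → Q a) → Always P d → Always Q d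
Always-map (ret a)    P⇒Q p = P⇒Q a p
Always-map (unif n f) P⇒Q p = λ i → Always-map (f i) P⇒Q (p i)

Always->>=⁺ : ∀ {P : B → Set} (d : Dist A) {k : A → Dist B} →
  Always (λ a → Always P (k a)) d → Always P (d >>= k)
Always->>=⁺ (ret a)    p = p
Always->>=⁺ (unif n f) p = λ i → Always->>=⁺ (f i) (p i)

Always->>=⁻ : ∀ {P : B → Set} (d : Dist A) {k : A → Dist B} →
  Always P (d >>= k) → Always (λ a → Always P (k a)) d
Always->>=⁻ (ret a)    p = p
Always->>=⁻ (unif n f) p = λ i → Always->>=⁻ (f i) (p i)

Proper->>= : ∀ {d : Dist A} {k : A → Dist B} → Proper d → (∀ a → Proper (k a)) → Proper (d >>= k)
Proper->>= (ret a)    q = q a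
Proper->>= (unif n p) q = unif n (λ i → Proper->>= (p i) q)

+-cancelˡ-≤ : ∀ r {p q} → r ℚ.+ p ℚ.≤ r ℚ.+ q → p ℚ.≤ q
+-cancelˡ-≤ r {p} {q} le = subst₂ ℚ._≤_ (lem p r) (lem q r) (ℚ.+-monoʳ-≤ (ℚ.- r) le)
  where
  open +-*-Solver
  lem : ∀ p r → ℚ.- r ℚ.+ (r ℚ.+ p) ≡ p
  lem = solve 2 (λ p r → :- r :+ (r :+ p) := p) refl

-- After multiplication by n, the other terms account for at most n - 1, which leaves at least 1 for
-- `f i`.
1≤mean⇒1≤ : ∀ n {f : Fin n → ℚ} → (∀ i → f i ℚ.≤ 1ℚ) → 1ℚ ℚ.≤ mean n f → ∀ i → 1ℚ ℚ.≤ f i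
1≤mean⇒1≤ (suc n) {f} f≤1 1≤m i = +-cancelˡ-≤ (ι n) (begin
  ι n ℚ.+ 1ℚ                        ≡⟨ ι-+ n 1 ⟨
  ι (n + 1)                         ≡⟨ cong ι (ℕ.+-comm n 1) ⟩
  ι (suc n)                         ≡⟨ ℚ.*-identityʳ (ι (suc n)) ⟨
  ι (suc n) ℚ.* 1ℚ                  ≤⟨ *-monoˡ (0≤ι (suc n)) 1≤m ⟩
  ι (suc n) ℚ.* ((+ 1 ℚ./ suc n) ℚ.* sum f)  ≡⟨ ℚ.*-assoc (ι (suc n)) (+ 1 ℚ./ suc n) (sum f) ⟨
  ι (suc n) ℚ.* (+ 1 ℚ./ suc n) ℚ.* sum f    ≡⟨ cong (ℚ._* sum f) (trans (ℚ.*-comm (ι (suc n)) (+ 1 ℚ./ suc n)) (n/n≡1 n)) ⟩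
  1ℚ ℚ.* sum f                      ≡⟨ ℚ.*-identityˡ (sum f) ⟩
  sum f                             ≡⟨ ∑.sum-remove {i = i} f ⟩
  f i ℚ.+ sum {n} _                 ≤⟨ ℚ.+-monoʳ-≤ (f i) (sum-mono {n} (λ j → f≤1 _)) ⟩
  f i ℚ.+ sum {n} (λ _ → 1ℚ)        ≡⟨ cong (f i ℚ.+_) (trans (sum-const n 1ℚ) (ℚ.*-identityʳ (ι n))) ⟩
  f i ℚ.+ ι n                       ≡⟨ ℚ.+-comm (f i) (ι n) ⟩
  ι n ℚ.+ f i                       ∎)
  where open ℚ.≤-Reasoning

-- Every branch of a `Dist` has positive weight, so an event of probability 1 holds on all of them.
-- This turns the exact output probabilities of the sampler into a guarantee for each of its runs.
1≤E⇒Always : ∀ (d : Dist A) {φ} → (∀ a → φ a ℚ.≤ 1ℚ) → 1ℚ ℚ.≤ E d φ → Always (λ a → 1ℚ ℚ.≤ φ a) d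
1≤E⇒Always (ret a)    φ≤1 p = p
1≤E⇒Always (unif n f) φ≤1 p = λ i →
  1≤E⇒Always (f i) φ≤1 (1≤mean⇒1≤ n (λ j → E-≤const (f j) 0≤1 φ≤1) p i)

-- Refinement

-- Only lower bounds for expectations transfer from the ideal distribution
-- μ to d, which is all that a success probability needs.
record Refines {A B : Set} (d : Dist B) (μ : Dist A) (R : A → B → Set) : Set where
  constructor refines
  field
    always : Always (λ b → ∃[ a ] R a b) d
    lower  : ∀ (φ : A → ℚ) (ψ : B → ℚ) → (∀ b → 0ℚ ℚ.≤ ψ b) →
      (∀ a b → R a b → φ a ℚ.≤ ψ b) → E μ φ ℚ.≤ E d ψ

open Refines public

Refines-ret : ∀ {R : A → B → Set} {a b} → R a b → Refines (ret b) (ret a) R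
Refines-ret Rab = refines (_ , Rab) λ φ ψ _ φ≤ψ → φ≤ψ _ _ Rab

Refines-unif : ∀ {R : A → B → Set} n {f g} → (∀ i → Refines (f i) (g i) R) → Refines (unif n f) (unif n g) R
Refines-unif n ref = refines (λ i → always (ref i)) λ φ ψ 0≤ψ φ≤ψ → mean-mono n (λ i → lower (ref i) φ ψ 0≤ψ φ≤ψ)

-- For related `a` and `b` the inner refinements yield exactly the pointwise inequality between
-- conditional expectations that the outer one asks for.
Refines->>= : ∀ {A B C D : Set} {R : A → B → Set} {S : C → D → Set} {d : Dist B} {μ : Dist A}
  {k : B → Dist D} {ν : A → Dist C} → Refines d μ R →
  (∀ a b → R a b → Refines (k b) (ν a) S) → Refines (d >>= k) (μ >>= ν) S
Refines->>= {d = d} {μ} {k} {ν} ref refs = refines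
  (Always->>=⁺ d (Always-map d (λ b (a , Rab) → always (refs a b Rab)) (always ref)))
  λ φ ψ 0≤ψ φ≤ψ → subst₂ ℚ._≤_ (sym (E->>= μ ν φ)) (sym (E->>= d k ψ))
    (lower ref _ _ (λ b → E-nonneg (k b) 0≤ψ) (λ a b Rab → lower (refs a b Rab) φ ψ 0≤ψ φ≤ψ))

Refines-map : ∀ {C : Set} {R : A → B → Set} {S : C → B → Set} {d : Dist B} {μ : Dist A} (f : A → C) →
  Refines d μ R → (∀ a b → R a b → S (f a) b) → Refines d (μ >>= (ret ∘ f)) S
Refines-map {d = d} {μ} f ref R⇒S = refines
  (Always-map d (λ b (a , Rab) → f a , R⇒S a b Rab) (always ref))
  λ φ ψ 0≤ψ φ≤ψ → ℚ.≤-trans (ℚ.≤-reflexive (E->>= μ (ret ∘ f) φ))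
    (lower ref (φ ∘ f) ψ 0≤ψ (λ a b Rab → φ≤ψ (f a) b (R⇒S a b Rab)))

Refines-weaken : ∀ {R S : A → B → Set} {d : Dist B} {μ : Dist A} →
  (∀ a b → R a b → S a b) → Refines d μ R → Refines d μ S
Refines-weaken {d = d} R⇒S ref = refines
  (Always-map d (λ b (a , Rab) → a , R⇒S a b Rab) (always ref))
  λ φ ψ 0≤ψ φ≤ψ → lower ref φ ψ 0≤ψ (λ a b Rab → φ≤ψ a b (R⇒S a b Rab))

Refines-≡ : ∀ {R : A → B → Set} {d : Dist B} {μ ν : Dist A} →
  (∀ φ → E ν φ ≡ E μ φ) → Refines d μ R → Refines d ν R
Refines-≡ ν≡μ ref = refines (always ref) λ φ ψ 0≤ψ φ≤ψ →
  ℚ.≤-trans (ℚ.≤-reflexive (ν≡μ φ)) (lower ref φ ψ 0≤ψ φ≤ψ)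

-- Bit lengths

n<2^bits : ∀ n → n < 2 ^ bits n
n<2^bits = <-rec _ go
  where
  go : ∀ n → (∀ {m} → m < n → m < 2 ^ bits m) → n < 2 ^ bits n
  go 0 rec = s≤s z≤n
  go 1 rec = s≤s (s≤s z≤n)
  go n@(suc (suc m)) rec = begin-strict
    n                              <⟨ n<2+2⌊n/2⌋ n ⟩
    2 * suc ⌊ n /2⌋                ≤⟨ ℕ.*-monoʳ-≤ 2 (rec (ℕ.⌊n/2⌋<n (suc m))) ⟩
    2 * (2 ^ bits ⌊ n /2⌋)         ≡⟨ cong (λ l → 2 * (2 ^ l)) (trans (cong suc (⌊log₂⌊n/2⌋⌋≡⌊log₂n⌋∸1 n)) (ℕ.m+[n∸m]≡n {1} (⌊log₂⌋-mono-≤ {2} {n} (s≤s (s≤s z≤n))))) ⟩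
    2 * (2 ^ ⌊log₂ n ⌋)            ∎
    where
    open ℕ.≤-Reasoning
    n<2+2⌊n/2⌋ : ∀ n → n < 2 * suc ⌊ n /2⌋
    n<2+2⌊n/2⌋ 0 = s≤s z≤n
    n<2+2⌊n/2⌋ 1 = s≤s (s≤s z≤n)
    n<2+2⌊n/2⌋ (suc (suc n)) = subst (suc (suc n) <_) (sym (ℕ.*-suc 2 (suc ⌊ n /2⌋))) (s≤s (s≤s (n<2+2⌊n/2⌋ n)))

2^log≤n : ∀ n → 1 ≤ n → 2 ^ ⌊log₂ n ⌋ ≤ n
2^log≤n = <-rec _ go
  where
  go : ∀ n → (∀ {m} → m < n → 1 ≤ m → 2 ^ ⌊log₂ m ⌋ ≤ m) → 1 ≤ n → 2 ^ ⌊log₂ n ⌋ ≤ n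
  go 1 rec _ = s≤s z≤n
  go n@(suc (suc m)) rec _ = begin
    2 ^ ⌊log₂ n ⌋                  ≡⟨ cong (2 ^_) (trans (cong suc (⌊log₂⌊n/2⌋⌋≡⌊log₂n⌋∸1 n)) (ℕ.m+[n∸m]≡n {1} (⌊log₂⌋-mono-≤ {2} {n} (s≤s (s≤s z≤n))))) ⟨
    2 * (2 ^ ⌊log₂ ⌊ n /2⌋ ⌋)      ≤⟨ ℕ.*-monoʳ-≤ 2 (rec (ℕ.⌊n/2⌋<n (suc m)) (s≤s z≤n)) ⟩
    2 * ⌊ n /2⌋                    ≤⟨ 2⌊n/2⌋≤n n ⟩
    n                              ∎
    where
    open ℕ.≤-Reasoning
    2⌊n/2⌋≤n : ∀ n → 2 * ⌊ n /2⌋ ≤ n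
    2⌊n/2⌋≤n 0 = z≤n
    2⌊n/2⌋≤n 1 = z≤n
    2⌊n/2⌋≤n (suc (suc n)) = subst (_≤ suc (suc n)) (sym (ℕ.*-suc 2 ⌊ n /2⌋)) (s≤s (s≤s (2⌊n/2⌋≤n n)))

1≤bits : ∀ n → 1 ≤ bits n
1≤bits n = s≤s z≤n

bits-mono : ∀ {m n} → m ≤ n → bits m ≤ bits n
bits-mono m≤n = s≤s (⌊log₂⌋-mono-≤ m≤n)

n<2^s⇒bits≤s : ∀ n s → 1 ≤ s → n < 2 ^ s → bits n ≤ s
n<2^s⇒bits≤s zero    s 1≤s _  = 1≤s
n<2^s⇒bits≤s (suc n) s _   n< with ℕ.≤-total s ⌊log₂ suc n ⌋
... | inj₁ s≤l = ⊥-elim (ℕ.<-irrefl refl (ℕ.<-≤-trans n< (ℕ.≤-trans (ℕ.^-monoʳ-≤ 2 s≤l) (2^log≤n (suc n) (s≤s z≤n)))))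
... | inj₂ l≤s with ℕ.m≤n⇒m<n∨m≡n l≤s
...   | inj₁ l<s  = l<s
...   | inj₂ refl = ⊥-elim (ℕ.<-irrefl refl (ℕ.<-≤-trans n< (2^log≤n (suc n) (s≤s z≤n))))

bits-* : ∀ m n → bits (m * n) ≤ bits m + bits n
bits-* m n = n<2^s⇒bits≤s (m * n) (bits m + bits n) (s≤s z≤n)
  (subst (m * n <_) (sym (ℕ.^-distribˡ-+-* 2 (bits m) (bits n))) (ℕ.*-mono-< (n<2^bits m) (n<2^bits n)))

bits-+ : ∀ m n → bits (m + n) ≤ bits m + bits n
bits-+ m n = n<2^s⇒bits≤s (m + n) (bits m + bits n) (s≤s z≤n) (begin-strict
  m + n                        <⟨ ℕ.+-mono-< (n<2^bits m) (n<2^bits n) ⟩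
  -- The two powers are `2 * y` and `2 * x` with x and y at least 1, so each is at most half of
  -- their product.
  2 ^ bits m + 2 ^ bits n      ≤⟨ ℕ.+-mono-≤ (ℕ.m≤m*n (2 ^ bits m) x) (ℕ.m≤n*m (2 ^ bits n) y) ⟩
  2 ^ bits m * x + y * 2 ^ bits n  ≡⟨ lem x y ⟩
  2 ^ bits m * 2 ^ bits n      ≡⟨ ℕ.^-distribˡ-+-* 2 (bits m) (bits n) ⟨
  2 ^ (bits m + bits n)        ∎)
  where
  open ℕ.≤-Reasoning
  x = 2 ^ ⌊log₂ n ⌋
  y = 2 ^ ⌊log₂ m ⌋
  instance
    _ : NonZero x
    _ = ℕ.m^n≢0 2 ⌊log₂ n ⌋
    _ : NonZero y
    _ = ℕ.m^n≢0 2 ⌊log₂ m ⌋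
  lem : ∀ x y → 2 * y * x + y * (2 * x) ≡ 2 * y * (2 * x)
  lem = solve-∀

-- Program logic

exec-cond-suc : ∀ {n e P Q t m v} → eval e m ≡ suc v → exec n (cond e P Q) (t , m) ≡ exec n P (t + cost e m , m)
exec-cond-suc {e = e} {m = m} e≡ with eval e m
exec-cond-suc refl | suc _ = refl

exec-cond-zero : ∀ {n e P Q t m} → eval e m ≡ 0 → exec n (cond e P Q) (t , m) ≡ exec n Q (t + cost e m , m)
exec-cond-zero {e = e} {m = m} e≡ with eval e m
exec-cond-zero refl | zero = refl

exec-while-suc : ∀ {n e P t m v} → eval e m ≡ suc v →
  exec (suc n) (while e P) (t , m) ≡ andThen (exec n P (t + cost e m , m)) (exec n (while e P))
exec-while-suc {e = e} {m = m} e≡ with eval e m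
exec-while-suc refl | suc _ = refl

exec-while-zero : ∀ {n e P t m} → eval e m ≡ 0 → exec (suc n) (while e P) (t , m) ≡ ret (just (t + cost e m , m))
exec-while-zero {e = e} {m = m} e≡ with eval e m
exec-while-zero refl | zero = refl

Post : ℕ → (A → Mem → Set) → A → Outcome → Set
Post b R a nothing        = ⊥
Post b R a (just (t , m)) = t ≤ b × R a m

-- The time bound b also bounds the fuel needed, since every loop test
-- costs at least 1.
record Triple {A : Set} (m : Mem) (P : Program) (b : ℕ) (μ : Dist A) (R : A → Mem → Set) : Set where
  constructor triple
  field
    from : ∀ n t → b ≤ n → Refines (exec n P (t , m)) μ (Post (t + b) R)

open Triple public

Post-mono : ∀ {b b′} {R S : A → Mem → Set} → b ≤ b′ → (∀ a m → R a m → S a m) →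
  ∀ a o → Post b R a o → Post b′ S a o
Post-mono b≤b′ R⇒S a (just (t , m)) (t≤b , Ram) = ℕ.≤-trans t≤b b≤b′ , R⇒S a m Ram

Triple-mono : ∀ {m P b b′} {μ : Dist A} {R S : A → Mem → Set} → b ≤ b′ → (∀ a m′ → R a m′ → S a m′) →
  Triple m P b μ R → Triple m P b′ μ S
Triple-mono b≤b′ R⇒S tr = triple λ n t b′≤n →
  Refines-weaken (Post-mono (ℕ.+-monoʳ-≤ t b≤b′) R⇒S) (from tr n t (ℕ.≤-trans b≤b′ b′≤n))

Triple-cast : ∀ {m P b b′} {μ : Dist A} {R : A → Mem → Set} → b ≡ b′ → Triple m P b μ R → Triple m P b′ μ R
Triple-cast refl tr = tr

Triple-skip : ∀ {m} {R : A → Mem → Set} {a} → R a m → Triple m skip 1 (ret a) R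
Triple-skip Ram = triple λ n t _ → Refines-ret (ℕ.≤-reflexive (ℕ.+-comm 1 t) , Ram)

Triple-map : ∀ {m P b} {μ : Dist A} {R : A → Mem → Set} {S : C → Mem → Set} (f : A → C) →
  (∀ a m′ → R a m′ → S (f a) m′) → Triple m P b μ R → Triple m P b (μ >>= (ret ∘ f)) S
Triple-map f R⇒S tr = triple λ n t b≤n → Refines-map f (from tr n t b≤n) λ { a (just (t , m)) (p , q) → p , R⇒S a m q }

Refines-andThen : ∀ {b} {R : A → Mem → Set} {S : C → Outcome → Set} {d : Dist Outcome} {k} {μ : Dist A} {ν} →
  Refines d μ (Post b R) → (∀ a t m → t ≤ b → R a m → Refines (k (t , m)) (ν a) S) →
  Refines (andThen d k) (μ >>= ν) S
Refines-andThen ref refs = Refines->>= ref λ { a (just (t , m)) (t≤b , Ram) → refs a t m t≤b Ram }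

Triple-⨾ : ∀ {m P Q b c} {μ : Dist A} {ν : A → Dist C} {R : A → Mem → Set} {S : C → Mem → Set} →
  Triple m P b μ R → (∀ a m′ → R a m′ → Triple m′ Q c (ν a) S) → Triple m (P ⨾ Q) (b + c) (μ >>= ν) S
Triple-⨾ {b = b} {c} trP trQ = triple λ n t b+c≤n →
  Refines-andThen (from trP n t (ℕ.≤-trans (ℕ.m≤m+n b c) b+c≤n)) λ a t′ m′ t′≤ Ram →
    Refines-weaken (Post-mono (ℕ.≤-trans (ℕ.+-monoˡ-≤ c t′≤) (ℕ.≤-reflexive (ℕ.+-assoc t b c))) (λ _ _ → id))
      (from (trQ a m′ Ram) n t′ (ℕ.≤-trans (ℕ.m≤n+m c b) b+c≤n))

Triple-cond-suc : ∀ {m e P Q b c v} {μ : Dist A} {R : A → Mem → Set} →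
  eval e m ≡ suc v → cost e m ≤ b → Triple m P c μ R → Triple m (cond e P Q) (b + c) μ R
Triple-cond-suc {m = m} {e} {P} {Q} {b} {c} {v} e≡ cost≤ tr = triple λ n t b+c≤n →
  subst (λ d → Refines d _ _) (sym (exec-cond-suc {e = e} e≡)) $
  Refines-weaken (Post-mono (ℕ.≤-trans (ℕ.+-monoˡ-≤ c (ℕ.+-monoʳ-≤ t cost≤)) (ℕ.≤-reflexive (ℕ.+-assoc t b c))) (λ _ _ → id))
    (from tr n (t + cost e m) (ℕ.≤-trans (ℕ.m≤n+m c b) b+c≤n))

Triple-cond-zero : ∀ {m e P Q b c} {μ : Dist A} {R : A → Mem → Set} →
  eval e m ≡ 0 → cost e m ≤ b → Triple m Q c μ R → Triple m (cond e P Q) (b + c) μ R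
Triple-cond-zero {m = m} {e} {P} {Q} {b} {c} e≡ cost≤ tr = triple λ n t b+c≤n →
  subst (λ d → Refines d _ _) (sym (exec-cond-zero {e = e} e≡)) $
  Refines-weaken (Post-mono (ℕ.≤-trans (ℕ.+-monoˡ-≤ c (ℕ.+-monoʳ-≤ t cost≤)) (ℕ.≤-reflexive (ℕ.+-assoc t b c))) (λ _ _ → id))
    (from tr n (t + cost e m) (ℕ.≤-trans (ℕ.m≤n+m c b) b+c≤n))

1≤cost : ∀ e m → 1 ≤ cost e m
1≤cost (lit n)    m = 1≤bits n
1≤cost (cell e)   m = ℕ.≤-trans (1≤bits (m (eval e m))) (ℕ.m≤n+m (bits (m (eval e m))) (cost e m + bits (eval e m)))
1≤cost (op o e f) m = ℕ.≤-trans (1≤bits (eval f m)) (ℕ.m≤n+m (bits (eval f m)) (cost e m + cost f m + bits (eval e m)))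

Triple-while-exit : ∀ {m e P b} {R : A → Mem → Set} {a} →
  eval e m ≡ 0 → cost e m ≤ b → R a m → Triple m (while e P) b (ret a) R
Triple-while-exit {m = m} {e} {P} e≡ cost≤ Ram = triple λ where
  zero    t b≤0 → ⊥-elim (ℕ.n≮0 (ℕ.≤-trans (ℕ.≤-trans (1≤cost e m) cost≤) b≤0))
  (suc n) t _   → subst (λ d → Refines d _ _) (sym (exec-while-zero {e = e} e≡))
    (Refines-ret (ℕ.+-monoʳ-≤ t cost≤ , Ram))

-- Unrolling takes one unit of fuel, and the test takes at least one unit of time; hence fuel never
-- runs out before time.
Triple-while-step : ∀ {m e P b c d v} {μ : Dist A} {ν : A → Dist C} {R : A → Mem → Set} {S : C → Mem → Set} →
  eval e m ≡ suc v → cost e m ≤ b → Triple m P c μ R →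
  (∀ a m′ → R a m′ → Triple m′ (while e P) d (ν a) S) →
  Triple m (while e P) (b + c + d) (μ >>= ν) S
Triple-while-step {m = m} {e} {P} {b} {c} {d} e≡ cost≤ tr trs = triple λ {
  zero t b+c+d≤0 → ⊥-elim (ℕ.n≮0 (ℕ.≤-trans (ℕ.≤-trans (ℕ.≤-trans (1≤cost e m) cost≤)
    (ℕ.≤-trans (ℕ.m≤m+n b c) (ℕ.m≤m+n (b + c) d))) b+c+d≤0)) ;
  (suc n) t b+c+d≤n → let c+d≤n = fuel n b+c+d≤n in
    subst (λ d → Refines d _ _) (sym (exec-while-suc {e = e} e≡)) $
    Refines-andThen (from tr n (t + cost e m) (ℕ.≤-trans (ℕ.m≤m+n c d) c+d≤n)) λ a t′ m′ t′≤ Ram →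
      Refines-weaken (Post-mono (begin
        t′ + d                  ≤⟨ ℕ.+-monoˡ-≤ d t′≤ ⟩
        t + cost e m + c + d    ≤⟨ ℕ.+-monoˡ-≤ d (ℕ.+-monoˡ-≤ c (ℕ.+-monoʳ-≤ t cost≤)) ⟩
        t + b + c + d           ≡⟨ lem t b c d ⟩
        t + (b + c + d)         ∎) (λ _ _ → id))
        (from (trs a m′ Ram) n t′ (ℕ.≤-trans (ℕ.m≤n+m d c) c+d≤n)) }
  where
  open ℕ.≤-Reasoning
  lem : ∀ t b c d → t + b + c + d ≡ t + (b + c + d)
  lem = solve-∀
  fuel : ∀ n → b + c + d ≤ suc n → c + d ≤ n
  fuel n b+c+d≤n = ℕ.≤-pred (begin
    1 + (c + d)    ≤⟨ ℕ.+-monoˡ-≤ (c + d) (ℕ.≤-trans (1≤cost e m) cost≤) ⟩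
    b + (c + d)    ≡⟨ ℕ.+-assoc b c d ⟨
    b + c + d      ≤⟨ b+c+d≤n ⟩
    suc n          ∎)

iter : ℕ → (A → Dist A) → A → Dist A
iter zero    f a = ret a
iter (suc n) f a = f a >>= iter n f

-- The invariant is indexed by the number of iterations still to come. As that number does not
-- depend on the random choices, the ideal counterpart of the loop is a plain `iter`.
Triple-while : ∀ {e P b c} (f : A → Dist A) (I : ℕ → A → Mem → Set) →
  (∀ j a m → I (suc j) a m → (∃[ v ] eval e m ≡ suc v) × cost e m ≤ b × Triple m P c (f a) (I j)) →
  (∀ a m → I 0 a m → eval e m ≡ 0 × cost e m ≤ b) →
  ∀ j a m → I j a m → Triple m (while e P) (j * (b + c) + b) (iter j f a) (I 0)
Triple-while {e = e} f I step exit zero    a m Iam = Triple-while-exit {e = e} (proj₁ (exit a m Iam)) (proj₂ (exit a m Iam)) Iam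
Triple-while {e = e} {b = b} {c} f I step exit (suc j) a m Iam with step j a m Iam
... | (v , e≡) , cost≤ , tr = Triple-cast (sym (ℕ.+-assoc (b + c) (j * (b + c)) b))
  (Triple-while-step {e = e} e≡ cost≤ tr (Triple-while f I step exit j))

-- The trials of a round are unrolled in the program text, which is possible because their number D
-- is a constant; no counter has to be kept in memory.
rep : ℕ → Program → Program
rep zero    P = skip
rep (suc n) P = P ⨾ rep n P

Triple-rep : ∀ {P c} (f : A → Dist A) (I : ℕ → A → Mem → Set) →
  (∀ j a m → I (suc j) a m → Triple m P c (f a) (I j)) →
  ∀ j a m → I j a m → Triple m (rep j P) (j * c + 1) (iter j f a) (I 0)
Triple-rep f I step zero    a m Iam = Triple-skip Iam
Triple-rep {c = c} f I step (suc j) a m Iam = Triple-cast (sym (ℕ.+-assoc c (j * c) 1))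
  (Triple-⨾ (step j a m Iam) (Triple-rep f I step j))

Triple-store : ∀ {m a e b} {R : A → Mem → Set} {x} →
  cost a m + cost e m + bits (eval a m) + bits (eval e m) ≤ b →
  R x (m [ eval a m ↦ eval e m ]) → Triple m (store a e) b (ret x) R
Triple-store {m = m} {a} {e} {b} cost≤ Rx = triple λ n t _ → Refines-ret
  (ℕ.≤-trans (ℕ.≤-reflexive (lem t (cost a m) (cost e m) (bits (eval a m)) (bits (eval e m)))) (ℕ.+-monoʳ-≤ t cost≤) , Rx)
  where
  lem : ∀ t x y z w → t + x + y + z + w ≡ t + (x + y + z + w)
  lem = solve-∀

coin : Dist Bool
coin = unif 2 λ { zero → ret false ; (suc zero) → ret true }

𝟚 : Bool → ℕ
𝟚 b = if b then 1 else 0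

Triple-coin : ∀ {m a b} →
  cost a m + bits 2 + bits (eval a m) + bits 2 ≤ b →
  Triple m (random a (lit 2)) b coin (λ x m′ → m′ ≡ m [ eval a m ↦ 𝟚 x ])
Triple-coin {m} {a} {b} cost≤ = triple λ n t _ → Refines-unif 2 λ
  { zero → Refines-ret (t≤ t , refl) ; (suc zero) → Refines-ret (t≤ t , refl) }
  where
  lem : ∀ t x y z w → t + x + y + z + w ≡ t + (x + y + z + w)
  lem = solve-∀
  t≤ : ∀ t → t + cost a m + bits 2 + bits (eval a m) + bits 2 ≤ t + b
  t≤ t = ℕ.≤-trans (ℕ.≤-reflexive (lem t (cost a m) (bits 2) (bits (eval a m)) (bits 2))) (ℕ.+-monoʳ-≤ t cost≤)

-- Memory updates, regions and the confinement of programs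

≡ᵇ-refl : ∀ n → (n ≡ᵇ n) ≡ true
≡ᵇ-refl zero    = refl
≡ᵇ-refl (suc n) = ≡ᵇ-refl n

≢⇒≡ᵇ : ∀ {m n} → m ≢ n → (m ≡ᵇ n) ≡ false
≢⇒≡ᵇ {m} {n} m≢n with m ≡ᵇ n in eq
... | false = refl
... | true  = ⊥-elim (m≢n (ℕ.≡ᵇ⇒≡ m n (subst Bool.T (sym eq) tt)))

update-same : ∀ m a v → (m [ a ↦ v ]) a ≡ v
update-same m a v rewrite ≡ᵇ-refl a = refl

update-other : ∀ m {a b} v → b ≢ a → (m [ a ↦ v ]) b ≡ m b
update-other m v b≢a rewrite ≢⇒≡ᵇ b≢a = refl

setReg : (ℕ → Mem) → ℕ → Mem → ℕ → Mem
setReg reg ρ s ρ′ = if ρ′ ≡ᵇ ρ then s else reg ρ′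

setReg-same : ∀ reg ρ s → setReg reg ρ s ρ ≡ s
setReg-same reg ρ s rewrite ≡ᵇ-refl ρ = refl

setReg-other : ∀ reg {ρ ρ′} s → ρ′ ≢ ρ → setReg reg ρ s ρ′ ≡ reg ρ′
setReg-other reg s ρ′≢ρ rewrite ≢⇒≡ᵇ ρ′≢ρ = refl

-- The values R, N and ρ appear as variables, so that bounds for them can be inserted one summand at
-- a time.
cost-affine : ∀ {e₁ e₂ ρE x m R N ρ} → eval e₁ m ≡ R → eval e₂ m ≡ N → eval ρE m ≡ ρ →
  cost (op add e₁ (op add (op mul x e₂) ρE)) m ≡
  cost e₁ m + (cost x m + cost e₂ m + bits (eval x m) + bits N + cost ρE m + bits (eval x m * N) + bits ρ)
  + bits R + bits (eval x m * N + ρ)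
cost-affine refl refl refl = refl

cost-cell : ∀ {e m a v} → eval e m ≡ a → m a ≡ v → cost (cell e) m ≡ cost e m + bits a + bits v
cost-cell refl refl = refl

eval-affine : ∀ {e₁ e₂ ρE x m R N ρ a} → eval e₁ m ≡ R → eval e₂ m ≡ N → eval ρE m ≡ ρ → eval x m ≡ a →
  eval (op add e₁ (op add (op mul x e₂) ρE)) m ≡ R + (a * N + ρ)
eval-affine refl refl refl refl = refl

-- The memory beyond the input is divided into regions, interleaved so that
-- each of them is unbounded; a program confined to a fresh region runs as
-- if it were started on its own, and no region is ever cleaned up.
module Regions (l : ℕ) where

  rE r+1E sizeE : Expr
  rE    = cell (lit 0)
  r+1E  = op add (lit 1) rE
  sizeE = op mul (lit (suc l)) (op mul r+1E r+1E)

  addrE : Expr → Expr → Expr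
  addrE ρ a = op add r+1E (op add (op mul a sizeE) ρ)

  at : Expr → Expr → Expr
  at ρ a = cell (addrE ρ a)

  confineE : Expr → Expr → Expr
  confineE ρ (lit n)    = lit n
  confineE ρ (cell e)   = at ρ (confineE ρ e)
  confineE ρ (op o e f) = op o (confineE ρ e) (confineE ρ f)

  confine : Expr → Program → Program
  confine ρ skip         = skip
  confine ρ (store a e)  = store (addrE ρ (confineE ρ a)) (confineE ρ e)
  confine ρ (random a e) = random (addrE ρ (confineE ρ a)) (confineE ρ e)
  confine ρ (P ⨾ Q)      = confine ρ P ⨾ confine ρ Q
  confine ρ (cond e P Q) = cond (confineE ρ e) (confine ρ P) (confine ρ Q)
  confine ρ (while e P)  = while (confineE ρ e) (confine ρ P)

  module Layout (r : ℕ) where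

    opaque
      M : ℕ
      M = suc l * (suc r * suc r)

      M-def : M ≡ suc l * (suc r * suc r)
      M-def = refl

      addr : ℕ → ℕ → ℕ
      addr ρ a = suc r + (a * M + ρ)

      addr-def : ∀ ρ a → addr ρ a ≡ suc r + (a * M + ρ)
      addr-def ρ a = refl

    instance
      M≢0 : NonZero M
      M≢0 = subst NonZero (sym M-def) (>-nonZero (s≤s z≤n))

    addr-injective : ∀ {ρ ρ′ a a′} → ρ < M → ρ′ < M → addr ρ a ≡ addr ρ′ a′ → ρ ≡ ρ′ × a ≡ a′
    addr-injective {ρ} {ρ′} {a} {a′} ρ<M ρ′<M eq = ρ≡ρ′ , ℕ.*-cancelʳ-≡ a a′ M
      (ℕ.+-cancelʳ-≡ ρ (a * M) (a′ * M) (trans eq′ (cong (λ z → a′ * M + z) (sym ρ≡ρ′))))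
      where
      eq′ : a * M + ρ ≡ a′ * M + ρ′
      eq′ = ℕ.+-cancelˡ-≡ (suc r) _ _ (trans (sym (addr-def ρ a)) (trans eq (addr-def ρ′ a′)))
      modM : ∀ ρ a → ρ < M → (a * M + ρ) ℕ.% M ≡ ρ
      modM ρ a ρ<M = trans (cong (ℕ._% M) (ℕ.+-comm (a * M) ρ)) (trans (ℕ.[m+kn]%n≡m%n ρ a M) (ℕ.m<n⇒m%n≡m ρ<M))
      ρ≡ρ′ : ρ ≡ ρ′
      ρ≡ρ′ = trans (sym (modM ρ a ρ<M)) (trans (cong (ℕ._% M) eq′) (modM ρ′ a′ ρ′<M))

    -- Only regions below `M` are described, since the addresses of larger ones would collide with
    -- them. `size` is a field of its own because every address is computed from the r in cell 0,
    -- also after the output has begun to overwrite the input.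
    record Rep (m low : Mem) (reg : ℕ → Mem) : Set where
      field
        size : m 0 ≡ r
        low≡ : ∀ a → a ≤ r → m a ≡ low a
        reg≡ : ∀ ρ a → ρ < M → m (addr ρ a) ≡ reg ρ a

    open Rep public

    r<addr : ∀ ρ a → r < addr ρ a
    r<addr ρ a = subst (r <_) (sym (addr-def ρ a)) (s≤s (ℕ.m≤m+n r (a * M + ρ)))

    Rep-ext : ∀ {m low reg reg′} → (∀ ρ a → reg ρ a ≡ reg′ ρ a) → Rep m low reg → Rep m low reg′
    Rep-ext reg≡reg′ rep = record
      { size = size rep
      ; low≡ = low≡ rep
      ; reg≡ = λ ρ a ρ<M → trans (reg≡ rep ρ a ρ<M) (reg≡reg′ ρ a)
      }

    -- Memories are functions that agree only pointwise. The contents of a region may be replaced by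
    -- any `s` with the same cells, in particular by the initial memory of a program to be confined.
    Rep-focus : ∀ {m low reg s} ρ → (∀ a → reg ρ a ≡ s a) → Rep m low reg → Rep m low (setReg reg ρ s)
    Rep-focus {reg = reg} {s} ρ regρ≡s = Rep-ext eq
      where
      eq : ∀ ρ′ a → reg ρ′ a ≡ setReg reg ρ s ρ′ a
      eq ρ′ a with ρ′ ≡ᵇ ρ in e
      ... | false = refl
      ... | true  with ℕ.≡ᵇ⇒≡ ρ′ ρ (subst Bool.T (sym e) tt)
      ...   | refl = regρ≡s a

    Rep-store-focused : ∀ {m low reg s ρ} a v → ρ < M → Rep m low (setReg reg ρ s) →
      Rep (m [ addr ρ a ↦ v ]) low (setReg reg ρ (s [ a ↦ v ]))
    Rep-store-focused {m} {low} {reg} {s} {ρ} a v ρ<M rep = record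
      { size = trans (update-other m {a = addr ρ a} v (ℕ.<⇒≢ (ℕ.≤-<-trans z≤n (r<addr ρ a)))) (size rep)
      ; low≡ = λ b b≤r → trans (update-other m v (ℕ.<⇒≢ (ℕ.≤-<-trans b≤r (r<addr ρ a)))) (low≡ rep b b≤r)
      ; reg≡ = reg≡′
      }
      where
      reg≡′ : ∀ ρ′ b → ρ′ < M → (m [ addr ρ a ↦ v ]) (addr ρ′ b) ≡ setReg reg ρ (s [ a ↦ v ]) ρ′ b
      reg≡′ ρ′ b ρ′<M with ρ′ ℕ.≟ ρ | reg≡ rep ρ′ b ρ′<M
      ... | no ρ′≢ρ | eq = trans (update-other m {a = addr ρ a} v (ρ′≢ρ ∘ proj₁ ∘ addr-injective {a = b} {a′ = a} ρ′<M ρ<M))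
        (trans eq (trans (cong (λ s → s b) (setReg-other reg s ρ′≢ρ)) (cong (λ s → s b) (sym (setReg-other reg (s [ a ↦ v ]) ρ′≢ρ)))))
      ... | yes refl | eq with b ℕ.≟ a
      ...   | yes refl = trans (update-same m (addr ρ a) v)
        (sym (trans (cong (λ s → s b) (setReg-same reg ρ (s [ a ↦ v ]))) (update-same s a v)))
      ...   | no b≢a = trans (update-other m {a = addr ρ a} v (b≢a ∘ proj₂ ∘ addr-injective {a = b} {a′ = a} ρ<M ρ<M))
        (trans eq (trans (cong (λ s → s b) (setReg-same reg ρ s))
        (sym (trans (cong (λ s → s b) (setReg-same reg ρ (s [ a ↦ v ]))) (update-other s v b≢a)))))

    Rep-store : ∀ {m low reg ρ} a v → ρ < M → Rep m low reg →
      Rep (m [ addr ρ a ↦ v ]) low (setReg reg ρ (reg ρ [ a ↦ v ]))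
    Rep-store a v ρ<M rep = Rep-store-focused a v ρ<M (Rep-focus _ (λ _ → refl) rep)

    Rep-store-low : ∀ {m low reg} a v → 1 ≤ a → a ≤ r → Rep m low reg → Rep (m [ a ↦ v ]) (low [ a ↦ v ]) reg
    Rep-store-low {m} {low} {reg} a v 1≤a a≤r rep = record
      { size = trans (update-other m v (ℕ.<⇒≢ 1≤a)) (size rep)
      ; low≡ = low≡′
      ; reg≡ = λ ρ b ρ<M → trans (update-other m v (≢-sym (ℕ.<⇒≢ (ℕ.≤-<-trans a≤r (r<addr ρ b))))) (reg≡ rep ρ b ρ<M)
      }
      where
      low≡′ : ∀ b → b ≤ r → (m [ a ↦ v ]) b ≡ (low [ a ↦ v ]) b
      low≡′ b b≤r with b ≡ᵇ a
      ... | true  = refl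
      ... | false = low≡ rep b b≤r

    -- A bound for all addresses and values that the reduction itself handles.
    U : ℕ
    U = suc r + (suc r * M + M)

    module Sized (w : ℕ) (U≤w : bits U ≤ w) where

      small : ∀ {x} → x ≤ U → bits x ≤ w
      small x≤U = ℕ.≤-trans (bits-mono x≤U) U≤w

      1≤w : 1 ≤ w
      1≤w = ℕ.≤-trans (1≤bits U) U≤w

      M≤U : M ≤ U
      M≤U = ℕ.≤-trans (ℕ.m≤n+m M (suc r * M)) (ℕ.m≤n+m (suc r * M + M) (suc r))

      r+1≤U : suc r ≤ U
      r+1≤U = ℕ.m≤m+n (suc r) (suc r * M + M)

      -- Costs are counted in multiples of the word length w, and the multiplier is computed along
      -- the expression; this is where the numerals in the later time bounds come from.
      record Ev (m : Mem) (e : Expr) (v k : ℕ) : Set where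
        constructor ev
        field
          value : eval e m ≡ v
          time  : cost e m ≤ k * w

      open Ev public

      ev-lit : ∀ {m n} → bits n ≤ w → Ev m (lit n) n 1
      ev-lit n≤w = ev refl (ℕ.≤-trans n≤w (ℕ.≤-reflexive (sym (ℕ.*-identityˡ w))))

      ev-op : ∀ {m e f x y j k} o → Ev m e x j → Ev m f y k → bits x ≤ w → bits y ≤ w →
        Ev m (op o e f) (apply o x y) (j + k + 2)
      ev-op {j = j} {k} o (ev refl e≤) (ev refl f≤) x≤w y≤w = ev refl
        (ℕ.≤-trans (ℕ.+-mono-≤ (ℕ.+-mono-≤ (ℕ.+-mono-≤ e≤ f≤) x≤w) y≤w) (ℕ.≤-reflexive (lem j k w)))
        where
        lem : ∀ j k w → j * w + k * w + w + w ≡ (j + k + 2) * w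
        lem = solve-∀

      ev-cell : ∀ {m e a j} → Ev m e a j → bits a ≤ w → bits (m a) ≤ w → Ev m (cell e) (m a) (j + 2)
      ev-cell {j = j} (ev refl e≤) a≤w ma≤w = ev refl
        (ℕ.≤-trans (ℕ.+-mono-≤ (ℕ.+-mono-≤ e≤ a≤w) ma≤w) (ℕ.≤-reflexive (lem j w)))
        where
        lem : ∀ j w → j * w + w + w ≡ (j + 2) * w
        lem = solve-∀

      ev-≡ : ∀ {m e v v′ k} → v ≡ v′ → Ev m e v k → Ev m e v′ k
      ev-≡ refl e = e

      module _ {m low reg} (rep : Rep m low reg) where

        ev-r : Ev m rE r 3
        ev-r = ev-≡ (size rep) (ev-cell (ev-lit (small z≤n)) (small z≤n)
          (small (ℕ.≤-trans (ℕ.≤-reflexive (size rep)) (ℕ.≤-trans (ℕ.n≤1+n r) r+1≤U))))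

        ev-r+1 : Ev m r+1E (suc r) 6
        ev-r+1 = ev-op add (ev-lit (small (s≤s z≤n))) ev-r (small (s≤s z≤n)) (small (ℕ.≤-trans (ℕ.n≤1+n r) r+1≤U))

        ev-size : Ev m sizeE M 17
        ev-size = ev-≡ (sym M-def) $ ev-op mul (ev-lit l≤) (ev-op mul ev-r+1 ev-r+1 (small r+1≤U) (small r+1≤U)) l≤
          (small (ℕ.≤-trans (ℕ.≤-trans (ℕ.m≤n*m (suc r * suc r) (suc l)) (ℕ.≤-reflexive (sym M-def))) M≤U))
          where
          l≤ : bits (suc l) ≤ w
          l≤ = small (ℕ.≤-trans (ℕ.≤-trans (ℕ.m≤m*n (suc l) (suc r * suc r)) (ℕ.≤-reflexive (sym M-def))) M≤U)

        -- The address is charged in terms of bits a, which is part of the cost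
        -- of accessing cell a in the confined program.
        cost-addrE : ∀ {ρE x ρ j} → Ev m ρE ρ j → ρ < M →
          cost (addrE ρE x) m + bits (addr ρ (eval x m)) ≤ cost x m + (36 + j) * w * bits (eval x m)
        cost-addrE {ρE} {x} {ρ} {j} (ev ρ≡ ρ≤) ρ<M = begin
            cost (addrE ρE x) m + bits (addr ρ a)
              ≡⟨ cong (λ z → z + bits (addr ρ a)) (cost-affine {r+1E} {sizeE} {ρE} {x} (value ev-r+1) (value ev-size) ρ≡) ⟩
            cost r+1E m + (c + cost sizeE m + b + bits M + cost ρE m + bits (a * M) + bits ρ) + bits (suc r) + bits (a * M + ρ) + bits (addr ρ a)
              ≤⟨ ℕ.+-mono-≤ (ℕ.+-mono-≤ (ℕ.+-mono-≤ (ℕ.+-mono-≤ (time ev-r+1)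
                   (ℕ.+-mono-≤ (ℕ.+-mono-≤ (ℕ.+-mono-≤ (ℕ.+-mono-≤ (ℕ.+-monoˡ-≤ b (ℕ.+-monoʳ-≤ c (time ev-size))) (small M≤U)) ρ≤) aM≤) ρ≤w)) (small r+1≤U)) aM+ρ≤) addr≤ ⟩
            6 * w + (c + 17 * w + b + w + j * w + (b + w) + w) + w + (b + w + w) + (w + (b + w + w))
              ≡⟨ lem₁ c b w j ⟩
            c + (4 * (b * 1) + (32 + j) * (w * 1))
              ≤⟨ ℕ.+-monoʳ-≤ c (ℕ.+-mono-≤ (ℕ.*-monoʳ-≤ 4 (ℕ.*-monoʳ-≤ b 1≤w)) (ℕ.*-monoʳ-≤ (32 + j) (ℕ.*-monoʳ-≤ w (1≤bits a)))) ⟩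
            c + (4 * (b * w) + (32 + j) * (w * b))
              ≡⟨ lem₂ c b w j ⟩
            c + (36 + j) * w * b
              ∎
          where
          open ℕ.≤-Reasoning
          a = eval x m
          b = bits a
          c = cost x m
          ρ≤w : bits ρ ≤ w
          ρ≤w = small (ℕ.≤-trans (ℕ.<⇒≤ ρ<M) M≤U)
          aM≤ : bits (a * M) ≤ b + w
          aM≤ = ℕ.≤-trans (bits-* a M) (ℕ.+-monoʳ-≤ b (small M≤U))
          aM+ρ≤ : bits (a * M + ρ) ≤ b + w + w
          aM+ρ≤ = ℕ.≤-trans (bits-+ (a * M) ρ) (ℕ.+-mono-≤ aM≤ ρ≤w)
          addr≤ : bits (addr ρ a) ≤ w + (b + w + w)
          addr≤ = ℕ.≤-trans (ℕ.≤-reflexive (cong bits (addr-def ρ a))) $ ℕ.≤-trans (bits-+ (suc r) (a * M + ρ)) (ℕ.+-mono-≤ (small r+1≤U) aM+ρ≤)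
          lem₁ : ∀ c b w j → 6 * w + (c + 17 * w + b + w + j * w + (b + w) + w) + w + (b + w + w) + (w + (b + w + w)) ≡ c + (4 * (b * 1) + (32 + j) * (w * 1))
          lem₁ = solve-∀
          lem₂ : ∀ c b w j → c + (4 * (b * w) + (32 + j) * (w * b)) ≡ c + (36 + j) * w * b
          lem₂ = solve-∀

        addr≤U : ∀ {ρ a} → ρ < M → a ≤ suc r → addr ρ a ≤ U
        addr≤U {ρ} {a} ρ<M a≤ = ℕ.≤-trans (ℕ.≤-reflexive (addr-def ρ a)) $ ℕ.+-monoʳ-≤ (suc r) (ℕ.+-mono-≤ (ℕ.*-monoˡ-≤ M a≤) (ℕ.<⇒≤ ρ<M))

        eval-addrE : ∀ {ρE aE ρ a} → eval ρE m ≡ ρ → eval aE m ≡ a → eval (addrE ρE aE) m ≡ addr ρ a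
        eval-addrE {ρE} {aE} {ρ} {a} ρ≡ a≡ = trans (eval-affine {r+1E} {sizeE} {ρE} {aE} (value ev-r+1) (value ev-size) ρ≡ a≡) (sym (addr-def ρ a))

        ev-addr : ∀ {ρE aE ρ a j k} → Ev m ρE ρ j → Ev m aE a k → ρ < M → a ≤ suc r → Ev m (addrE ρE aE) (addr ρ a) (29 + j + k)
        ev-addr {ρE} {aE} {ρ} {a} {j} {k} evρ eva ρ<M a≤ = record
          { value = eval-addrE {ρE} {aE} (value evρ) (value eva)
          ; time  = ℕ.≤-trans (time (ev-op add ev-r+1 (ev-op add (ev-op mul eva ev-size
              (small (ℕ.≤-trans a≤ r+1≤U)) (small M≤U)) evρ
              (small (ℕ.≤-trans (ℕ.m≤m+n (a * M) ρ) aM+ρ≤U)) (small (ℕ.≤-trans (ℕ.<⇒≤ ρ<M) M≤U)))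
              (small r+1≤U) (small aM+ρ≤U)))
              (ℕ.≤-reflexive (cong (_* w) (lem j k)))
          }
          where
          aM+ρ≤U : a * M + ρ ≤ U
          aM+ρ≤U = ℕ.≤-trans (ℕ.m≤n+m (a * M + ρ) (suc r)) (ℕ.≤-trans (ℕ.≤-reflexive (sym (addr-def ρ a))) (addr≤U ρ<M a≤))
          lem : ∀ j k → 6 + (k + 17 + 2 + j + 2) + 2 ≡ 29 + j + k
          lem = solve-∀

        ev-at : ∀ {ρE aE ρ a j k} → Ev m ρE ρ j → Ev m aE a k → ρ < M → a ≤ suc r → bits (reg ρ a) ≤ w →
          Ev m (at ρE aE) (reg ρ a) (29 + j + k + 2)
        ev-at {ρ = ρ} {a} evρ eva ρ<M a≤ v≤w = ev-≡ (reg≡ rep ρ a ρ<M)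
          (ev-cell (ev-addr evρ eva ρ<M a≤) (small (addr≤U ρ<M a≤))
            (ℕ.≤-trans (ℕ.≤-reflexive (cong bits (reg≡ rep ρ a ρ<M))) v≤w))

        ev-low : ∀ {aE a k} → Ev m aE a k → a ≤ r → bits (low a) ≤ w → Ev m (cell aE) (low a) (k + 2)
        ev-low {a = a} eva a≤r v≤w = ev-≡ (low≡ rep a a≤r)
          (ev-cell eva (small (ℕ.≤-trans a≤r (ℕ.≤-trans (ℕ.n≤1+n r) r+1≤U)))
            (ℕ.≤-trans (ℕ.≤-reflexive (cong bits (low≡ rep a a≤r))) v≤w))

        -- The address accounts for 29 + i + j words and the write for two more. The caller states a
        -- numeral b, and its comparison with the exact count is left to evaluation.
        Triple-store-at : ∀ b {ρE aE eE ρ a v i j k} {R : A → Mem → Set} {x} →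
          Ev m ρE ρ i → Ev m aE a j → Ev m eE v k → ρ < M → a ≤ suc r → bits v ≤ w →
          {Bool.T (31 + i + j + k ≤ᵇ b)} →
          (∀ m′ → Rep m′ low (setReg reg ρ (reg ρ [ a ↦ v ])) → R x m′) →
          Triple m (store (addrE ρE aE) eE) (b * w) (ret x) R
        Triple-store-at b {ρE} {aE} {eE} {ρ} {a} {v} {i} {j} {k} {R} {x} evρ eva eve ρ<M a≤ v≤w {k≤b} post =
          Triple-store
            (ℕ.≤-trans (ℕ.+-mono-≤ (ℕ.+-mono-≤ (ℕ.+-mono-≤ (time ev′) (time eve))
                (ℕ.≤-trans (ℕ.≤-reflexive (cong bits (value ev′))) (small (addr≤U ρ<M a≤))))
                (ℕ.≤-trans (ℕ.≤-reflexive (cong bits (value eve))) v≤w))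
              (ℕ.≤-trans (ℕ.≤-reflexive (lem i j k w)) (ℕ.*-monoˡ-≤ w (ℕ.≤ᵇ⇒≤ (31 + i + j + k) b k≤b))))
            (subst₂ (λ α β → R x (m [ α ↦ β ])) (sym (value ev′)) (sym (value eve))
              (post _ (Rep-store a v ρ<M rep)))
          where
          ev′ = ev-addr evρ eva ρ<M a≤
          lem : ∀ i j k w → (29 + i + j) * w + k * w + w + w ≡ (31 + i + j + k) * w
          lem = solve-∀

        Triple-store-low : ∀ b {aE eE a v j k} {R : A → Mem → Set} {x} →
          Ev m aE a j → Ev m eE v k → 1 ≤ a → a ≤ r → bits v ≤ w →
          {Bool.T (2 + j + k ≤ᵇ b)} →
          (∀ m′ → Rep m′ (low [ a ↦ v ]) reg → R x m′) →
          Triple m (store aE eE) (b * w) (ret x) R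
        Triple-store-low b {aE} {eE} {a} {v} {j} {k} {R} {x} eva eve 1≤a a≤r v≤w {k≤b} post =
          Triple-store
            (ℕ.≤-trans (ℕ.+-mono-≤ (ℕ.+-mono-≤ (ℕ.+-mono-≤ (time eva) (time eve))
                (ℕ.≤-trans (ℕ.≤-reflexive (cong bits (value eva))) (small (ℕ.≤-trans a≤r (ℕ.≤-trans (ℕ.n≤1+n r) r+1≤U)))))
                (ℕ.≤-trans (ℕ.≤-reflexive (cong bits (value eve))) v≤w))
              (ℕ.≤-trans (ℕ.≤-reflexive (lem j k w)) (ℕ.*-monoˡ-≤ w (ℕ.≤ᵇ⇒≤ (2 + j + k) b k≤b))))
            (subst₂ (λ α β → R x (m [ α ↦ β ])) (sym (value eva)) (sym (value eve))
              (post _ (Rep-store-low a v 1≤a a≤r rep)))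
          where
          lem : ∀ j k w → j * w + k * w + w + w ≡ (2 + j + k) * w
          lem = solve-∀

        Triple-coin-at : ∀ b {ρE aE ρ a i j} →
          Ev m ρE ρ i → Ev m aE a j → ρ < M → a ≤ suc r → bits 2 ≤ w →
          {Bool.T (32 + i + j ≤ᵇ b)} →
          Triple m (random (addrE ρE aE) (lit 2)) (b * w) coin
            (λ x m′ → Rep m′ low (setReg reg ρ (reg ρ [ a ↦ 𝟚 x ])))
        Triple-coin-at b {ρE} {aE} {ρ} {a} {i} {j} evρ eva ρ<M a≤ 2≤w {k≤b} =
          Triple-mono
            (ℕ.≤-trans (ℕ.+-mono-≤ (ℕ.+-mono-≤ (ℕ.+-mono-≤ (time ev′) 2≤w)
                (ℕ.≤-trans (ℕ.≤-reflexive (cong bits (value ev′))) (small (addr≤U ρ<M a≤)))) 2≤w)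
              (ℕ.≤-trans (ℕ.≤-reflexive (lem i j w)) (ℕ.*-monoˡ-≤ w (ℕ.≤ᵇ⇒≤ (32 + i + j) b k≤b))))
            (λ { x _ refl → subst (λ α → Rep (m [ α ↦ 𝟚 x ]) low (setReg reg ρ (reg ρ [ a ↦ 𝟚 x ]))) (sym (value ev′))
              (Rep-store a (𝟚 x) ρ<M rep) })
            (Triple-coin ℕ.≤-refl)
          where
          ev′ = ev-addr evρ eva ρ<M a≤
          lem : ∀ i j w → (29 + i + j) * w + w + w + w ≡ (32 + i + j) * w
          lem = solve-∀

      module Simulation (low : Mem) (reg : ℕ → Mem) (ρE : Expr) (ρ j : ℕ) (ρ<M : ρ < M)
        (evρ : ∀ {m s} → Rep m low (setReg reg ρ s) → Ev m ρE ρ j) where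

        -- The slowdown caused by confinement. Computing an address costs at most this factor times
        -- its bit length, which the original access already pays once.
        K : ℕ
        K = (36 + j) * w

        1≤K : 1 ≤ K
        1≤K = ℕ.≤-trans 1≤w (ℕ.m≤m+n w ((35 + j) * w))

        x≤K*x : ∀ x → x ≤ K * x
        x≤K*x x = ℕ.≤-trans (ℕ.≤-reflexive (sym (ℕ.*-identityˡ x))) (ℕ.*-monoˡ-≤ x 1≤K)

        State : Mem → Mem → Set
        State s m = Rep m low (setReg reg ρ s)

        eval-confine : ∀ e {s m} → State s m → eval (confineE ρE e) m ≡ eval e s
        eval-confine (lit n)    st = refl
        eval-confine (cell e) {s} {m} st = trans (cong m (eval-addrE st {ρE} {confineE ρE e} (value (evρ st)) (eval-confine e st)))
          (trans (reg≡ st ρ (eval e s) ρ<M) (cong (λ s′ → s′ (eval e s)) (setReg-same reg ρ s)))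
        eval-confine (op o e f) st = cong₂ (apply o) (eval-confine e st) (eval-confine f st)

        cost-confine-addr : ∀ e {s m} → State s m → cost (confineE ρE e) m ≤ K * cost e s →
          cost (addrE ρE (confineE ρE e)) m + bits (addr ρ (eval e s)) ≤ K * (cost e s + bits (eval e s))
        cost-confine-addr e {s} {m} st e≤ =
          subst (λ a → cost (addrE ρE (confineE ρE e)) m + bits (addr ρ a) ≤ K * (cost e s + bits a)) (eval-confine e st) (begin
            cost (addrE ρE e′) m + bits (addr ρ (eval e′ m))   ≤⟨ cost-addrE st {x = e′} (evρ st) ρ<M ⟩
            cost e′ m + K * bits (eval e′ m)                   ≤⟨ ℕ.+-monoˡ-≤ _ e≤ ⟩
            K * cost e s + K * bits (eval e′ m)                ≡⟨ ℕ.*-distribˡ-+ K (cost e s) _ ⟨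
            K * (cost e s + bits (eval e′ m))                  ∎)
          where
          open ℕ.≤-Reasoning
          e′ = confineE ρE e

        cost-confine : ∀ e {s m} → State s m → cost (confineE ρE e) m ≤ K * cost e s
        cost-confine (lit n) st = x≤K*x (bits n)
        cost-confine (cell e) {s} {m} st = begin
            cost (at ρE (confineE ρE e)) m
              ≡⟨ cost-cell {addrE ρE (confineE ρE e)} (eval-addrE st {ρE} {confineE ρE e} (value (evρ st)) (eval-confine e st))
                   (trans (reg≡ st ρ (eval e s) ρ<M) (cong (λ s′ → s′ (eval e s)) (setReg-same reg ρ s))) ⟩
            cost (addrE ρE (confineE ρE e)) m + bits (addr ρ (eval e s)) + bits v
              ≤⟨ ℕ.+-mono-≤ (cost-confine-addr e st (cost-confine e st)) (x≤K*x (bits v)) ⟩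
            K * (cost e s + bits (eval e s)) + K * bits v
              ≡⟨ ℕ.*-distribˡ-+ K _ (bits v) ⟨
            K * (cost e s + bits (eval e s) + bits v)
              ∎
          where
          open ℕ.≤-Reasoning
          v = s (eval e s)
        cost-confine (op o e f) {s} {m} st = begin
          cost (confineE ρE e) m + cost (confineE ρE f) m + bits (eval (confineE ρE e) m) + bits (eval (confineE ρE f) m)
            ≡⟨ cong₂ (λ x y → cost (confineE ρE e) m + cost (confineE ρE f) m + bits x + bits y) (eval-confine e st) (eval-confine f st) ⟩
          cost (confineE ρE e) m + cost (confineE ρE f) m + x + y
            ≤⟨ ℕ.+-mono-≤ (ℕ.+-mono-≤ (ℕ.+-mono-≤ (cost-confine e st) (cost-confine f st)) (x≤K*x x)) (x≤K*x y) ⟩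
          K * cost e s + K * cost f s + K * x + K * y
            ≡⟨ lem K (cost e s) (cost f s) x y ⟩
          K * (cost e s + cost f s + x + y)
            ∎
          where
          open ℕ.≤-Reasoning
          x = bits (eval e s)
          y = bits (eval f s)
          lem : ∀ K a b x y → K * a + K * b + K * x + K * y ≡ K * (a + b + x + y)
          lem = solve-∀

        -- `Q` is whatever is known about all outcomes of the original run; carried in the relation,
        -- it is available again after the confined run.
        Related : ℕ → (Outcome → Set) → Outcome → Outcome → Set
        Related t₀ Q nothing o                       = ⊥
        Related t₀ Q (just (t , s)) nothing          = ⊥
        Related t₀ Q (just (t , s)) (just (t′ , m))  = Q (just (t , s)) × t′ ≤ t₀ + K * t × State s m

        K-+ : ∀ t₀ {t t′ c c′} → t′ ≤ t₀ + K * t → c′ ≤ K * c → t′ + c′ ≤ t₀ + K * (t + c)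
        K-+ t₀ {t} {t′} {c} {c′} t′≤ c′≤ = begin
          t′ + c′                ≤⟨ ℕ.+-mono-≤ t′≤ c′≤ ⟩
          t₀ + K * t + K * c     ≡⟨ lem t₀ K t c ⟩
          t₀ + K * (t + c)       ∎
          where
          open ℕ.≤-Reasoning
          lem : ∀ t₀ K t c → t₀ + K * t + K * c ≡ t₀ + K * (t + c)
          lem = solve-∀

        cost-store : ∀ a e {s m} → State s m →
          cost (addrE ρE (confineE ρE a)) m + cost (confineE ρE e) m + bits (addr ρ (eval a s)) + bits (eval e s) ≤
          K * (cost a s + cost e s + bits (eval a s) + bits (eval e s))
        cost-store a e {s} {m} st = begin
          ca + ce + bits (addr ρ (eval a s)) + y     ≡⟨ lem₁ ca ce (bits (addr ρ (eval a s))) y ⟩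
          (ca + bits (addr ρ (eval a s))) + ce + y   ≤⟨ ℕ.+-mono-≤ (ℕ.+-mono-≤ (cost-confine-addr a st (cost-confine a st)) (cost-confine e st)) (x≤K*x y) ⟩
          K * (cost a s + x) + K * cost e s + K * y  ≡⟨ lem₂ K (cost a s) (cost e s) x y ⟩
          K * (cost a s + cost e s + x + y)          ∎
          where
          open ℕ.≤-Reasoning
          ca = cost (addrE ρE (confineE ρE a)) m
          ce = cost (confineE ρE e) m
          x = bits (eval a s)
          y = bits (eval e s)
          lem₁ : ∀ a b c d → a + b + c + d ≡ a + c + b + d
          lem₁ = solve-∀
          lem₂ : ∀ K a b x y → K * (a + x) + K * b + K * y ≡ K * (a + b + x + y)
          lem₂ = solve-∀

        store-step : ∀ t₀ a e v {Q : Outcome → Set} {t t′ s m α β} → α ≡ addr ρ (eval a s) → β ≡ eval e s →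
          t′ ≤ t₀ + K * t → State s m →
          Q (just (t + cost a s + cost e s + bits (eval a s) + bits (eval e s) , s [ eval a s ↦ v ])) →
          Related t₀ Q
            (just (t + cost a s + cost e s + bits (eval a s) + bits (eval e s) , s [ eval a s ↦ v ]))
            (just (t′ + cost (addrE ρE (confineE ρE a)) m + cost (confineE ρE e) m +
                bits α + bits β , m [ α ↦ v ]))
        store-step t₀ a e v {Q} {t} {t′} {s} {m} refl refl t′≤ st q =
          q , (begin
            t′ + ca + ce + bα + y         ≡⟨ lem t′ ca ce bα y ⟩
            t′ + (ca + ce + bα + y)       ≤⟨ K-+ t₀ t′≤ (cost-store a e st) ⟩
            t₀ + K * (t + (cost a s + cost e s + bits (eval a s) + y))  ≡⟨ cong (λ x → t₀ + K * x) (sym (lem t (cost a s) (cost e s) (bits (eval a s)) y)) ⟩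
            t₀ + K * (t + cost a s + cost e s + bits (eval a s) + y)    ∎)
            , Rep-store-focused (eval a s) v ρ<M st
          where
          open ℕ.≤-Reasoning
          ca = cost (addrE ρE (confineE ρE a)) m
          ce = cost (confineE ρE e) m
          bα = bits (addr ρ (eval a s))
          y = bits (eval e s)
          lem : ∀ t a b c d → t + a + b + c + d ≡ t + (a + b + c + d)
          lem = solve-∀

        -- Every charge grows by a factor of at most K, and the two runs test their loops in
        -- lockstep. As `Q` excludes `nothing`, the original never exhausts its fuel n, so that any
        -- larger n′ suffices for the copy.
        simulate : ∀ n n′ P {t₀ t t′ s m} {Q : Outcome → Set} → ¬ Q nothing → n ≤ n′ → t′ ≤ t₀ + K * t → State s m →
          Always Q (exec n P (t , s)) →
          Refines (exec n′ (confine ρE P) (t′ , m)) (exec n P (t , s)) (Related t₀ Q)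
        simulate-then : ∀ n n′ P {t₀} {Q : Outcome → Set} {d d′} → ¬ Q nothing → n ≤ n′ →
          Refines d′ d (Related t₀ (λ o → Always Q (maybe′ (exec n P) (ret nothing) o))) →
          Refines (andThen d′ (exec n′ (confine ρE P))) (andThen d (exec n P)) (Related t₀ Q)

        simulate n n′ skip {t₀} {t} {t′} ¬Q n≤n′ t′≤ st q = Refines-ret
          (q , subst₂ _≤_ (ℕ.+-comm t′ 1) (cong (λ x → t₀ + K * x) (ℕ.+-comm t 1)) (K-+ t₀ t′≤ (x≤K*x 1)) , st)
        simulate n n′ (store a e) {t₀} {t} {t′} {s} {m} {Q} ¬Q n≤n′ t′≤ st q =
          Refines-ret (subst (λ v → Related t₀ Q (just (t + cost a s + cost e s + bits (eval a s) + bits (eval e s) , s [ eval a s ↦ eval e s ]))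
              (just (t′ + cost (addrE ρE (confineE ρE a)) m + cost (confineE ρE e) m + bits (eval (addrE ρE (confineE ρE a)) m) + bits (eval (confineE ρE e) m) ,
                m [ eval (addrE ρE (confineE ρE a)) m ↦ v ]))) (sym (eval-confine e st))
            (store-step t₀ a e (eval e s) {Q} (eval-addrE st {ρE} {confineE ρE a} (value (evρ st)) (eval-confine a st)) (eval-confine e st) t′≤ st q))
        simulate n n′ (random a e) {t₀} {t} {t′} {s} {m} {Q} ¬Q n≤n′ t′≤ st q =
          subst (λ v → Refines (draw v >>= kₘ) (draw (eval e s) >>= kₛ) (Related t₀ Q)) (sym (eval-confine e st)) (drawn (eval e s) q)
          where
          kₛ kₘ : ℕ → Dist Outcome
          kₛ v = ret (just (t + cost a s + cost e s + bits (eval a s) + bits (eval e s) , s [ eval a s ↦ v ]))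
          kₘ v = ret (just (t′ + cost (addrE ρE (confineE ρE a)) m + cost (confineE ρE e) m + bits (eval (addrE ρE (confineE ρE a)) m) + bits (eval (confineE ρE e) m) ,
                m [ eval (addrE ρE (confineE ρE a)) m ↦ v ]))
          drawn₁ : ∀ v → Q (just (t + cost a s + cost e s + bits (eval a s) + bits (eval e s) , s [ eval a s ↦ v ])) → Refines (kₘ v) (kₛ v) (Related t₀ Q)
          drawn₁ v q = Refines-ret (store-step t₀ a e v {Q} (eval-addrE st {ρE} {confineE ρE a} (value (evρ st)) (eval-confine a st)) (eval-confine e st) t′≤ st q)
          drawn : ∀ u → Always Q (draw u >>= kₛ) → Refines (draw u >>= kₘ) (draw u >>= kₛ) (Related t₀ Q)
          drawn zero    q = drawn₁ 0 q
          drawn (suc u) q = Refines-unif (suc u) (λ i → drawn₁ (toℕ i) (q i))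
        simulate n n′ (P ⨾ P′) {Q = Q} ¬Q n≤n′ t′≤ st q =
          simulate-then n n′ P′ {Q = Q} ¬Q n≤n′ (simulate n n′ P ¬Q n≤n′ t′≤ st (Always->>=⁻ (exec n P _) q))
        simulate n n′ (cond e P P′) {t₀} {t} {t′} {s} {m} {Q} ¬Q n≤n′ t′≤ st q with eval e s in eq
        ... | zero = subst (λ d → Refines d (exec n P′ (t + cost e s , s)) (Related t₀ Q)) (sym (exec-cond-zero {e = confineE ρE e} (trans (eval-confine e st) eq)))
          (simulate n n′ P′ ¬Q n≤n′ (K-+ t₀ t′≤ (cost-confine e st)) st q)
        ... | suc _ = subst (λ d → Refines d (exec n P (t + cost e s , s)) (Related t₀ Q)) (sym (exec-cond-suc {e = confineE ρE e} (trans (eval-confine e st) eq)))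
          (simulate n n′ P ¬Q n≤n′ (K-+ t₀ t′≤ (cost-confine e st)) st q)
        simulate zero    n′       (while e P) ¬Q n≤n′ t′≤ st q = ⊥-elim (¬Q q)
        simulate (suc n) (suc n′) (while e P) {t₀} {t} {t′} {s} {m} {Q} ¬Q (s≤s n≤n′) t′≤ st q with eval e s in eq
        ... | zero = subst (λ d → Refines d (ret (just (t + cost e s , s))) (Related t₀ Q)) (sym (exec-while-zero {e = confineE ρE e} (trans (eval-confine e st) eq)))
          (Refines-ret (q , K-+ t₀ t′≤ (cost-confine e st) , st))
        ... | suc _ = subst (λ d → Refines d (andThen (exec n P (t + cost e s , s)) (exec n (while e P))) (Related t₀ Q)) (sym (exec-while-suc {e = confineE ρE e} (trans (eval-confine e st) eq)))
          (simulate-then n n′ (while e P) {Q = Q} ¬Q n≤n′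
            (simulate n n′ P ¬Q n≤n′ (K-+ t₀ t′≤ (cost-confine e st)) st (Always->>=⁻ (exec n P _) q)))

        simulate-then n n′ P ¬Q n≤n′ ref = Refines->>= ref λ
          { (just (t , s)) (just (t′ , m)) (q , t′≤ , st) → simulate n n′ P ¬Q n≤n′ t′≤ st q }

        Confined : (Outcome → Set) → Outcome → Mem → Set
        Confined Q nothing        m = ⊥
        Confined Q (just (t , s)) m = Q (just (t , s)) × State s m

        Triple-confine : ∀ P {T s m} {Q : Outcome → Set} → ¬ Q nothing → (∀ t s → Q (just (t , s)) → t ≤ T) →
          State s m → Always Q (exec T P (0 , s)) →
          Triple m (confine ρE P) (K * T) (exec T P (0 , s)) (Confined Q)
        Triple-confine P {T} {s} {Q = Q} ¬Q Q⇒≤ st q = triple λ n t K*T≤n →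
          Refines-weaken (λ { (just (u , s)) (just (u′ , m)) (q , u′≤ , st) →
              ℕ.≤-trans u′≤ (ℕ.+-monoʳ-≤ t (ℕ.*-monoʳ-≤ K (Q⇒≤ u s q))) , q , st })
            (simulate T n P {t₀ = t} {0} ¬Q (ℕ.≤-trans (x≤K*x T) K*T≤n) (ℕ.m≤m+n t (K * 0)) st q)

-- Running time bounds the length of memory contents

Grown : ℕ → Outcome → Set
Grown b nothing        = ⊤
Grown b (just (t , m)) = ∀ a → bits (m a) ≤ b + t

module _ {b : ℕ} where

  grown-later : ∀ {t t′ m} → t ≤ t′ → Grown b (just (t , m)) → Grown b (just (t′ , m))
  grown-later t≤t′ grown a = ℕ.≤-trans (grown a) (ℕ.+-monoʳ-≤ b t≤t′)

  grown-update : ∀ {t m a v} → bits v ≤ t → Grown b (just (t , m)) → Grown b (just (t , m [ a ↦ v ]))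
  grown-update {t} {m} {a} v≤t grown c with c ≡ᵇ a
  ... | true  = ℕ.≤-trans v≤t (ℕ.m≤n+m t b)
  ... | false = grown c

  grown-write : ∀ t x y z u {m a v} → bits v ≤ u → Grown b (just (t , m)) → Grown b (just (t + x + y + z + u , m [ a ↦ v ]))
  grown-write t x y z u {m} v≤u grown = grown-update (ℕ.≤-trans v≤u (ℕ.m≤n+m u (t + x + y + z)))
    (grown-later {m = m} (ℕ.≤-trans (ℕ.m≤m+n t x) (ℕ.≤-trans (ℕ.m≤m+n (t + x) y) (ℕ.≤-trans (ℕ.m≤m+n (t + x + y) z) (ℕ.m≤m+n (t + x + y + z) u)))) grown)

  -- Each value written is charged its own length, and a random value the length of its bound, so
  -- cells grow by no more than the elapsed time. This bounds the codes of group elements through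
  -- the sampler, and the output of the decision algorithm through its running time.
  grown-exec : ∀ n P t m → Grown b (just (t , m)) → Always (Grown b) (exec n P (t , m))
  grown-then : ∀ n P (d : Dist Outcome) → Always (Grown b) d → Always (Grown b) (andThen d (exec n P))
  grown-exec n skip         t m grown = grown-later {m = m} (ℕ.n≤1+n t) grown
  grown-exec n (store a e)  t m grown = grown-write t _ _ _ (bits (eval e m)) {m} {eval a m} {eval e m} ℕ.≤-refl grown
  grown-exec n (random a e) t m grown = drawn (eval e m) (cost e m) (eval a m) (bits (eval e m))
      (bits-mono {0} {eval e m} z≤n) (λ i → bits-mono {toℕ i} {eval e m} (ℕ.<⇒≤ (Fin.toℕ<n i)))
    where
    drawn : ∀ u c α x → bits 0 ≤ x → (∀ (i : Fin u) → bits (toℕ i) ≤ x) →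
      Always (Grown b) (draw u >>= λ v → ret (just (t + cost a m + c + bits α + x , m [ α ↦ v ])))
    drawn zero    c α x 0≤x i≤x   = grown-write t (cost a m) c (bits α) x {m} {α} {0} 0≤x grown
    drawn (suc u) c α x 0≤x i≤x i = grown-write t (cost a m) c (bits α) x {m} {α} {toℕ i} (i≤x i) grown
  grown-exec n (P ⨾ Q)      t m grown = grown-then n Q (exec n P (t , m)) (grown-exec n P t m grown)
  grown-exec n (cond e P Q) t m grown with eval e m
  ... | zero  = grown-exec n Q (t + cost e m) m (grown-later {m = m} (ℕ.m≤m+n t (cost e m)) grown)
  ... | suc _ = grown-exec n P (t + cost e m) m (grown-later {m = m} (ℕ.m≤m+n t (cost e m)) grown)
  grown-exec zero    (while e P) t m grown = tt
  grown-exec (suc n) (while e P) t m grown with eval e m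
  ... | zero  = grown-later {m = m} (ℕ.m≤m+n t (cost e m)) grown
  ... | suc _ = grown-then n (while e P) (exec n P (t + cost e m , m))
    (grown-exec n P (t + cost e m) m (grown-later {m = m} (ℕ.m≤m+n t (cost e m)) grown))
  grown-then n P d grown = Always->>=⁺ d (Always-map d (λ { nothing _ → tt ; (just (t , m)) grown → grown-exec n P t m grown }) grown)

proper-draw : ∀ n → Proper (draw n)
proper-draw zero    = ret 0
proper-draw (suc n) = unif n (λ i → ret (toℕ i))

proper-exec : ∀ n P s → Proper (exec n P s)
proper-then : ∀ n P {d} → Proper d → Proper (andThen d (exec n P))
proper-exec n skip         s       = ret _
proper-exec n (store a e)  s       = ret _
proper-exec n (random a e) (t , m) = Proper->>= (proper-draw (eval e m)) (λ _ → ret _)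
proper-exec n (P ⨾ Q)      s       = proper-then n Q (proper-exec n P s)
proper-exec n (cond e P Q) (t , m) with eval e m
... | zero  = proper-exec n Q _
... | suc _ = proper-exec n P _
proper-exec zero    (while e P) s = ret _
proper-exec (suc n) (while e P) (t , m) with eval e m
... | zero  = ret _
... | suc _ = proper-then n (while e P) (proper-exec n P _)
proper-then n P p = Proper->>= p λ { nothing → ret _ ; (just s) → proper-exec n P s }

Always-zip : ∀ {P Q R : A → Set} (d : Dist A) → (∀ a → P a → Q a → R a) → Always P d → Always Q d → Always R d
Always-zip (ret a)    f p q = f a p q
Always-zip (unif n g) f p q = λ i → Always-zip (g i) f (p i) (q i)

1≰0 : ¬ (1ℚ ℚ.≤ 0ℚ)
1≰0 p = ℚ.<-irrefl refl (ℚ.<-≤-trans (ℚ.positive⁻¹ 1ℚ) p)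

sum-delta : ∀ {n} (f : Fin n → ℚ) j {δ : Fin n → Bool} → δ j ≡ true → (∀ i → i ≢ j → δ i ≡ false) →
  sum (λ i → 𝟙 (δ i) ℚ.* f i) ≡ f j
sum-delta {suc n} f zero {δ} δj δi = trans (cong₂ ℚ._+_ (trans (cong (λ b → 𝟙 b ℚ.* f zero) δj) (ℚ.*-identityˡ (f zero)))
  (sum-0 (λ i → trans (cong (λ b → 𝟙 b ℚ.* f (suc i)) (δi (suc i) (λ ()))) (ℚ.*-zeroˡ (f (suc i)))))) (ℚ.+-identityʳ (f zero))
sum-delta {suc n} f (suc j) {δ} δj δi = trans (cong₂ ℚ._+_ (trans (cong (λ b → 𝟙 b ℚ.* f zero) (δi zero (λ ()))) (ℚ.*-zeroˡ (f zero)))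
  (sum-delta (f ∘ suc) j δj (λ i i≢j → δi (suc i) (i≢j ∘ Fin.suc-injective)))) (ℚ.+-identityˡ (f (suc j)))

term≤sum : ∀ {n} (f : Fin n → ℚ) i → (∀ j → 0ℚ ℚ.≤ f j) → f i ℚ.≤ sum f
term≤sum f zero    0≤f = ℚ.≤-trans (ℚ.≤-reflexive (sym (ℚ.+-identityʳ (f zero)))) (ℚ.+-monoʳ-≤ (f zero) (sum-nonneg (0≤f ∘ suc)))
term≤sum f (suc i) 0≤f = ℚ.≤-trans (term≤sum (f ∘ suc) i (0≤f ∘ suc)) (ℚ.≤-trans (ℚ.≤-reflexive (sym (ℚ.+-identityˡ _))) (ℚ.+-monoˡ-≤ _ (0≤f zero)))

-- The sampler as a source of uniform group elements

module Sampling {k 𝓖 Δ} (adm : Admissible k 𝓖 Δ) (r : ℕ) (1≤r : 1 ≤ r) where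
  open GroupEnsemble 𝓖
  open Admissible adm

  n : ℕ
  n = order r

  el : Fin n → G r
  el = Inverse.from (enum r)

  setoid-refl : ∀ {g : G r} → g ≈ g
  setoid-refl = AbelianGroup.refl (group r)

  el-injective : ∀ {i j} → el i ≈ el j → i ≡ j
  el-injective {i} {j} eq = trans (sym (Inverse.strictlyInverseˡ (enum r) i))
    (trans (Inverse.to-cong (enum r) eq) (Inverse.strictlyInverseˡ (enum r) j))

  ⟦⟧-injective : ∀ {g h : G r} → ⟦ g ⟧ ≡ ⟦ h ⟧ → g ≈ h
  ⟦⟧-injective = Injection.injective (code r)

  ⟦⟧-cong : ∀ {g h : G r} → g ≈ h → ⟦ g ⟧ ≡ ⟦ h ⟧
  ⟦⟧-cong = Injection.cong (code r)

  el-surjective : ∀ (g : G r) → el (Inverse.to (enum r) g) ≈ g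
  el-surjective = Inverse.strictlyInverseʳ (enum r)

  out : Fin n → Outcome → Bool
  out i = holds (outputs ⟦ el i ⟧)

  out-unique : ∀ {i j} o → out i o ≡ true → out j o ≡ true → i ≡ j
  out-unique {i} {j} (just (t , m)) p q = el-injective (⟦⟧-injective
    (trans (sym (ℕ.≡ᵇ⇒≡ (m 0) ⟦ el i ⟧ (subst Bool.T (sym p) tt))) (ℕ.≡ᵇ⇒≡ (m 0) ⟦ el j ⟧ (subst Bool.T (sym q) tt))))

  out-others : ∀ {j} o → out j o ≡ true → ∀ i → i ≢ j → out i o ≡ false
  out-others o p i i≢j with out i o in q
  ... | false = refl
  ... | true  = ⊥-elim (i≢j (out-unique o q p))

  samplerRun : Dist Outcome
  samplerRun = run (samplerTime r) sampler (r ∷ [])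

  δ : Fin n → Fin n → Bool
  δ i j = does (el j ≈? el i)

  δ-same : ∀ j → δ j j ≡ true
  δ-same j = dec-true (el j ≈? el j) setoid-refl

  δ-other : ∀ j i → i ≢ j → δ i j ≡ false
  δ-other j i i≢j = dec-false (el j ≈? el i) (λ eq → i≢j (sym (el-injective eq)))

  E-out : ∀ i → E samplerRun (𝟙 ∘ out i) ≡ mean n (λ j → 𝟙 (δ i j))
  E-out i = trans (sym (E->>= samplerRun _ 𝟙)) (trans (sym (Pr≡E (samplerRun >>= λ o → ret (out i o))))
    (trans (samplerExact r 1≤r (el i)) (trans (Pr≡E (uniform r >>= λ h → ret (does (h ≈? el i)))) (E->>= (uniform r) (λ h → ret (does (h ≈? el i))) 𝟙))))

  -- The value of f at the element whose code stands in the output cell, or 0 if there is none;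
  -- injectivity of the codes leaves at most one nonzero term. It reduces arbitrary expectations to
  -- the output probabilities that `samplerExact` provides.
  observe : (Fin n → ℚ) → Outcome → ℚ
  observe f o = sum (λ i → 𝟙 (out i o) ℚ.* f i)

  E-observe : ∀ f → E samplerRun (observe f) ≡ mean n f
  E-observe f = begin
    E samplerRun (observe f)                             ≡⟨ E-sum samplerRun (λ i o → 𝟙 (out i o) ℚ.* f i) ⟩
    sum (λ i → E samplerRun (λ o → 𝟙 (out i o) ℚ.* f i))   ≡⟨ ∑.sum-cong-≗ (λ i → trans (E-cong samplerRun (λ o → ℚ.*-comm (𝟙 (out i o)) (f i)))
                                                             (trans (E-* samplerRun (f i) (𝟙 ∘ out i)) (cong (f i ℚ.*_) (E-out i)))) ⟩
    sum (λ i → f i ℚ.* mean n (λ j → 𝟙 (δ i j)))           ≡⟨ ∑.sum-cong-≗ (λ i → sym (mean-* n (f i) (λ j → 𝟙 (δ i j)))) ⟩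
    sum (λ i → mean n (λ j → f i ℚ.* 𝟙 (δ i j)))           ≡⟨ E-sum (unif n ret) (λ i j → f i ℚ.* 𝟙 (δ i j)) ⟨
    mean n (λ j → sum (λ i → f i ℚ.* 𝟙 (δ i j)))           ≡⟨ mean-cong n (λ j → trans (∑.sum-cong-≗ (λ i → ℚ.*-comm (f i) (𝟙 (δ i j))))
                                                             (sum-delta f j (δ-same j) (δ-other j))) ⟩
    mean n f                                             ∎
    where open ≡-Reasoning

  Hit : Outcome → Set
  Hit o = ∃[ i ] out i o ≡ true

  hit? : ∀ o → Dec (Hit o)
  hit? o = Fin.any? (λ i → out i o Bool.≟ true)

  observe-hit : ∀ f {i} o → out i o ≡ true → observe f o ≡ f i
  observe-hit f {i} o p = sum-delta f i p (out-others o p)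

  observe-miss : ∀ f o → ¬ Hit o → observe f o ≡ 0ℚ
  observe-miss f o miss = sum-0 λ i → trans (cong (λ b → 𝟙 b ℚ.* f i) (lem i)) (ℚ.*-zeroˡ (f i))
    where
    lem : ∀ i → out i o ≡ false
    lem i with out i o in q
    ... | false = refl
    ... | true  = ⊥-elim (miss (i , q))

  mean-1 : mean n (λ _ → 1ℚ) ≡ 1ℚ
  mean-1 with n | nontrivial r 1≤r
  ... | suc n | _ = mean-const n 1ℚ

  -- The output probabilities of the group elements sum to 1, so no branch can miss.
  sampler-hits : Always Hit samplerRun
  sampler-hits = Always-map samplerRun hit (1≤E⇒Always samplerRun ≤1
    (ℚ.≤-reflexive (sym (trans (E-observe (λ _ → 1ℚ)) mean-1))))
    where
    ≤1 : ∀ o → observe (λ _ → 1ℚ) o ℚ.≤ 1ℚ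
    ≤1 o with hit? o
    ... | yes (i , p) = ℚ.≤-reflexive (observe-hit (λ _ → 1ℚ) o p)
    ... | no miss     = ℚ.≤-trans (ℚ.≤-reflexive (observe-miss (λ _ → 1ℚ) o miss)) 0≤1
    hit : ∀ o → 1ℚ ℚ.≤ observe (λ _ → 1ℚ) o → Hit o
    hit o 1≤ with hit? o
    ... | yes h   = h
    ... | no miss = ⊥-elim (1≰0 (ℚ.≤-trans 1≤ (ℚ.≤-reflexive (observe-miss (λ _ → 1ℚ) o miss))))

  -- Beyond its output the sampler may leave anything in memory, so a run is tied only to the
  -- element whose code it outputs; `observe` translates expectations between the two.
  Refines-uniform : ∀ {d : Dist B} {R : Outcome → B → Set} → Refines d samplerRun R → (∀ o b → R o b → Hit o) →
    Refines d (uniform r) (λ g b → ∃[ o ] R o b × holds (outputs ⟦ g ⟧) o ≡ true)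
  Refines-uniform {d = d} {R} ref hits = refines
    (Always-map d (λ b (o , Rob) → let i , p = hits o b Rob in el i , o , Rob , p) (always ref))
    λ φ ψ 0≤ψ φ≤ψ → ℚ.≤-trans (ℚ.≤-reflexive (sym (E-observe (φ ∘ el))))
      (lower ref (observe (φ ∘ el)) ψ 0≤ψ λ o b Rob → let i , p = hits o b Rob in
        ℚ.≤-trans (ℚ.≤-reflexive (observe-hit (φ ∘ el) o p)) (φ≤ψ (el i) b (o , Rob , p)))

  initial-grown : Grown (bits r) (just (0 , initial (r ∷ [])))
  initial-grown zero    = ℕ.m≤m+n (bits r) 0
  initial-grown (suc a) = ℕ.≤-trans (bits-mono {0} {r} z≤n) (ℕ.m≤m+n (bits r) 0)

  Sampled : Outcome → Set
  Sampled o = Maybe.Any (λ (t , _) → t ≤ samplerTime r) o × Hit o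

  sampled : Always Sampled samplerRun
  sampled = Always-zip samplerRun (λ _ → _,_) (samplerHalts r 1≤r) sampler-hits

  mean-δ≢0 : ∀ i → mean n (λ j → 𝟙 (δ i j)) ≢ 0ℚ
  mean-δ≢0 i eq = 1≰0 (ℚ.≤-trans 1≤sum (ℚ.≤-reflexive (sum≡0 n (λ j → 𝟙 (δ i j)) eq)))
    where
    1≤sum : 1ℚ ℚ.≤ sum (λ j → 𝟙 (δ i j))
    1≤sum = ℚ.≤-trans (ℚ.≤-reflexive (cong 𝟙 (sym (δ-same i)))) (term≤sum (λ j → 𝟙 (δ i j)) i (λ j → 0≤𝟙 (δ i j)))
    sum≡0 : ∀ n (f : Fin n → ℚ) → mean n f ≡ 0ℚ → sum f ≡ 0ℚ
    sum≡0 zero    f _  = refl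
    sum≡0 (suc n) f eq = trans (sym (ℚ.*-identityˡ (sum f))) (trans (cong (ℚ._* sum f) (sym (trans (ℚ.*-comm (ι (suc n)) (+ 1 ℚ./ suc n)) (n/n≡1 n))))
      (trans (ℚ.*-assoc (ι (suc n)) (+ 1 ℚ./ suc n) (sum f)) (trans (cong (ι (suc n) ℚ.*_) eq) (ℚ.*-zeroʳ (ι (suc n))))))

  -- The sampler has to write down every group element.
  bits-code : ∀ (g : G r) → bits ⟦ g ⟧ ≤ bits r + samplerTime r
  bits-code g with bits ⟦ g ⟧ ℕ.≤? bits r + samplerTime r
  ... | yes p = p
  ... | no ¬p = ⊥-elim (mean-δ≢0 i (trans (sym (E-out i)) (trans (E-cong-Always samplerRun never (λ o p → cong 𝟙 p)) (E-0 samplerRun))))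
    where
    i = Inverse.to (enum r) g
    E-cong-Always : ∀ {A : Set} {P : A → Set} (d : Dist A) {φ ψ} → Always P d → (∀ a → P a → φ a ≡ ψ a) → E d φ ≡ E d ψ
    E-cong-Always (ret a)    p f = f a p
    E-cong-Always (unif n g) p f = mean-cong n (λ i → E-cong-Always (g i) (p i) f)
    never : Always (λ o → out i o ≡ false) samplerRun
    never = Always-zip samplerRun miss (samplerHalts r 1≤r) (grown-exec (samplerTime r) sampler 0 (initial (r ∷ [])) initial-grown)
      where
      miss : ∀ o → Maybe.Any (λ (t , _) → t ≤ samplerTime r) o → Grown (bits r) o → out i o ≡ false
      miss (just (t , m)) (Maybe.just t≤) grown = ≢⇒≡ᵇ {m 0} λ eq → ¬p (ℕ.≤-trans
        (ℕ.≤-reflexive (cong bits (trans (⟦⟧-cong (AbelianGroup.sym (group r) (el-surjective g))) (sym eq))))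
        (ℕ.≤-trans (grown 0) (ℕ.+-monoʳ-≤ (bits r) {t} t≤)))

Triple-≡ : ∀ {m P b} {μ ν : Dist A} {R : A → Mem → Set} →
  (∀ φ → E ν φ ≡ E μ φ) → Triple m P b μ R → Triple m P b ν R
Triple-≡ ν≡μ tr = triple λ n t b≤n → Refines-≡ ν≡μ (from tr n t b≤n)

-- Composition produces `μ >>= ret`, which has the same expectations as μ; a refinement sees its
-- ideal distribution through expectations only.
Triple-then-ret : ∀ {m P Q b c} {μ : Dist A} {R S : A → Mem → Set} →
  Triple m P b μ R → (∀ a m′ → R a m′ → Triple m′ Q c (ret a) S) → Triple m (P ⨾ Q) (b + c) μ S
Triple-then-ret {μ = μ} trP trQ = Triple-≡ (λ φ → sym (E->>= μ ret φ)) (Triple-⨾ trP trQ)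

writeVec : ∀ {n} → ℕ → Vec ℕ n → Mem → Mem
writeVec i []       m = m
writeVec i (v ∷ vs) m = writeVec (suc i) vs (m [ i ↦ v ])

update-cong : ∀ {m m′ : Mem} i v → (∀ a → m a ≡ m′ a) → ∀ a → (m [ i ↦ v ]) a ≡ (m′ [ i ↦ v ]) a
update-cong i v eq a with a ≡ᵇ i
... | true  = refl
... | false = eq a

writeVec-cong : ∀ {n} i (vs : Vec ℕ n) {m m′ : Mem} → (∀ a → m a ≡ m′ a) → ∀ a → writeVec i vs m a ≡ writeVec i vs m′ a
writeVec-cong i []       eq = eq
writeVec-cong i (v ∷ vs) eq = writeVec-cong (suc i) vs (update-cong i v eq)

writeVec-below : ∀ {n} i (vs : Vec ℕ n) m {a} → a < i → writeVec i vs m a ≡ m a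
writeVec-below i []       m a<i = refl
writeVec-below i (v ∷ vs) m a<i = trans (writeVec-below (suc i) vs (m [ i ↦ v ]) (ℕ.m<n⇒m<1+n a<i))
  (update-other m v (ℕ.<⇒≢ a<i))

writeVec-lookup : ∀ {n} i (vs : Vec ℕ n) m (j : Fin n) → writeVec i vs m (i + toℕ j) ≡ lookup vs j
writeVec-lookup i (v ∷ vs) m zero    = trans (cong (writeVec (suc i) vs (m [ i ↦ v ])) (ℕ.+-identityʳ i))
  (trans (writeVec-below (suc i) vs (m [ i ↦ v ]) (ℕ.n<1+n i)) (update-same m i v))
writeVec-lookup i (v ∷ vs) m (suc j) = trans (cong (writeVec (suc i) vs (m [ i ↦ v ])) (ℕ.+-suc i (toℕ j)))
  (writeVec-lookup (suc i) vs (m [ i ↦ v ]) j)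

writeVec-initial : ∀ {n} i (vs : Vec ℕ n) m → (∀ a → m (i + a) ≡ 0) → ∀ a → writeVec i vs m (i + a) ≡ initial (toList vs) a
writeVec-initial i []       m m≡0 a       = m≡0 a
writeVec-initial i (v ∷ vs) m m≡0 zero    = writeVec-lookup i (v ∷ vs) m zero
writeVec-initial i (v ∷ vs) m m≡0 (suc a) = trans (cong (writeVec (suc i) vs (m [ i ↦ v ])) (ℕ.+-suc i a))
  (writeVec-initial (suc i) vs (m [ i ↦ v ]) (λ a → trans
    (update-other m v (ℕ.>⇒≢ (ℕ.m≤m+n (suc i) a))) (trans (cong m (sym (ℕ.+-suc i a))) (m≡0 (suc a)))) a)

initial-lookup : ∀ {n} (vs : Vec ℕ n) (i : Fin n) → initial (toList vs) (toℕ i) ≡ lookup vs i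
initial-lookup (v ∷ vs) zero    = refl
initial-lookup (v ∷ vs) (suc i) = initial-lookup vs i

initial-beyond : ∀ {n} (vs : Vec ℕ n) a → n ≤ a → initial (toList vs) a ≡ 0
initial-beyond []       a       _         = refl
initial-beyond (v ∷ vs) (suc a) (s≤s n≤a) = initial-beyond vs a n≤a

initial-≤ : ∀ {n} {P : ℕ → Set} (vs : Vec ℕ n) → P 0 → (∀ i → P (lookup vs i)) → ∀ a → P (initial (toList vs) a)
initial-≤ []       p0 pv a       = p0
initial-≤ (v ∷ vs) p0 pv zero    = pv zero
initial-≤ {P = P} (v ∷ vs) p0 pv (suc a) = initial-≤ {P = P} vs p0 (pv ∘ suc) a

-- The reduction

module Reduction {k 𝓖 Δ} (adm : Admissible k 𝓖 Δ) (𝓐 : Program) (T : ℕ → ℕ)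
  (halts : KSum.RunsInTime k 𝓖 𝓐 T) (D : ℕ) where
  open GroupEnsemble 𝓖
  open Admissible adm
  open KSum k 𝓖 using (encode; decode)
  open Regions (2 + D)

  -- Region 0 holds the scores, region 1 the coins, and region 2 the variables.
  -- In a trial that starts with qE = q, region 3 + q belongs to the decision
  -- algorithm and region 3 + (q + i) to the i-th run of the sampler.
  var : ℕ → Expr
  var j = at (lit 2) (lit j)

  iE pE qE hE trialE sampleE : Expr
  iE      = var 0
  pE      = var 1
  qE      = var 2
  hE      = var 3
  trialE  = op add (lit 3) qE
  sampleE = op add (lit 3) (op add qE iE)

  forLoop for : Program → Program
  forLoop P = while (op sub r+1E iE) (P ⨾ store (addrE (lit 2) (lit 0)) (op add (lit 1) iE))
  for P     = store (addrE (lit 2) (lit 0)) (lit 1) ⨾ forLoop P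

  -- The sampler runs whichever way the coin falls, and for one side its result is discarded. Thus
  -- the coin and the fresh element are independent, as in `pair`.
  resampleP : Program
  resampleP =
    random (addrE (lit 1) iE) (lit 2) ⨾
    store (addrE sampleE (lit 0)) rE ⨾
    confine sampleE sampler ⨾
    cond (at (lit 1) iE)
      (store (addrE trialE iE) (at sampleE (lit 0)))
      (store (addrE trialE iE) (cell iE))

  scoreP : Program
  scoreP = store (addrE (lit 0) iE) (op add (at (lit 0) iE) (at (lit 1) iE))

  trialP : Program
  trialP =
    store (addrE trialE (lit 0)) rE ⨾
    for resampleP ⨾
    confine trialE 𝓐 ⨾
    cond (at trialE (lit 0)) (for scoreP) skip ⨾
    -- The next trial moves on to r + 1 regions that are still zero: one for the decision algorithm
    -- and r for the runs of the sampler.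
    store (addrE (lit 2) (lit 2)) (op add qE r+1E)

  -- `pE` doubles from 1 for as long as it is at most r, which makes ⌊log₂ r⌋ + 1 rounds without
  -- computing a logarithm; `hE` counts them and ends as H.
  roundP : Program
  roundP =
    rep D trialP ⨾
    store (addrE (lit 2) (lit 1)) (op add pE pE) ⨾
    store (addrE (lit 2) (lit 3)) (op add (lit 1) hE)

  -- The value stored is nonzero if and only if the score is below the
  -- number of rounds.
  outputP : Program
  outputP = store iE (op sub hE (at (lit 0) iE))

  mainP : Program
  mainP =
    store (addrE (lit 2) (lit 1)) (lit 1) ⨾
    while (op sub r+1E pE) roundP ⨾
    for outputP

  -- The reduction with an exact sampler and without the machine.
  module Ideal (r : ℕ) where

    pair : Dist (Bool × G r)
    pair = coin >>= λ b → uniform r >>= λ z → ret (b , z)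

    mix : ∀ {n} → Vec (G r) n → Vec (Bool × G r) n → Vec (G r) n
    mix = zipWith (λ x (b , z) → if b then z else x)

    -- Any nonzero output counts as acceptance, which is what `cond` tests. Output 0 excludes it and
    -- output 1 implies it, so both error bounds of the decision algorithm carry over.
    accepts : Outcome → Bool
    accepts = holds (λ m → not (m 0 ≡ᵇ 0))

    addCoins : ∀ {n} → Vec (Bool × G r) n → Vec ℕ n → Vec ℕ n
    addCoins = zipWith (λ (b , _) x → x + 𝟚 b)

    trial : Vec (G r) r → Vec ℕ r → Dist (Vec ℕ r)
    trial X s = do
      cz ← iid r pair
      o  ← run (T r) 𝓐 (encode (mix X cz))
      ret (if accepts o then addCoins cz s else s)

    H : ℕ
    H = bits r

    scores : Vec (G r) r → Dist (Vec ℕ r)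
    scores X = iter H (iter D (trial X)) (replicate r 0)

  -- From r ≥ 2 on, the variables at addresses 0 to 3 respect the bound `suc r` under which
  -- addresses within a region are costed.
  module Correct (r : ℕ) (2≤r : 2 ≤ r) where
    1≤r : 1 ≤ r
    1≤r = ℕ.≤-trans (s≤s z≤n) 2≤r

    open Ideal r
    open Layout r
    open Sampling adm r 1≤r using (samplerRun; Sampled; sampled; Hit; Refines-uniform; bits-code)

    opaque
      -- A word has room for every address that the reduction forms and, by `bits-code`, for the
      -- code of every group element.
      w : ℕ
      w = bits U + (bits r + samplerTime r)

      w-def : w ≡ bits U + (bits r + samplerTime r)
      w-def = refl

    open Sized w (ℕ.≤-trans (ℕ.m≤m+n (bits U) (bits r + samplerTime r)) (ℕ.≤-reflexive (sym w-def)))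

    code≤w : ∀ (g : G r) → bits ⟦ g ⟧ ≤ w
    code≤w g = ℕ.≤-trans (bits-code g) (ℕ.≤-trans (ℕ.m≤n+m (bits r + samplerTime r) (bits U)) (ℕ.≤-reflexive (sym w-def)))

    r≤U : r ≤ U
    r≤U = ℕ.≤-trans (ℕ.n≤1+n r) r+1≤U

    3≤r+1 : 3 ≤ suc r
    3≤r+1 = s≤s 2≤r

    -- Three regions serve the reduction itself, and each of at most D * (r + 1) trials takes r + 1
    -- more; `M` is (3 + D) * (r + 1) ^ 2 to make room for them.
    q<M : ∀ {q} → q ≤ D * (suc r * suc r) → 2 + q < M
    q<M {q} q≤ = begin
      3 + q                                                  ≤⟨ ℕ.+-monoʳ-≤ 3 q≤ ⟩
      3 + D * (suc r * suc r)                                ≤⟨ ℕ.m≤m+n _ (3 * r * r + 6 * r) ⟩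
      3 + D * (suc r * suc r) + (3 * r * r + 6 * r)          ≡⟨ lem r D ⟩
      (3 + D) * (suc r * suc r)                              ≡⟨ M-def ⟨
      M                                                      ∎
      where
      open ℕ.≤-Reasoning
      lem : ∀ r D → 3 + D * (suc r * suc r) + (3 * r * r + 6 * r) ≡ (3 + D) * (suc r * suc r)
      lem = solve-∀

    admin<M : ∀ {ρ} → ρ ≤ 2 → ρ < M
    admin<M ρ≤2 = ℕ.≤-<-trans ρ≤2 (ℕ.≤-<-trans (ℕ.m≤m+n 2 0) (q<M {0} z≤n))

    ev-var : ∀ {m low reg} → Rep m low reg → ∀ j {v} → j ≤ 3 → reg 2 j ≡ v → v ≤ U → Ev m (var j) v 33
    ev-var rep j j≤3 refl v≤U = ev-at rep (ev-lit (small (ℕ.≤-trans (s≤s (s≤s z≤n)) (ℕ.≤-trans 3≤r+1 r+1≤U))))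
      (ev-lit (small (ℕ.≤-trans j≤3 (ℕ.≤-trans 3≤r+1 r+1≤U)))) (admin<M ℕ.≤-refl) (ℕ.≤-trans j≤3 3≤r+1) (small v≤U)

    ev-num : ∀ {m} j → j ≤ 3 → Ev m (lit j) j 1
    ev-num j j≤3 = ev-lit (small (ℕ.≤-trans j≤3 (ℕ.≤-trans 3≤r+1 r+1≤U)))

    -- 41 words for the test of the counter and 69 for its increment.
    stepTime : ℕ → ℕ
    stepTime c = 41 * w + (c + 69 * w)

    test : ∀ {m low reg i} → Rep m low reg → reg 2 0 ≡ i → i ≤ suc r → Ev m (op sub r+1E iE) (suc r ∸ i) 41
    test rep i≡ i≤ = ev-op sub (ev-r+1 rep) (ev-var rep 0 z≤n i≡ (ℕ.≤-trans i≤ r+1≤U)) (small r+1≤U) (small (ℕ.≤-trans i≤ r+1≤U))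

    for-exit : ∀ {m low reg P} {S : A → Mem → Set} {x} → Rep m low reg → reg 2 0 ≡ suc r → S x m →
      Triple m (forLoop P) (41 * w) (ret x) S
    for-exit rep i≡ Sx = let ev v≡ t≤ = test rep i≡ ℕ.≤-refl in
      Triple-while-exit (trans v≡ (ℕ.n∸n≡0 r)) t≤ Sx

    for-step : ∀ {m low reg P i c d} {μ : Dist A} {ν : A → Dist B} {R : A → Mem → (ℕ → Mem) → Set} {S : B → Mem → Set} →
      Rep m low reg → reg 2 0 ≡ i → i ≤ r →
      Triple m P c μ (λ a m′ → ∃[ low′ ] ∃[ reg′ ] Rep m′ low′ reg′ × reg′ 2 0 ≡ i × R a low′ reg′) →
      (∀ a m′ low′ reg′ → Rep m′ low′ (setReg reg′ 2 (reg′ 2 [ 0 ↦ suc i ])) → R a low′ reg′ →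
        Triple m′ (forLoop P) d (ν a) S) →
      Triple m (forLoop P) (stepTime c + d) (μ >>= ν) S
    for-step {i = i} {μ = μ} {ν} {R} rep i≡ i≤r body rest = let ev v≡ t≤ = test rep i≡ (ℕ.m≤n⇒m≤1+n i≤r) in
      Triple-while-step (trans v≡ (ℕ.+-∸-assoc 1 i≤r)) t≤
        (Triple-then-ret {S = λ a m′ → ∃[ low′ ] ∃[ reg′ ] Rep m′ low′ (setReg reg′ 2 (reg′ 2 [ 0 ↦ suc i ])) × R a low′ reg′}
          body λ { a m′ (low′ , reg′ , rep′ , i≡′ , Ra) → Triple-store-at rep′ 69 (ev-num 2 (s≤s (s≤s z≤n))) (ev-num 0 z≤n)
            (ev-op add (ev-num 1 (s≤s z≤n)) (ev-var rep′ 0 z≤n i≡′ (ℕ.≤-trans i≤r r≤U)) (small (ℕ.≤-trans (s≤s z≤n) r+1≤U)) (small (ℕ.≤-trans i≤r r≤U)))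
            (admin<M ℕ.≤-refl) z≤n (small (ℕ.≤-trans (s≤s i≤r) r+1≤U)) λ m″ rep″ → low′ , reg′ , rep″ , Ra })
        λ { a m′ (low′ , reg′ , rep′ , Ra) → rest a m′ low′ reg′ rep′ Ra }

    forTime : ℕ → ℕ → ℕ
    forTime c zero    = 41 * w
    forTime c (suc n) = stepTime c + forTime c n

    Triple-forLoop : ∀ {P c} (I : ℕ → Mem → (ℕ → Mem) → Set) →
      (∀ i low reg v → I i low reg → I i low (setReg reg 2 (reg 2 [ 0 ↦ v ]))) →
      (∀ i m low reg → 1 ≤ i → i ≤ r → Rep m low reg → reg 2 0 ≡ i → I i low reg →
        Triple m P c (ret tt) (λ _ m′ → ∃[ low′ ] ∃[ reg′ ] Rep m′ low′ reg′ × reg′ 2 0 ≡ i × I (suc i) low′ reg′)) →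
      ∀ n i m low reg → 1 ≤ i → i + n ≡ suc r → Rep m low reg → reg 2 0 ≡ i → I i low reg →
      Triple m (forLoop P) (forTime c n) (ret tt) (λ _ m′ → ∃[ low′ ] ∃[ reg′ ] Rep m′ low′ reg′ × I (suc r) low′ reg′)
    Triple-forLoop I stable body zero i m low reg 1≤i i≡ rep eq Ii with trans (sym (ℕ.+-identityʳ i)) i≡
    ... | refl = for-exit rep eq (low , reg , rep , Ii)
    Triple-forLoop I stable body (suc n) i m low reg 1≤i i≡ rep eq Ii =
      for-step {R = λ _ → I (suc i)} rep eq i≤r (body i m low reg 1≤i i≤r rep eq Ii)
        λ { _ m′ low′ reg′ rep′ I+ → Triple-forLoop I stable body n (suc i) m′ low′ _ (s≤s z≤n)
          (trans (sym (ℕ.+-suc i n)) i≡) rep′ refl (stable (suc i) low′ reg′ (suc i) I+) }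
      where
      i≤r : i ≤ r
      i≤r = ℕ.≤-pred (ℕ.≤-trans (ℕ.m≤m+n (suc i) n) (ℕ.≤-reflexive (trans (sym (ℕ.+-suc i n)) i≡)))

    Triple-for : ∀ {P c} (I : ℕ → Mem → (ℕ → Mem) → Set) →
      (∀ i low reg v → I i low reg → I i low (setReg reg 2 (reg 2 [ 0 ↦ v ]))) →
      (∀ i m low reg → 1 ≤ i → i ≤ r → Rep m low reg → reg 2 0 ≡ i → I i low reg →
        Triple m P c (ret tt) (λ _ m′ → ∃[ low′ ] ∃[ reg′ ] Rep m′ low′ reg′ × reg′ 2 0 ≡ i × I (suc i) low′ reg′)) →
      ∀ m low reg → Rep m low reg → I 1 low reg →
      Triple m (for P) (34 * w + forTime c r) (ret tt) (λ _ m′ → ∃[ low′ ] ∃[ reg′ ] Rep m′ low′ reg′ × I (suc r) low′ reg′)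
    Triple-for I stable body m low reg rep I1 = Triple-⨾
      (Triple-store-at rep 34 {R = λ (_ : ⊤) m′ → Rep m′ low (setReg reg 2 (reg 2 [ 0 ↦ 1 ]))}
        (ev-num 2 (s≤s (s≤s z≤n))) (ev-num 0 z≤n) (ev-num 1 (s≤s z≤n))
        (admin<M ℕ.≤-refl) z≤n (small (ℕ.≤-trans (s≤s z≤n) r+1≤U)) (λ _ → id))
      λ _ m′ rep′ → Triple-forLoop I stable body r 1 m′ low _ (s≤s z≤n) refl rep′ refl (stable 1 low reg 1 I1)

    Triple-uniform : ∀ {m P b} {R : Outcome → Mem → Set} → Triple m P b samplerRun R → (∀ o m′ → R o m′ → Hit o) →
      Triple m P b (uniform r) (λ g m′ → ∃[ o ] R o m′ × holds (outputs ⟦ g ⟧) o ≡ true)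
    Triple-uniform {b = b} {R} tr hits = triple λ n t b≤n →
      Refines-weaken (λ { g (just (t′ , m′)) (o , (t′≤ , Rom) , p) → t′≤ , o , Rom , p })
        (Refines-uniform (from tr n t b≤n) λ { o (just (t′ , m′)) (_ , Rom) → hits o m′ Rom })

    Stored : ∀ {n} → Mem → ℕ → Vec (G r) n → Set
    Stored low i []       = ⊤
    Stored low i (x ∷ xs) = low i ≡ ⟦ x ⟧ × Stored low (suc i) xs

    codes : ∀ {n} → Vec (G r) n → Vec ℕ n
    codes = Vec.map ⟦_⟧

    flips : ∀ {n} → Vec (Bool × G r) n → Vec ℕ n
    flips = Vec.map (𝟚 ∘ proj₁)

    resampleTime : ℕ
    resampleTime = 66 * w + (106 * w + (107 * w * samplerTime r + (65 * w + 203 * w)))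

    ev-at-reg : ∀ {m low reg ρE aE ρ a v j k} → Rep m low reg → Ev m ρE ρ j → Ev m aE a k → ρ < M → a ≤ suc r →
      reg ρ a ≡ v → bits v ≤ w → Ev m (at ρE aE) v (29 + j + k + 2)
    ev-at-reg rep evρ eva ρ<M a≤ refl v≤w = ev-at rep evρ eva ρ<M a≤ v≤w

    bits𝟚≤w : ∀ b → bits (𝟚 b) ≤ w
    bits𝟚≤w true  = small (ℕ.≤-trans (s≤s z≤n) r+1≤U)
    bits𝟚≤w false = small z≤n

    module Trial (q : ℕ) (q+r≤ : q + suc r ≤ D * (suc r * suc r)) where

      q≤ : q ≤ D * (suc r * suc r)
      q≤ = ℕ.≤-trans (ℕ.m≤m+n q (suc r)) q+r≤

      q+i≤ : ∀ {i} → i ≤ suc r → q + i ≤ D * (suc r * suc r)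
      q+i≤ i≤ = ℕ.≤-trans (ℕ.+-monoʳ-≤ q i≤) q+r≤

      x<M⇒x≤U : ∀ {x} → x < M → x ≤ U
      x<M⇒x≤U x<M = ℕ.≤-trans (ℕ.<⇒≤ x<M) M≤U

      q≤U : q ≤ U
      q≤U = ℕ.≤-trans (ℕ.m≤n+m q 2) (x<M⇒x≤U (q<M q≤))

      3+ρ<M : ∀ {i} → i ≤ r → 3 + (q + i) < M
      3+ρ<M {i} i≤r = ℕ.≤-trans (ℕ.≤-reflexive (cong (λ x → 3 + x) (sym (ℕ.+-suc q i)))) (q<M (q+i≤ (s≤s i≤r)))

      3+q<M : 3 + q < M
      3+q<M = subst (λ x → 3 + x < M) (ℕ.+-identityʳ q) (3+ρ<M z≤n)

      ev-trial : ∀ {m low reg} → Rep m low reg → reg 2 2 ≡ q → Ev m trialE (3 + q) 36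
      ev-trial rep q≡ = ev-op add (ev-num 3 ℕ.≤-refl) (ev-var rep 2 (s≤s (s≤s z≤n)) q≡ q≤U)
        (small (ℕ.≤-trans 3≤r+1 r+1≤U)) (small q≤U)

      ev-sample : ∀ {m low reg i} → Rep m low reg → reg 2 2 ≡ q → reg 2 0 ≡ i → i ≤ r → Ev m sampleE (3 + (q + i)) 71
      ev-sample {i = i} rep q≡ i≡ i≤r = ev-op add (ev-num 3 ℕ.≤-refl)
        (ev-op add (ev-var rep 2 (s≤s (s≤s z≤n)) q≡ q≤U) (ev-var rep 0 z≤n i≡ (ℕ.≤-trans i≤r r≤U)) (small q≤U) (small (ℕ.≤-trans i≤r r≤U)))
        (small (ℕ.≤-trans 3≤r+1 r+1≤U)) (small (ℕ.≤-trans (ℕ.m≤n+m (q + i) 3) (x<M⇒x≤U (3+ρ<M i≤r))))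

      -- Besides what the loop writes, later steps depend on what it leaves alone: the scores, the
      -- variables other than the counter, and the regions beyond those of the sampler runs so far,
      -- which must still be zero.
      Filled : ∀ {n} → ℕ → Vec ℕ n → Vec ℕ n → (ℕ → Mem) → (ℕ → Mem) → Set
      Filled {n} i vs cs reg reg′ =
        (∀ a → reg′ 0 a ≡ reg 0 a) × (∀ j → reg′ 2 (suc j) ≡ reg 2 (suc j)) ×
        (∀ a → reg′ 1 a ≡ writeVec i cs (reg 1) a) × (∀ a → reg′ (3 + q) a ≡ writeVec i vs (reg (3 + q)) a) ×
        (∀ ρ → q + (i + n) ≤ ρ → ∀ a → reg′ (3 + ρ) a ≡ reg (3 + ρ) a)

      Triple-resample : ∀ {m low reg i x} → Rep m low reg → 1 ≤ i → i ≤ r → reg 2 0 ≡ i → reg 2 2 ≡ q → low i ≡ ⟦ x ⟧ →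
        (∀ ρ → q + i ≤ ρ → ∀ a → reg (3 + ρ) a ≡ 0) →
        Triple m resampleP resampleTime pair (λ (b , z) m′ → ∃[ low′ ] ∃[ reg′ ] Rep m′ low′ reg′ × reg′ 2 0 ≡ i ×
          low′ ≡ low × Filled i (⟦ if b then z else x ⟧ ∷ []) (𝟚 b ∷ []) reg reg′)
      Triple-resample {m} {low} {reg} {i} {x} rep 1≤i i≤r i≡ q≡ x≡ fresh =
        Triple-⨾ (Triple-coin-at rep 66 (ev-num 1 (s≤s z≤n)) (ev-var rep 0 z≤n i≡ (ℕ.≤-trans i≤r r≤U)) (admin<M (s≤s z≤n))
            (ℕ.m≤n⇒m≤1+n i≤r) (small (ℕ.≤-trans (ℕ.n≤1+n 2) (ℕ.≤-trans 3≤r+1 r+1≤U)))) λ b m₁ rep₁ →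
        Triple-⨾ (Triple-store-at rep₁ 106 {R = λ (_ : ⊤) m₂ → Rep m₂ low (reg₂ b)} (ev-sample rep₁ q≡ i≡ i≤r) (ev-num 0 z≤n)
            (ev-r rep₁) (3+ρ<M i≤r) z≤n (small r≤U) λ _ → id) λ _ m₂ rep₂ →
        Triple-⨾ (Triple-uniform (Sim.Triple-confine b sampler {T = samplerTime r} {s = initial (r ∷ [])} {Q = Sampled}
              (λ ()) (λ { _ _ (Maybe.just t≤ , _) → t≤ }) (Rep-focus (3 + (q + i)) (region-init b) rep₂) sampled)
            λ { (just _) _ ((_ , hit) , _) → hit }) λ { z m₃ (just (t , s) , ((_ , _) , rep₃) , hit) →
        let s≡ : setReg (reg₂ b) (3 + (q + i)) s (3 + (q + i)) 0 ≡ ⟦ z ⟧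
            s≡ = trans (cong (λ s → s 0) (setReg-same (reg₂ b) (3 + (q + i)) s)) (ℕ.≡ᵇ⇒≡ (s 0) ⟦ z ⟧ (subst Bool.T (sym hit) tt))
        in case-coin b z rep₃ s≡ }
        where
        reg₁ : Bool → ℕ → Mem
        reg₁ b = setReg reg 1 (reg 1 [ i ↦ 𝟚 b ])
        reg₂ : Bool → ℕ → Mem
        reg₂ b = setReg (reg₁ b) (3 + (q + i)) (reg₁ b (3 + (q + i)) [ 0 ↦ r ])
        region-init : ∀ b a → reg₂ b (3 + (q + i)) a ≡ initial (r ∷ []) a
        region-init b a = trans (cong (λ s → s a) (setReg-same (reg₁ b) (3 + (q + i)) (reg₁ b (3 + (q + i)) [ 0 ↦ r ]))) (cell≡ a)
          where
          cell≡ : ∀ a → (reg (3 + (q + i)) [ 0 ↦ r ]) a ≡ initial (r ∷ []) a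
          cell≡ zero    = refl
          cell≡ (suc a) = fresh (q + i) ℕ.≤-refl (suc a)
        module Sim (b : Bool) = Simulation low (reg₂ b) sampleE (3 + (q + i)) 71 (3+ρ<M i≤r)
          (λ rep → ev-sample rep q≡ i≡ i≤r)

        q≢q+i : q ≢ q + i
        q≢q+i eq = ℕ.<⇒≢ 1≤i (ℕ.+-cancelˡ-≡ q 0 i (trans (ℕ.+-identityʳ q) eq))

        module _ (b : Bool) (s : Mem) (v : ℕ) where
          reg₃ reg₄ : ℕ → Mem
          reg₃ = setReg (reg₂ b) (3 + (q + i)) s
          reg₄ = setReg reg₃ (3 + q) (reg₃ (3 + q) [ i ↦ v ])

          reg₃-other : ∀ ρ → ρ ≢ q + i → ∀ a → reg₃ (3 + ρ) a ≡ reg (3 + ρ) a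
          reg₃-other ρ ρ≢ a = trans (cong (λ s → s a) (setReg-other (reg₂ b) s (ρ≢ ∘ ℕ.+-cancelˡ-≡ 3 ρ (q + i))))
            (cong (λ s → s a) (setReg-other (reg₁ b) (reg₁ b (3 + (q + i)) [ 0 ↦ r ]) (ρ≢ ∘ ℕ.+-cancelˡ-≡ 3 ρ (q + i))))

          filled : Filled i (v ∷ []) (𝟚 b ∷ []) reg reg₄
          filled = (λ a → refl) , (λ j → refl) , (λ a → refl) ,
            (λ a → trans (cong (λ s → s a) (setReg-same reg₃ (3 + q) (reg₃ (3 + q) [ i ↦ v ]))) (update-cong i v (reg₃-other q q≢q+i) a)) ,
            λ ρ q+i+1≤ρ a → let q+i<ρ = ℕ.≤-trans (ℕ.≤-reflexive (trans (sym (ℕ.+-suc q i)) (cong (λ z → q + z) (ℕ.+-comm 1 i)))) q+i+1≤ρ in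
              trans (cong (λ s → s a) (setReg-other reg₃ (reg₃ (3 + q) [ i ↦ v ]) (ℕ.>⇒≢ (ℕ.≤-<-trans (ℕ.m≤m+n q i) q+i<ρ) ∘ ℕ.+-cancelˡ-≡ 3 ρ q)))
                (reg₃-other ρ (ℕ.>⇒≢ q+i<ρ) a)

        case-coin : ∀ b z {m₃ s} → Rep m₃ low (reg₃ b s 0) → reg₃ b s 0 (3 + (q + i)) 0 ≡ ⟦ z ⟧ →
          Triple m₃ (cond (at (lit 1) iE)
            (store (addrE trialE iE) (at sampleE (lit 0)))
            (store (addrE trialE iE) (cell iE))) (65 * w + 203 * w) (ret (b , z))
            (λ (b , z) m′ → ∃[ low′ ] ∃[ reg′ ] Rep m′ low′ reg′ × reg′ 2 0 ≡ i ×
              low′ ≡ low × Filled i (⟦ if b then z else x ⟧ ∷ []) (𝟚 b ∷ []) reg reg′)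
        case-coin true z {s = s} rep₃ s≡ = Triple-cond-suc (value test′) (time test′)
          (Triple-store-at rep₃ 203 (ev-trial rep₃ q≡) (ev-var rep₃ 0 z≤n i≡ (ℕ.≤-trans i≤r r≤U))
            (ev-at-reg rep₃ (ev-sample rep₃ q≡ i≡ i≤r) (ev-num 0 z≤n) (3+ρ<M i≤r) z≤n s≡ (code≤w z)) 3+q<M (ℕ.m≤n⇒m≤1+n i≤r) (code≤w z)
            λ m₄ rep₄ → low , reg₄ true s ⟦ z ⟧ , rep₄ , i≡ , refl , filled true s ⟦ z ⟧)
          where test′ = ev-at-reg rep₃ (ev-num 1 (s≤s z≤n)) (ev-var rep₃ 0 z≤n i≡ (ℕ.≤-trans i≤r r≤U)) (admin<M (s≤s z≤n)) (ℕ.m≤n⇒m≤1+n i≤r) (update-same (reg 1) i 1) (bits𝟚≤w true)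
        case-coin false z {s = s} rep₃ s≡ = Triple-cond-zero (value test′) (time test′)
          (Triple-store-at rep₃ 203 (ev-trial rep₃ q≡) (ev-var rep₃ 0 z≤n i≡ (ℕ.≤-trans i≤r r≤U))
            (ev-≡ x≡ (ev-low rep₃ (ev-var rep₃ 0 z≤n i≡ (ℕ.≤-trans i≤r r≤U)) i≤r (subst (λ c → bits c ≤ w) (sym x≡) (code≤w x))))
            3+q<M (ℕ.m≤n⇒m≤1+n i≤r) (code≤w x)
            λ m₄ rep₄ → low , reg₄ false s ⟦ x ⟧ , rep₄ , i≡ , refl , filled false s ⟦ x ⟧)
          where test′ = ev-at-reg rep₃ (ev-num 1 (s≤s z≤n)) (ev-var rep₃ 0 z≤n i≡ (ℕ.≤-trans i≤r r≤U)) (admin<M (s≤s z≤n)) (ℕ.m≤n⇒m≤1+n i≤r) (update-same (reg 1) i 0) (bits𝟚≤w false)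

      Triple-fillLoop : ∀ {n} (xs : Vec (G r) n) i {m low reg} → 1 ≤ i → i + n ≡ suc r → Rep m low reg → reg 2 0 ≡ i → reg 2 2 ≡ q →
        Stored low i xs → (∀ ρ → q + i ≤ ρ → ∀ a → reg (3 + ρ) a ≡ 0) →
        Triple m (forLoop resampleP) (forTime resampleTime n) (iid n pair)
          (λ cz m′ → ∃[ reg′ ] Rep m′ low reg′ × Filled i (codes (mix xs cz)) (flips cz) reg reg′)
      Triple-fillLoop [] i 1≤i i≡ rep eq q≡ st fresh with trans (sym (ℕ.+-identityʳ i)) i≡
      ... | refl = for-exit rep eq (_ , rep , (λ _ → refl) , (λ _ → refl) , (λ _ → refl) , (λ _ → refl) , (λ _ _ _ → refl))
      Triple-fillLoop {suc n} (x ∷ xs) i {m} {low} {reg} 1≤i i≡ rep eq q≡ (x≡ , st) fresh =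
        for-step {R = λ (b , z) low′ reg′ → low′ ≡ low × Filled i (⟦ if b then z else x ⟧ ∷ []) (𝟚 b ∷ []) reg reg′} rep eq i≤r
          (Triple-resample rep 1≤i i≤r eq q≡ x≡ fresh)
          λ { (b , z) m′ low′ reg′ rep′ (refl , score , vars , coins , arr , rest) →
            Triple-map ((b , z) ∷_) (λ { cz m″ (reg″ , rep″ , score′ , vars′ , coins′ , arr′ , rest′) →
                reg″ , rep″ , (λ a → trans (score′ a) (score a)) , (λ j → trans (vars′ j) (vars j)) ,
                (λ a → trans (coins′ a) (writeVec-cong (suc i) (flips cz) coins a)) ,
                (λ a → trans (arr′ a) (writeVec-cong (suc i) (codes (mix xs cz)) arr a)) ,
                λ ρ le a → trans (rest′ ρ (ℕ.≤-trans (ℕ.≤-reflexive (cong (λ z → q + z) (sym (ℕ.+-suc i n)))) le) a)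
                  (rest ρ (ℕ.≤-trans (ℕ.+-monoʳ-≤ q (ℕ.+-monoʳ-≤ i (s≤s z≤n))) le) a) })
              (Triple-fillLoop xs (suc i) (s≤s z≤n) (trans (sym (ℕ.+-suc i n)) i≡) rep′ refl (trans (vars 1) q≡) st
                λ ρ le a → trans (rest ρ (ℕ.≤-trans (ℕ.≤-reflexive (cong (λ z → q + z) (ℕ.+-comm i 1))) le) a)
                  (fresh ρ (ℕ.≤-trans (ℕ.+-monoʳ-≤ q (ℕ.n≤1+n i)) le) a)) }
        where
        i≤r : i ≤ r
        i≤r = ℕ.≤-pred (ℕ.≤-trans (ℕ.m≤m+n (suc i) n) (ℕ.≤-reflexive (trans (sym (ℕ.+-suc i n)) i≡)))

    index : ∀ {a} → 1 ≤ a → a ≤ r → ∃[ j ] suc (toℕ {r} j) ≡ a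
    index {suc a} _ a<r = fromℕ< a<r , cong suc (Fin.toℕ-fromℕ< a<r)

    scoreTime : ℕ
    scoreTime = 34 * w + forTime (197 * w) r

    Triple-score : ∀ {m low reg} → Rep m low reg → (∀ a → 1 ≤ a → a ≤ r → reg 0 a + reg 1 a ≤ U) →
      Triple m (for scoreP) scoreTime (ret tt) (λ _ m′ → ∃[ reg′ ] Rep m′ low reg′ ×
        (∀ j → reg′ 2 (suc j) ≡ reg 2 (suc j)) × (∀ ρ a → reg′ (3 + ρ) a ≡ reg (3 + ρ) a) ×
        (∀ a → 1 ≤ a → a ≤ r → reg′ 0 a ≡ reg 0 a + reg 1 a))
    Triple-score {m} {low} {reg} rep bound = Triple-mono ℕ.≤-refl
      (λ { _ m′ (low′ , reg′ , rep′ , refl , _ , vars , rest , done , _) → reg′ , rep′ , vars , rest , λ a 1≤a a≤r → done a 1≤a (s≤s a≤r) })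
      (Triple-for I (λ i low reg v p → p) body m low reg rep
        (refl , (λ _ → refl) , (λ _ → refl) , (λ _ _ → refl) , (λ a 1≤a a<1 → ⊥-elim (ℕ.<⇒≱ a<1 1≤a)) , (λ _ _ → refl)))
      where
      I : ℕ → Mem → (ℕ → Mem) → Set
      I i low′ reg′ = low′ ≡ low × (∀ a → reg′ 1 a ≡ reg 1 a) × (∀ j → reg′ 2 (suc j) ≡ reg 2 (suc j)) ×
        (∀ ρ a → reg′ (3 + ρ) a ≡ reg (3 + ρ) a) ×
        (∀ a → 1 ≤ a → a < i → reg′ 0 a ≡ reg 0 a + reg 1 a) × (∀ a → i ≤ a → reg′ 0 a ≡ reg 0 a)
      body : ∀ i m low reg′ → 1 ≤ i → i ≤ r → Rep m low reg′ → reg′ 2 0 ≡ i → I i low reg′ →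
        Triple m scoreP (197 * w) (ret tt) (λ _ m′ → ∃[ low′ ] ∃[ reg″ ] Rep m′ low′ reg″ × reg″ 2 0 ≡ i × I (suc i) low′ reg″)
      body i m low reg′ 1≤i i≤r rep′ i≡ (refl , coins , vars , rest , done , todo) =
        Triple-store-at rep′ 197 (ev-num 0 z≤n) evi
          (ev-op add (ev-at-reg rep′ (ev-num 0 z≤n) evi (admin<M z≤n) (ℕ.m≤n⇒m≤1+n i≤r) (todo i ℕ.≤-refl) (small s≤))
            (ev-at-reg rep′ (ev-num 1 (s≤s z≤n)) evi (admin<M (s≤s z≤n)) (ℕ.m≤n⇒m≤1+n i≤r) (coins i) (small c≤)) (small s≤) (small c≤))
          (admin<M z≤n) (ℕ.m≤n⇒m≤1+n i≤r) (small (bound i 1≤i i≤r))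
          λ m″ rep″ → low , _ , rep″ , i≡ , refl , coins , vars , rest , done′ , λ a i<a → trans (update-other (reg′ 0) _ (ℕ.>⇒≢ i<a)) (todo a (ℕ.<⇒≤ i<a))
        where
        evi = ev-var rep′ 0 z≤n i≡ (ℕ.≤-trans i≤r r≤U)
        s≤ = ℕ.≤-trans (ℕ.m≤m+n (reg 0 i) (reg 1 i)) (bound i 1≤i i≤r)
        c≤ = ℕ.≤-trans (ℕ.m≤n+m (reg 1 i) (reg 0 i)) (bound i 1≤i i≤r)
        done′ : ∀ a → 1 ≤ a → a < suc i → (reg′ 0 [ i ↦ reg 0 i + reg 1 i ]) a ≡ reg 0 a + reg 1 a
        done′ a 1≤a a<i+1 with a ℕ.≟ i
        ... | yes refl = update-same (reg′ 0) a _
        ... | no a≢i   = trans (update-other (reg′ 0) _ a≢i) (done a 1≤a (ℕ.≤∧≢⇒< (ℕ.≤-pred a<i+1) a≢i))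

    Stored-initial : ∀ {n} i (xs : Vec (G r) n) (low : Mem) → (∀ (j : Fin n) → low (i + toℕ j) ≡ lookup (codes xs) j) → Stored low i xs
    Stored-initial i []       low eq = tt
    Stored-initial i (x ∷ xs) low eq = trans (cong low (sym (ℕ.+-identityʳ i))) (eq zero) ,
      Stored-initial (suc i) xs low λ j → trans (cong low (sym (ℕ.+-suc i (toℕ j)))) (eq (suc j))

    trialTime : ℕ
    trialTime = 71 * w + ((34 * w + forTime resampleTime r) + (72 * w * T r + ((68 * w + T r + scoreTime) + 74 * w)))

    roundTime : ℕ
    roundTime = (D * trialTime + 1) + (101 * w + 69 * w)

    outputTime : ℕ
    outputTime = 34 * w + forTime (135 * w) r

    mainTime : ℕ
    mainTime = 34 * w + ((H * (41 * w + roundTime) + 41 * w) + outputTime)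

    module _ (X : Vec (G r) r) where

      X̂ : Mem
      X̂ = initial (encode X)

      -- `t` counts the trials of all rounds so far. It locates the first untouched region, 3 + t *
      -- (r + 1), and bounds every score, which keeps the scores within a word.
      Facts : ℕ → ℕ → ℕ → Vec ℕ r → (ℕ → Mem) → Set
      Facts t p h s reg = (∀ i → reg 0 (suc (toℕ i)) ≡ lookup s i) × reg 2 1 ≡ p × reg 2 2 ≡ t * suc r × reg 2 3 ≡ h ×
        (∀ ρ → t * suc r ≤ ρ → ∀ a → reg (3 + ρ) a ≡ 0) × (∀ i → lookup s i ≤ t)

      Inv : ℕ → ℕ → ℕ → Vec ℕ r → Mem → Set
      Inv t p h s m = ∃[ reg ] Rep m X̂ reg × Facts t p h s reg

      encode≤w : ∀ (Y : Vec (G r) r) a → bits (initial (encode Y) a) ≤ w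
      encode≤w Y zero    = small r≤U
      encode≤w Y (suc a) = initial-≤ {P = λ v → bits v ≤ w} (codes Y) (small z≤n)
        (λ i → subst (λ v → bits v ≤ w) (sym (Vec.lookup-map i ⟦_⟧ Y)) (code≤w (lookup Y i))) a

      Decided : Outcome → Set
      Decided o = Maybe.Any (λ (t , _) → t ≤ T r) o × Grown w o

      decided : ∀ Y → Always Decided (run (T r) 𝓐 (encode Y))
      decided Y = Always-zip (run (T r) 𝓐 (encode Y)) (λ _ → _,_) (halts r 1≤r Y)
        (grown-exec (T r) 𝓐 0 (initial (encode Y)) λ a → ℕ.≤-trans (encode≤w Y a) (ℕ.m≤m+n w 0))

      Triple-trial : ∀ t p h s m → suc t ≤ D * suc r → Inv t p h s m →
        Triple m trialP trialTime (trial X s) (Inv (suc t) p h)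
      Triple-trial t p h s m t<N (reg , rep , score , p≡ , q≡ , h≡ , fresh , bound) =
        Triple-⨾ (Triple-store-at rep 71 {R = λ (_ : ⊤) m₁ → Rep m₁ X̂ reg₁} (ev-trial rep q≡) (ev-num 0 z≤n) (ev-r rep) 3+q<M z≤n (small r≤U) λ _ → id)
          λ _ m₁ rep₁ →
        Triple-⨾ (Triple-⨾ (Triple-store-at rep₁ 34 {R = λ (_ : ⊤) m₂ → Rep m₂ X̂ reg₂}
            (ev-num 2 (s≤s (s≤s z≤n))) (ev-num 0 z≤n) (ev-num 1 (s≤s z≤n)) (admin<M ℕ.≤-refl) z≤n (small (ℕ.≤-trans (s≤s z≤n) r+1≤U)) λ _ → id)
            λ _ m₂ rep₂ → Triple-fillLoop X 1 (s≤s z≤n) refl rep₂ refl q≡ (Stored-initial 1 X X̂ (initial-lookup (codes X)))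
              λ ρ q<ρ a → trans (cong (λ s → s a) (setReg-other reg (reg (3 + q) [ 0 ↦ r ]) (ℕ.>⇒≢ (ℕ.≤-trans (ℕ.≤-reflexive (ℕ.+-comm 1 q)) q<ρ) ∘ ℕ.+-cancelˡ-≡ 3 ρ q)))
                (fresh ρ (ℕ.≤-trans (ℕ.m≤m+n q 1) q<ρ) a))
          λ { cz m₃ (reg₃ , rep₃ , filled) →
        Triple-⨾ (Simulation.Triple-confine X̂ reg₃ trialE (3 + q) 36 3+q<M (λ rep → ev-trial rep (trans (proj₁ (proj₂ filled) 1) q≡)) 𝓐
            {T = T r} {s = initial (encode (mix X cz))} {Q = Decided} (λ ()) (λ { _ _ (Maybe.just t≤ , _) → t≤ })
            (Rep-focus (3 + q) (input cz {reg₃} filled) rep₃) (decided (mix X cz)))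
          λ { (just (u , s′)) m₄ ((Maybe.just u≤ , grown) , rep₄) →
        Triple-⨾ {ν = ret} (decide cz {reg₃} filled u s′ u≤ grown rep₄) λ { s⁺ m₅ (refl , reg₅ , rep₅ , score₅ , vars₅ , fresh₅) →
        Triple-store-at rep₅ 74 (ev-num 2 (s≤s (s≤s z≤n))) (ev-num 2 (s≤s (s≤s z≤n)))
          (ev-op add (ev-var rep₅ 2 (s≤s (s≤s z≤n)) (trans (vars₅ 1) q≡) q≤U) (ev-r+1 rep₅) (small q≤U) (small r+1≤U))
          (admin<M ℕ.≤-refl) 2≤r+1 (small (ℕ.≤-trans (q+i≤ ℕ.≤-refl) N≤U))
          λ m₆ rep₆ → _ , rep₆ , score₅ , trans (vars₅ 0) p≡ , ℕ.+-comm q (suc r) , trans (vars₅ 2) h≡ ,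
            (λ ρ le a → fresh₅ ρ (ℕ.≤-trans (ℕ.≤-reflexive (ℕ.+-comm q (suc r))) le) a) , bound⁺ cz (accepts (just (u , s′))) } } }
        where
        q = t * suc r
        open Trial q (ℕ.≤-trans (ℕ.≤-trans (ℕ.≤-reflexive (ℕ.+-comm q (suc r))) (ℕ.*-monoˡ-≤ (suc r) t<N)) (ℕ.≤-reflexive (ℕ.*-assoc D (suc r) (suc r))))
        reg₁ reg₂ : ℕ → Mem
        reg₁ = setReg reg (3 + q) (reg (3 + q) [ 0 ↦ r ])
        reg₂ = setReg reg₁ 2 (reg₁ 2 [ 0 ↦ 1 ])

        2≤r+1 : 2 ≤ suc r
        2≤r+1 = ℕ.m≤n⇒m≤1+n 2≤r

        N≤U : D * (suc r * suc r) ≤ U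
        N≤U = ℕ.≤-trans (ℕ.m≤n+m _ 3) (ℕ.≤-trans (q<M ℕ.≤-refl) M≤U)

        t+1≤U : suc t ≤ U
        t+1≤U = ℕ.≤-trans t<N (ℕ.≤-trans (ℕ.*-monoʳ-≤ D (ℕ.m≤m*n (suc r) (suc r))) N≤U)

        ρ≢q : ∀ {ρ} → q + suc r ≤ ρ → ρ ≢ q
        ρ≢q le = ℕ.>⇒≢ (ℕ.≤-trans (s≤s (ℕ.m≤m+n q r)) (ℕ.≤-trans (ℕ.≤-reflexive (sym (ℕ.+-suc q r))) le))

        input : ∀ cz {reg₃} → Filled 1 (codes (mix X cz)) (flips cz) reg₂ reg₃ → ∀ a → reg₃ (3 + q) a ≡ initial (encode (mix X cz)) a
        input cz (_ , _ , _ , arr , _) a = trans (arr a) (trans (writeVec-cong 1 (codes (mix X cz))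
          (λ a → cong (λ s → s a) (setReg-same reg (3 + q) (reg (3 + q) [ 0 ↦ r ]))) a) (contents a))
          where
          contents : ∀ a → writeVec 1 (codes (mix X cz)) (reg (3 + q) [ 0 ↦ r ]) a ≡ initial (encode (mix X cz)) a
          contents zero    = writeVec-below 1 (codes (mix X cz)) (reg (3 + q) [ 0 ↦ r ]) (s≤s z≤n)
          contents (suc a) = writeVec-initial 1 (codes (mix X cz)) (reg (3 + q) [ 0 ↦ r ]) (λ a → fresh q ℕ.≤-refl (suc a)) a

        bound⁺ : ∀ cz b i → lookup (if b then addCoins cz s else s) i ≤ suc t
        bound⁺ cz false i = ℕ.m≤n⇒m≤1+n (bound i)
        bound⁺ cz true  i = subst (_≤ suc t) (sym (Vec.lookup-zipWith _ i cz s))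
          (ℕ.≤-trans (ℕ.+-mono-≤ (bound i) (𝟚≤1 (proj₁ (lookup cz i)))) (ℕ.≤-reflexive (ℕ.+-comm t 1)))
          where
          𝟚≤1 : ∀ b → 𝟚 b ≤ 1
          𝟚≤1 true  = s≤s z≤n
          𝟚≤1 false = z≤n

        module _ (cz : Vec (Bool × G r) r) {reg₃} (filled : Filled 1 (codes (mix X cz)) (flips cz) reg₂ reg₃) where
          coin≡ : ∀ i → reg₃ 1 (suc (toℕ i)) ≡ 𝟚 (proj₁ (lookup cz i))
          coin≡ i = trans (proj₁ (proj₂ (proj₂ filled)) (suc (toℕ i)))
            (trans (writeVec-lookup 1 (flips cz) (reg₂ 1) i) (Vec.lookup-map i (𝟚 ∘ proj₁) cz))

          score≡ : ∀ i → reg₃ 0 (suc (toℕ i)) ≡ lookup s i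
          score≡ i = trans (proj₁ filled (suc (toℕ i))) (score i)

          sum≡ : ∀ i → reg₃ 0 (suc (toℕ i)) + reg₃ 1 (suc (toℕ i)) ≡ lookup (addCoins cz s) i
          sum≡ i = trans (cong₂ _+_ (score≡ i) (coin≡ i)) (sym (Vec.lookup-zipWith _ i cz s))

          fresh₃ : ∀ ρ → q + suc r ≤ ρ → ∀ a → reg₃ (3 + ρ) a ≡ 0
          fresh₃ ρ le a = trans (proj₂ (proj₂ (proj₂ (proj₂ filled))) ρ le a)
            (trans (cong (λ s → s a) (setReg-other reg (reg (3 + q) [ 0 ↦ r ]) (ρ≢q le ∘ ℕ.+-cancelˡ-≡ 3 ρ q)))
              (fresh ρ (ℕ.≤-trans (ℕ.m≤m+n q (suc r)) le) a))

          module Test (s′ : Mem) {u m₄} (u≤ : u ≤ T r) (grown : Grown w (just (u , s′))) (rep₄ : Rep m₄ X̂ (setReg reg₃ (3 + q) s′)) where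
            reg₄ : ℕ → Mem
            reg₄ = setReg reg₃ (3 + q) s′

            evα : Ev m₄ (addrE trialE (lit 0)) (addr (3 + q) 0) 66
            evα = ev-addr rep₄ (ev-trial rep₄ (trans (proj₁ (proj₂ filled) 1) q≡)) (ev-num 0 z≤n) 3+q<M z≤n

            s′≡ : m₄ (addr (3 + q) 0) ≡ s′ 0
            s′≡ = trans (reg≡ rep₄ (3 + q) 0 3+q<M) (cong (λ s → s 0) (setReg-same reg₃ (3 + q) s′))

            value≡ : eval (at trialE (lit 0)) m₄ ≡ s′ 0
            value≡ = trans (cong m₄ (value evα)) s′≡

            -- The output of 𝓐 need not be small, but 𝓐 took the time to write it.
            cost≤ : cost (at trialE (lit 0)) m₄ ≤ 68 * w + T r
            cost≤ = begin
              cost (at trialE (lit 0)) m₄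
                ≡⟨ cost-cell {addrE trialE (lit 0)} {m₄} {addr (3 + q) 0} {s′ 0} (value evα) s′≡ ⟩
              cost (addrE trialE (lit 0)) m₄ + bits (addr (3 + q) 0) + bits (s′ 0)
                ≤⟨ ℕ.+-mono-≤ (ℕ.+-mono-≤ (time evα) (small (addr≤U rep₄ 3+q<M z≤n))) (ℕ.≤-trans (grown 0) (ℕ.+-monoʳ-≤ w u≤)) ⟩
              66 * w + w + (w + T r)
                ≡⟨ lem w (T r) ⟩
              68 * w + T r
                ∎
              where
              open ℕ.≤-Reasoning
              lem : ∀ w t → 66 * w + w + (w + t) ≡ 68 * w + t
              lem = solve-∀

            1≤ : 1 ≤ scoreTime
            1≤ = ℕ.≤-trans 1≤w (ℕ.≤-trans (ℕ.m≤m+n w (33 * w)) (ℕ.m≤m+n (34 * w) (forTime (197 * w) r)))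

            fresh₄ : ∀ ρ → q + suc r ≤ ρ → ∀ a → reg₄ (3 + ρ) a ≡ 0
            fresh₄ ρ le a = trans (cong (λ s → s a) (setReg-other reg₃ s′ (ρ≢q le ∘ ℕ.+-cancelˡ-≡ 3 ρ q))) (fresh₃ ρ le a)

          decide : ∀ u s′ → u ≤ T r → Grown w (just (u , s′)) → ∀ {m₄} → Rep m₄ X̂ (setReg reg₃ (3 + q) s′) →
            let s⁺ = if accepts (just (u , s′)) then addCoins cz s else s in
            Triple m₄ (cond (at trialE (lit 0)) (for scoreP) skip) (68 * w + T r + scoreTime) (ret s⁺)
              (λ s₅ m₅ → s⁺ ≡ s₅ × ∃[ reg₅ ] Rep m₅ X̂ reg₅ × (∀ i → reg₅ 0 (suc (toℕ i)) ≡ lookup s₅ i) ×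
                (∀ j → reg₅ 2 (suc j) ≡ reg 2 (suc j)) × (∀ ρ → q + suc r ≤ ρ → ∀ a → reg₅ (3 + ρ) a ≡ 0))
          decide u s′ u≤ grown {m₄} rep₄ with s′ 0 in s0≡
          ... | zero = Triple-cond-zero (trans value≡ s0≡) cost≤ (Triple-mono 1≤ (λ _ _ → id) (Triple-skip
              (refl , _ , rep₄ , score≡ , proj₁ (proj₂ filled) , fresh₄)))
            where
            open Test s′ u≤ grown rep₄
          ... | suc v = Triple-cond-suc (trans value≡ s0≡) cost≤ (Triple-map (λ _ → addCoins cz s)
              (λ { _ m₅ (reg₅ , rep₅ , vars₅ , rest₅ , score₅) → refl , reg₅ , rep₅ ,
                (λ i → trans (score₅ (suc (toℕ i)) (s≤s z≤n) (Fin.toℕ<n i)) (sum≡ i)) ,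
                (λ j → trans (vars₅ j) (proj₁ (proj₂ filled) j)) , λ ρ le a → trans (rest₅ ρ a) (fresh₄ ρ le a) })
              (Triple-score rep₄ λ a 1≤a a≤r → let j , eq = index 1≤a a≤r in
                subst (λ a → reg₃ 0 a + reg₃ 1 a ≤ U) eq (ℕ.≤-trans (ℕ.≤-reflexive (sum≡ j)) (ℕ.≤-trans (bound⁺ cz true j) t+1≤U))))
            where
            open Test s′ u≤ grown rep₄

      mainInit : Rep X̂ X̂ (λ ρ a → X̂ (addr ρ a))
      mainInit = record { size = refl ; low≡ = λ _ _ → refl ; reg≡ = λ _ _ _ → refl }

      beyond : ∀ ρ a → X̂ (addr ρ a) ≡ 0
      beyond ρ a = trans (cong X̂ (addr-def ρ a)) (initial-beyond (codes X) (r + (a * M + ρ)) (ℕ.m≤m+n r (a * M + ρ)))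

      2^d≤U : ∀ {d} → d ≤ H → 2 ^ d ≤ U
      2^d≤U {d} d≤H = begin
        2 ^ d                     ≤⟨ ℕ.^-monoʳ-≤ 2 d≤H ⟩
        2 * 2 ^ ⌊log₂ r ⌋         ≤⟨ ℕ.*-monoʳ-≤ 2 (2^log≤n r 1≤r) ⟩
        2 * r                     ≡⟨ cong (λ z → r + z) (ℕ.+-identityʳ r) ⟩
        r + r                     ≤⟨ ℕ.+-mono-≤ (ℕ.n≤1+n r) (ℕ.≤-trans (ℕ.n≤1+n r) (ℕ.≤-trans (ℕ.m≤m*n (suc r) M) (ℕ.m≤m+n (suc r * M) M))) ⟩
        U                         ∎
        where open ℕ.≤-Reasoning

      H≤r+1 : H ≤ suc r
      H≤r+1 = s≤s (ℕ.≤-trans (ℕ.<⇒≤ (n<2^n ⌊log₂ r ⌋)) (2^log≤n r 1≤r))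
        where
        n<2^n : ∀ n → n < 2 ^ n
        n<2^n zero    = s≤s z≤n
        n<2^n (suc n) = ℕ.+-mono-≤ (ℕ.m^n>0 2 n) (ℕ.≤-trans (n<2^n n) (ℕ.≤-reflexive (sym (ℕ.+-identityʳ (2 ^ n)))))

      -- There are H ≤ r + 1 rounds of D trials each; this is what the number of regions is made
      -- for.
      trials<N : ∀ {d j e i} → d + suc j ≡ H → e + suc i ≡ D → suc (d * D + e) ≤ D * suc r
      trials<N {d} {j} {e} {i} d+j≡H e+i≡D = begin
        suc (d * D + e)        ≡⟨ ℕ.+-suc (d * D) e ⟨
        d * D + suc e          ≤⟨ ℕ.+-monoʳ-≤ (d * D) (ℕ.≤-trans (ℕ.m≤m+n (suc e) i) (ℕ.≤-reflexive (trans (sym (ℕ.+-suc e i)) e+i≡D))) ⟩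
        d * D + D              ≡⟨ ℕ.+-comm (d * D) D ⟩
        suc d * D              ≤⟨ ℕ.*-monoˡ-≤ D (ℕ.≤-trans (ℕ.≤-trans (ℕ.m≤m+n (suc d) j) (ℕ.≤-reflexive (trans (sym (ℕ.+-suc d j)) d+j≡H))) H≤r+1) ⟩
        suc r * D              ≡⟨ ℕ.*-comm (suc r) D ⟩
        D * suc r              ∎
        where open ℕ.≤-Reasoning

      -- With d rounds done and j to come, the loop test vanishes exactly at d = H, because 2 ^
      -- ⌊log₂ r⌋ ≤ r < 2 ^ H.
      Round : ℕ → Vec ℕ r → Mem → Set
      Round j s m = ∃[ d ] d + j ≡ H × Inv (d * D) (2 ^ d) d s m

      ev-test : ∀ {d s m} → d ≤ H → Inv (d * D) (2 ^ d) d s m → Ev m (op sub r+1E pE) (suc r ∸ 2 ^ d) 41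
      ev-test d≤H (_ , rep , _ , p≡ , _) = ev-op sub (ev-r+1 rep) (ev-var rep 1 (s≤s z≤n) p≡ (2^d≤U d≤H)) (small r+1≤U) (small (2^d≤U d≤H))

      Triple-round : ∀ j s m → Round (suc j) s m → Triple m roundP roundTime (iter D (trial X) s) (Round j)
      Triple-round j s m (d , d+j≡H , inv) =
        Triple-then-ret
          (Triple-rep (trial X) (λ i s m → ∃[ e ] e + i ≡ D × Inv (d * D + e) (2 ^ d) d s m)
            (λ { i s m (e , e+i≡D , inv) → Triple-mono ℕ.≤-refl
                (λ { s′ m′ inv′ → suc e , trans (sym (ℕ.+-suc e i)) e+i≡D , subst (λ t → Inv t (2 ^ d) d s′ m′) (sym (ℕ.+-suc (d * D) e)) inv′ })
                (Triple-trial (d * D + e) (2 ^ d) d s m (trials<N d+j≡H e+i≡D) inv) })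
            D s m (0 , refl , subst (λ t → Inv t (2 ^ d) d s m) (sym (ℕ.+-identityʳ (d * D))) inv))
          λ { s′ m′ (e , e+0≡D , reg , rep , score , p≡ , q≡ , h≡ , fresh , bound) →
            let t≡ : d * D + e ≡ suc d * D
                t≡ = trans (cong (λ z → d * D + z) (trans (sym (ℕ.+-identityʳ e)) e+0≡D)) (ℕ.+-comm (d * D) D)
            in
            Triple-⨾ (Triple-store-at rep 101 {R = λ (_ : ⊤) m″ → Rep m″ X̂ (setReg reg 2 (reg 2 [ 1 ↦ 2 ^ suc d ]))} {x = tt}
                (ev-num 2 (s≤s (s≤s z≤n))) (ev-num 1 (s≤s z≤n))
                (ev-≡ (cong (λ z → 2 ^ d + z) (sym (ℕ.+-identityʳ (2 ^ d)))) (ev-op add (evp rep p≡) (evp rep p≡) (small (2^d≤U d≤H)) (small (2^d≤U d≤H))))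
                (admin<M ℕ.≤-refl) (ℕ.≤-trans (s≤s z≤n) 3≤r+1) (small (2^d≤U d<H)) λ _ → id)
            λ _ m″ rep″ → Triple-store-at rep″ 69 (ev-num 2 (s≤s (s≤s z≤n))) (ev-num 3 ℕ.≤-refl)
                (ev-op add (ev-num 1 (s≤s z≤n)) (ev-var rep″ 3 ℕ.≤-refl h≡ (ℕ.≤-trans d≤H (ℕ.≤-trans H≤r+1 r+1≤U)))
                  (small (ℕ.≤-trans (s≤s z≤n) r+1≤U)) (small (ℕ.≤-trans d≤H (ℕ.≤-trans H≤r+1 r+1≤U))))
                (admin<M ℕ.≤-refl) 3≤r+1 (small (ℕ.≤-trans d<H (ℕ.≤-trans H≤r+1 r+1≤U)))
                λ m‴ rep‴ → suc d , trans (sym (ℕ.+-suc d j)) d+j≡H , _ , rep‴ , score , refl , trans q≡ (cong (_* suc r) t≡) , refl ,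
                  (λ ρ le → fresh ρ (ℕ.≤-trans (ℕ.≤-reflexive (cong (_* suc r) t≡)) le)) , λ i → ℕ.≤-trans (bound i) (ℕ.≤-reflexive t≡) }
        where
        d<H : d < H
        d<H = ℕ.≤-trans (ℕ.m≤m+n (suc d) j) (ℕ.≤-reflexive (trans (sym (ℕ.+-suc d j)) d+j≡H))
        d≤H : d ≤ H
        d≤H = ℕ.<⇒≤ d<H
        evp : ∀ {m reg} → Rep m X̂ reg → reg 2 1 ≡ 2 ^ d → Ev m pE (2 ^ d) 33
        evp rep p≡ = ev-var rep 1 (s≤s z≤n) p≡ (2^d≤U d≤H)

      Triple-output : ∀ {m reg} s → Rep m X̂ reg → (∀ i → reg 0 (suc (toℕ i)) ≡ lookup s i) → (∀ i → lookup s i ≤ U) → reg 2 3 ≡ H →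
        Triple m (for outputP) outputTime (ret tt) (λ _ m′ → ∀ i → m′ (suc (toℕ i)) ≡ H ∸ lookup s i)
      Triple-output {m} {reg} s rep score bound h≡ = Triple-mono ℕ.≤-refl
        (λ { _ m′ (low′ , reg′ , rep′ , _ , _ , done) i → trans (low≡ rep′ (suc (toℕ i)) (Fin.toℕ<n i))
          (trans (done (suc (toℕ i)) (s≤s z≤n) (s≤s (Fin.toℕ<n i))) (cong (H ∸_) (score i))) })
        (Triple-for I (λ i low reg v p → p) body m X̂ reg rep ((λ _ → refl) , h≡ , λ a 1≤a a<1 → ⊥-elim (ℕ.<⇒≱ a<1 1≤a)))
        where
        H≤U : H ≤ U
        H≤U = ℕ.≤-trans H≤r+1 r+1≤U
        I : ℕ → Mem → (ℕ → Mem) → Set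
        I i low′ reg′ = (∀ a → reg′ 0 a ≡ reg 0 a) × reg′ 2 3 ≡ H × (∀ a → 1 ≤ a → a < i → low′ a ≡ H ∸ reg 0 a)
        body : ∀ i m low′ reg′ → 1 ≤ i → i ≤ r → Rep m low′ reg′ → reg′ 2 0 ≡ i → I i low′ reg′ →
          Triple m outputP (135 * w) (ret tt) (λ _ m′ → ∃[ low″ ] ∃[ reg″ ] Rep m′ low″ reg″ × reg″ 2 0 ≡ i × I (suc i) low″ reg″)
        body i m low′ reg′ 1≤i i≤r rep′ i≡ (same , h≡ , done) =
          Triple-store-low rep′ 135 evi (ev-op sub (ev-var rep′ 3 ℕ.≤-refl h≡ H≤U)
              (ev-at-reg rep′ (ev-num 0 z≤n) evi (admin<M z≤n) (ℕ.m≤n⇒m≤1+n i≤r) (same i) (small s≤)) (small H≤U) (small s≤))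
            1≤i i≤r (small (ℕ.≤-trans (ℕ.m∸n≤m H (reg 0 i)) H≤U))
            λ m″ rep″ → _ , reg′ , rep″ , i≡ , same , h≡ , done′
          where
          evi = ev-var rep′ 0 z≤n i≡ (ℕ.≤-trans i≤r r≤U)
          s≤ : reg 0 i ≤ U
          s≤ = let j , eq = index 1≤i i≤r in subst (λ a → reg 0 a ≤ U) eq (ℕ.≤-trans (ℕ.≤-reflexive (score j)) (bound j))
          done′ : ∀ a → 1 ≤ a → a < suc i → (low′ [ i ↦ H ∸ reg 0 i ]) a ≡ H ∸ reg 0 a
          done′ a 1≤a a<i+1 with a ℕ.≟ i
          ... | yes refl = update-same low′ a _
          ... | no a≢i   = trans (update-other low′ _ a≢i) (done a 1≤a (ℕ.≤∧≢⇒< (ℕ.≤-pred a<i+1) a≢i))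

      Triple-main : Triple X̂ mainP mainTime (scores X) (λ s m → ∀ i → m (suc (toℕ i)) ≡ H ∸ lookup s i)
      Triple-main =
        Triple-⨾ (Triple-store-at mainInit 34 {R = λ (_ : ⊤) m₁ → Rep m₁ X̂ (setReg reg₀ 2 (reg₀ 2 [ 1 ↦ 1 ]))} {x = tt}
            (ev-num 2 (s≤s (s≤s z≤n))) (ev-num 1 (s≤s z≤n)) (ev-num 1 (s≤s z≤n)) (admin<M ℕ.≤-refl) (ℕ.≤-trans (s≤s z≤n) 3≤r+1)
            (small (ℕ.≤-trans (s≤s z≤n) r+1≤U)) λ _ → id)
        λ _ m₁ rep₁ → Triple-then-ret
          (Triple-while (iter D (trial X)) Round step exit H (replicate r 0) m₁
            (0 , refl , _ , rep₁ , (λ i → trans (beyond 0 (suc (toℕ i))) (sym (Vec.lookup-replicate i 0))) , refl , beyond 2 2 , beyond 2 3 ,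
              (λ ρ _ a → beyond (3 + ρ) a) , λ i → ℕ.≤-reflexive (Vec.lookup-replicate i 0)))
          λ { s m₂ (d , d+0≡H , reg , rep , score , p≡ , q≡ , h≡ , fresh , bound) →
            Triple-map (λ _ → s) (λ _ m₃ out → out) (Triple-output s rep score
              (λ i → ℕ.≤-trans (bound i) (N≤U (trans (sym (ℕ.+-identityʳ d)) d+0≡H))) (trans h≡ (trans (sym (ℕ.+-identityʳ d)) d+0≡H))) }
        where
        reg₀ : ℕ → Mem
        reg₀ ρ a = X̂ (addr ρ a)
        step : ∀ j s m → Round (suc j) s m → (∃[ v ] eval (op sub r+1E pE) m ≡ suc v) × cost (op sub r+1E pE) m ≤ 41 * w ×
          Triple m roundP roundTime (iter D (trial X) s) (Round j)
        step j s m rnd@(d , d+j≡H , inv) = (r ∸ 2 ^ d , trans (value test′) (ℕ.+-∸-assoc 1 2^d≤r)) , time test′ , Triple-round j s m rnd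
          where
          d≤log : d ≤ ⌊log₂ r ⌋
          d≤log = ℕ.≤-pred (ℕ.≤-trans (ℕ.m≤m+n (suc d) j) (ℕ.≤-reflexive (trans (sym (ℕ.+-suc d j)) d+j≡H)))
          2^d≤r : 2 ^ d ≤ r
          2^d≤r = ℕ.≤-trans (ℕ.^-monoʳ-≤ 2 d≤log) (2^log≤n r 1≤r)
          test′ = ev-test {s = s} (ℕ.m≤n⇒m≤1+n d≤log) inv
        exit : ∀ s m → Round 0 s m → eval (op sub r+1E pE) m ≡ 0 × cost (op sub r+1E pE) m ≤ 41 * w
        exit s m (d , d+0≡H , inv) = trans (value test′) (ℕ.m≤n⇒m∸n≡0 (subst (λ d → r < 2 ^ d) (sym d≡H) (n<2^bits r))) , time test′
          where
          d≡H = trans (sym (ℕ.+-identityʳ d)) d+0≡H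
          test′ = ev-test {s = s} (ℕ.≤-reflexive d≡H) inv
        N≤U : ∀ {d} → d ≡ H → d * D ≤ U
        N≤U {d} refl = begin
          H * D                     ≤⟨ ℕ.*-monoˡ-≤ D H≤r+1 ⟩
          suc r * D                 ≡⟨ ℕ.*-comm (suc r) D ⟩
          D * suc r                 ≤⟨ ℕ.*-monoʳ-≤ D (ℕ.m≤m*n (suc r) (suc r)) ⟩
          D * (suc r * suc r)       ≤⟨ ℕ.m≤n+m _ 3 ⟩
          3 + D * (suc r * suc r)   ≤⟨ q<M ℕ.≤-refl ⟩
          M                         ≤⟨ M≤U ⟩
          U                         ∎
          where open ℕ.≤-Reasoning

-- Resampling coordinates of independent and of planted vectors

E-iid : ∀ n (d : Dist A) φ → E (iid (suc n) d) φ ≡ E d (λ x → E (iid n d) (λ xs → φ (x ∷ xs)))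
E-iid n d φ = trans (E->>= d _ φ) (E-cong d λ x → E->>= (iid n d) _ φ)

proper-iid : ∀ n {d : Dist A} → Proper d → Proper (iid n d)
proper-iid zero    p = ret []
proper-iid (suc n) p = Proper->>= p λ x → Proper->>= (proper-iid n p) λ xs → ret (x ∷ xs)

proper-coin : Proper coin
proper-coin = unif 1 λ { zero → ret false ; (suc zero) → ret true }

-- The old value at j is dropped, so its draw integrates out, and the fresh draw takes its place.
E-update : ∀ {n} {d : Dist A} → Proper d → ∀ (j : Fin n) φ →
  E (iid n d) (λ X → E d (λ x → φ (X [ j ]≔ x))) ≡ E (iid n d) φ
E-update {n = suc n} {d} p zero φ = begin
  E (iid (suc n) d) (λ X → E d (λ x → φ (X [ zero ]≔ x)))            ≡⟨ E-iid n d _ ⟩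
  E d (λ _ → E (iid n d) (λ xs → E d (λ x → φ (x ∷ xs))))            ≡⟨ E-const p _ ⟩
  E (iid n d) (λ xs → E d (λ x → φ (x ∷ xs)))                        ≡⟨ E-swap (iid n d) d _ ⟩
  E d (λ x → E (iid n d) (λ xs → φ (x ∷ xs)))                        ≡⟨ E-iid n d φ ⟨
  E (iid (suc n) d) φ                                                ∎
  where open ≡-Reasoning
E-update {n = suc n} {d} p (suc j) φ = trans (E-iid n d _)
  (trans (E-cong d (λ x → E-update p j (λ xs → φ (x ∷ xs)))) (sym (E-iid n d φ)))

mixWith : ∀ {n} → Vec Bool n → Vec A n → Vec A n → Vec A n
mixWith []      []       []       = []
mixWith (b ∷ C) (x ∷ X) (z ∷ Z) = (if b then z else x) ∷ mixWith C X Z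

-- For a fixed pattern C each coordinate keeps one of two independent draws, and the other
-- integrates out.
E-mix : ∀ {n} {d : Dist A} → Proper d → ∀ (C : Vec Bool n) φ →
  E (iid n d) (λ X → E (iid n d) (λ Z → φ (mixWith C X Z))) ≡ E (iid n d) φ
E-mix {n = zero} p [] φ = refl
E-mix {n = suc n} {d} p (b ∷ C) φ = begin
  E (iid (suc n) d) (λ X → E (iid (suc n) d) (λ Z → φ (mixWith (b ∷ C) X Z)))
    ≡⟨ E-iid n d _ ⟩
  E d (λ x → E (iid n d) (λ X → E (iid (suc n) d) (λ Z → φ (mixWith (b ∷ C) (x ∷ X) Z))))
    ≡⟨ E-cong d (λ x → E-cong (iid n d) (λ X → E-iid n d _)) ⟩
  E d (λ x → E (iid n d) (λ X → E d (λ z → E (iid n d) (λ Z → φ ((if b then z else x) ∷ mixWith C X Z)))))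
    ≡⟨ E-cong d (λ x → E-swap (iid n d) d _) ⟩
  E d (λ x → E d (λ z → E (iid n d) (λ X → E (iid n d) (λ Z → φ ((if b then z else x) ∷ mixWith C X Z)))))
    ≡⟨ E-cong d (λ x → E-cong d (λ z → E-mix p C (λ Y → φ ((if b then z else x) ∷ Y)))) ⟩
  E d (λ x → E d (λ z → E (iid n d) (λ Y → φ ((if b then z else x) ∷ Y))))
    ≡⟨ choose b ⟩
  E d (λ x → E (iid n d) (λ Y → φ (x ∷ Y)))
    ≡⟨ E-iid n d φ ⟨
  E (iid (suc n) d) φ
    ∎
  where
  open ≡-Reasoning
  choose : ∀ b → E d (λ x → E d (λ z → E (iid n d) (λ Y → φ ((if b then z else x) ∷ Y)))) ≡ E d (λ x → E (iid n d) (λ Y → φ (x ∷ Y)))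
  choose true  = E-const p _
  choose false = E-cong d (λ x → E-const p _)

lookup-mixWith : ∀ {n} (C : Vec Bool n) (X Z : Vec A n) i →
  lookup (mixWith C X Z) i ≡ (if lookup C i then lookup Z i else lookup X i)
lookup-mixWith (b ∷ C) (x ∷ X) (z ∷ Z) zero    = refl
lookup-mixWith (b ∷ C) (x ∷ X) (z ∷ Z) (suc i) = lookup-mixWith C X Z i

least-∈ : ∀ {n} (S : Subset n) {i} → least S ≡ just i → lookup S i ≡ true
least-∈ (true  ∷ S) refl = refl
least-∈ (false ∷ S) eq with least S in eq′
least-∈ (false ∷ S) refl | just i = least-∈ S eq′

least-nothing : ∀ {n} (S : Subset n) → least S ≡ nothing → ∀ i → lookup S i ≡ false
least-nothing (false ∷ S) eq zero = refl
least-nothing (false ∷ S) eq (suc i) with least S in eq′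
least-nothing (false ∷ S) eq (suc i) | nothing = least-nothing S eq′ i

lookup-remove-same : ∀ {n} (S : Subset n) i → lookup (S - i) i ≡ false
lookup-remove-same (b ∷ S) zero with b
... | true  = refl
... | false = refl
lookup-remove-same (b ∷ S) (suc i) = lookup-remove-same S i

lookup-─-∅ : ∀ {n} (S : Subset n) j → lookup (S ─ ∅) j ≡ lookup S j
lookup-─-∅ (b ∷ S) zero    = refl
lookup-─-∅ (b ∷ S) (suc j) = lookup-─-∅ S j

lookup-remove-other : ∀ {n} (S : Subset n) {i j} → j ≢ i → lookup (S - i) j ≡ lookup S j
lookup-remove-other (b ∷ S) {zero}  {zero}  j≢i = ⊥-elim (j≢i refl)
lookup-remove-other (b ∷ S) {zero}  {suc j} j≢i = lookup-─-∅ S j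
lookup-remove-other (b ∷ S) {suc i} {zero}  j≢i = refl
lookup-remove-other (b ∷ S) {suc i} {suc j} j≢i = lookup-remove-other S (j≢i ∘ cong suc)

module Resampling (𝓖 : GroupEnsemble) (r : ℕ) (nontrivial : 2 ≤ GroupEnsemble.order 𝓖 r) where
  open GroupEnsemble 𝓖
  module Gr = AbelianGroup (group r)
  module ∑ᴳ = CommutativeMonoidSum Gr.commutativeMonoid
  open import Relation.Binary.Reasoning.Setoid Gr.setoid as ≈-Reasoning using ()

  𝕌 : Dist (G r)
  𝕌 = uniform r

  proper-uniform : Proper 𝕌
  proper-uniform = proper-unif nontrivial (Inverse.from (enum r))
    where
    proper-unif : ∀ {n} → 2 ≤ n → (f : Fin n → G r) → Proper (unif n (λ i → ret (f i)))
    proper-unif (s≤s _) f = unif _ (λ i → ret (f i))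

  involution : ∀ (g x : G r) → ⊖ (⊖ (x ⊕ g) ⊕ g) ≈ x
  involution g x = begin
    ⊖ (⊖ (x ⊕ g) ⊕ g)          ≈⟨ Gr.⁻¹-cong (Gr.∙-congʳ (⁻¹-anti-homo-∙ x g)) ⟩
    ⊖ ((⊖ g ⊕ ⊖ x) ⊕ g)        ≈⟨ Gr.⁻¹-cong (Gr.∙-congʳ (Gr.comm (⊖ g) (⊖ x))) ⟩
    ⊖ ((⊖ x ⊕ ⊖ g) ⊕ g)        ≈⟨ Gr.⁻¹-cong (Gr.assoc (⊖ x) (⊖ g) g) ⟩
    ⊖ (⊖ x ⊕ (⊖ g ⊕ g))        ≈⟨ Gr.⁻¹-cong (Gr.∙-congˡ (Gr.inverseˡ g)) ⟩
    ⊖ (⊖ x ⊕ 0ᴳ)               ≈⟨ Gr.⁻¹-cong (Gr.identityʳ (⊖ x)) ⟩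
    ⊖ (⊖ x)                    ≈⟨ ⁻¹-involutive x ⟩
    x                          ∎
    where
    open ≈-Reasoning
    open AbelianGroupProperties (group r) using (⁻¹-anti-homo-∙; ⁻¹-involutive)

  -- The map x ↦ - (x + g) is an involution and hence permutes the enumeration of the group. Passing
  -- through the enumeration changes representatives, so φ has to respect `_≈_`.
  E-reflect : ∀ (φ : G r → ℚ) → (∀ {x y} → x ≈ y → φ x ≡ φ y) → ∀ g → E 𝕌 (λ x → φ (⊖ (x ⊕ g))) ≡ E 𝕌 φ
  E-reflect φ resp g = trans (mean-cong (order r) (λ i → resp (Gr.sym (from-to _))))
    (sym (mean-permute (order r) (φ ∘ from′) (permutation f f inv inv)))
    where
    from′ = Inverse.from (enum r)
    from-to : ∀ x → from′ (Inverse.to (enum r) x) ≈ x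
    from-to = Inverse.strictlyInverseʳ (enum r)
    f : Fin (order r) → Fin (order r)
    f i = Inverse.to (enum r) (⊖ (from′ i ⊕ g))
    inv : ∀ i → f (f i) ≡ i
    inv i = trans (Inverse.to-cong (enum r) (Gr.trans (Gr.⁻¹-cong (Gr.∙-congʳ (from-to _))) (involution g (from′ i))))
      (Inverse.strictlyInverseˡ (enum r) i)

  Respects : ∀ {n} → (Vec (G r) n → ℚ) → Set
  Respects φ = ∀ Y Y′ → (∀ i → lookup Y i ≈ lookup Y′ i) → φ Y ≡ φ Y′

  without : ∀ {n} → Fin n → (Fin n → G r) → Fin n → G r
  without j f i = if does (i Fin.≟ j) then 0ᴳ else f i

  sum-split : ∀ {n} j (f : Fin n → G r) → ∑ᴳ.sum f ≈ f j ⊕ ∑ᴳ.sum (without j f)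
  sum-split zero f = Gr.∙-congˡ (Gr.sym (Gr.identityˡ _))
  sum-split (suc j) f = begin
    f zero ⊕ ∑ᴳ.sum (f ∘ suc)                                    ≈⟨ Gr.∙-congˡ (sum-split j (f ∘ suc)) ⟩
    f zero ⊕ (f (suc j) ⊕ ∑ᴳ.sum (without j (f ∘ suc)))          ≈⟨ Gr.assoc _ _ _ ⟨
    (f zero ⊕ f (suc j)) ⊕ ∑ᴳ.sum (without j (f ∘ suc))          ≈⟨ Gr.∙-congʳ (Gr.comm _ _) ⟩
    (f (suc j) ⊕ f zero) ⊕ ∑ᴳ.sum (without j (f ∘ suc))          ≈⟨ Gr.assoc _ _ _ ⟩
    f (suc j) ⊕ (f zero ⊕ ∑ᴳ.sum (without j (f ∘ suc)))          ≈⟨ Gr.∙-congˡ (Gr.∙-congˡ (Gr.reflexive (∑ᴳ.sum-cong-≗ (λ i → eq i)))) ⟩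
    f (suc j) ⊕ (f zero ⊕ ∑ᴳ.sum (without (suc j) f ∘ suc))      ∎
    where
    open ≈-Reasoning
    eq : ∀ i → without j (f ∘ suc) i ≡ without (suc j) f (suc i)
    eq i with i Fin.≟ j
    ... | yes _ = refl
    ... | no _  = refl

  summand : Subset r → Vec (G r) r → Fin r → G r
  summand S X i = if lookup S i then lookup X i else 0ᴳ

  without-cong : ∀ {n} j {f g : Fin n → G r} → (∀ i → i ≢ j → f i ≡ g i) → ∀ i → without j f i ≡ without j g i
  without-cong j f≡g i with i Fin.≟ j
  ... | yes _  = refl
  ... | no i≢j = f≡g i i≢j

  sumOver-update : ∀ S (X : Vec (G r) r) j x → lookup S j ≡ true →
    sumOver S (X [ j ]≔ x) ≈ x ⊕ ∑ᴳ.sum (without j (summand S X))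
  sumOver-update S X j x j∈S = Gr.trans (sum-split j (summand S (X [ j ]≔ x))) (Gr.∙-cong
    (Gr.reflexive (trans (cong (λ b → if b then lookup (X [ j ]≔ x) j else 0ᴳ) j∈S) (Vec.lookup∘updateAt j X)))
    (Gr.reflexive (∑ᴳ.sum-cong-≗ (without-cong j λ i i≢j → cong (λ y → if lookup S i then y else 0ᴳ) (Vec.lookup∘update′ i≢j X x)))))

  sumOver-remove : ∀ S (X : Vec (G r) r) i → ∑ᴳ.sum (without i (summand S X)) ≡ sumOver (S - i) X
  sumOver-remove S X i = ∑ᴳ.sum-cong-≗ eq
    where
    eq : ∀ j → without i (summand S X) j ≡ summand (S - i) X j
    eq j with j Fin.≟ i
    ... | yes refl = cong (λ b → if b then lookup X j else 0ᴳ) (sym (lookup-remove-same S j))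
    ... | no j≢i   = cong (λ b → if b then lookup X j else 0ᴳ) (sym (lookup-remove-other S j≢i))

  module _ (k : ℕ) where
    open KSum k 𝓖 using (plant)

    sumOver-plant : ∀ S (X : Vec (G r) r) → sumOver S (plant S X) ≈ 0ᴳ
    sumOver-plant S X with least S in eq
    ... | nothing = Gr.trans (Gr.reflexive (∑ᴳ.sum-cong-≗ {r} (λ i → cong (λ b → if b then lookup X i else 0ᴳ) (least-nothing S eq i))))
      (∑ᴳ.sum-replicate-zero r)
    ... | just i = Gr.trans (sumOver-update S X i _ (least-∈ S eq))
      (Gr.trans (Gr.∙-congˡ (Gr.reflexive (sumOver-remove S X i))) (Gr.inverseˡ _))

    sumOver-cong : ∀ S (X Y : Vec (G r) r) → (∀ j → lookup S j ≡ true → lookup X j ≡ lookup Y j) → sumOver S X ≡ sumOver S Y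
    sumOver-cong S X Y eq = ∑ᴳ.sum-cong-≗ eq′
      where
      eq′ : ∀ j → summand S X j ≡ summand S Y j
      eq′ j with lookup S j in j∈S
      ... | true  = eq j j∈S
      ... | false = refl

    Hits : Vec Bool r → Subset r → Set
    Hits C S = ∃[ j ] lookup S j ≡ true × lookup C j ≡ true

    remove-⊆ : ∀ (S : Subset r) i {j} → lookup (S - i) j ≡ true → lookup S j ≡ true
    remove-⊆ S i {j} j∈ with j Fin.≟ i
    ... | yes refl with trans (sym j∈) (lookup-remove-same S j)
    ...   | ()
    remove-⊆ S i {j} j∈ | no j≢i = trans (sym (lookup-remove-other S j≢i)) j∈

    -- The planted value depends only on entries at positions in S, and none of these is replaced;
    -- so planting commutes with resampling.
    mix-plant : ∀ C S (X Z : Vec (G r) r) → ¬ Hits C S → ∀ l → lookup (mixWith C (plant S X) Z) l ≡ lookup (plant S (mixWith C X Z)) l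
    mix-plant C S X Z miss l with least S in eq
    ... | nothing = refl
    ... | just i with l Fin.≟ i
    ...   | yes refl = begin
      lookup (mixWith C (X [ i ]≔ _) Z) i
        ≡⟨ lookup-mixWith C _ Z i ⟩
      (if lookup C i then lookup Z i else lookup (X [ i ]≔ _) i)
        ≡⟨ cong (λ b → if b then lookup Z i else lookup (X [ i ]≔ _) i) (C≡false i (least-∈ S eq)) ⟩
      lookup (X [ i ]≔ _) i
        ≡⟨ Vec.lookup∘updateAt i X ⟩
      ⊖ sumOver (S - i) X
        ≡⟨ cong ⊖_ (sumOver-cong (S - i) X (mixWith C X Z) (λ j j∈ → sym (trans (lookup-mixWith C X Z j)
             (cong (λ b → if b then lookup Z j else lookup X j) (C≡false j (remove-⊆ S i j∈)))))) ⟩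
      ⊖ sumOver (S - i) (mixWith C X Z)
        ≡⟨ Vec.lookup∘updateAt i (mixWith C X Z) ⟨
      lookup (mixWith C X Z [ i ]≔ _) i
        ∎
      where
      open ≡-Reasoning
      C≡false : ∀ j → lookup S j ≡ true → lookup C j ≡ false
      C≡false j j∈S with lookup C j in eq
      ... | false = refl
      ... | true  = ⊥-elim (miss (j , j∈S , eq))
    ...   | no l≢i = begin
      lookup (mixWith C (X [ i ]≔ _) Z) l
        ≡⟨ lookup-mixWith C _ Z l ⟩
      (if lookup C l then lookup Z l else lookup (X [ i ]≔ _) l)
        ≡⟨ cong (λ x → if lookup C l then lookup Z l else x) (Vec.lookup∘update′ l≢i X _) ⟩
      (if lookup C l then lookup Z l else lookup X l)
        ≡⟨ lookup-mixWith C X Z l ⟨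
      lookup (mixWith C X Z) l
        ≡⟨ Vec.lookup∘update′ l≢i (mixWith C X Z) _ ⟨
      lookup (mixWith C X Z [ i ]≔ _) l
        ∎
      where open ≡-Reasoning

    𝕏 : Dist (Vec (G r) r)
    𝕏 = iid r 𝕌

    -- Planting can be moved behind the resampling, and the resampled vector is again uniform.
    E-resample-miss : ∀ {F} → Respects F → ∀ C S → ¬ Hits C S →
      E 𝕏 (λ X → E 𝕏 (λ Z → F (mixWith C (plant S X) Z))) ≡ E 𝕏 (λ X → F (plant S X))
    E-resample-miss {F} resp C S miss = trans
      (E-cong 𝕏 λ X → E-cong 𝕏 λ Z → resp _ _ (λ l → Gr.reflexive (mix-plant C S X Z miss l)))
      (E-mix proper-uniform C (F ∘ plant S))

    -- If an element of the planted set is resampled, the planted element is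
    -- uniform given all the others.
    E-resample-hit : ∀ {F} → Respects F → ∀ C S → Hits C S →
      E 𝕏 (λ X → E 𝕏 (λ Z → F (mixWith C (plant S X) Z))) ≡ E 𝕏 F
    E-resample-hit {F} resp C S (j , j∈S , Cj) with least S in eq
    ... | nothing = E-mix proper-uniform C F
    ... | just i with lookup C i in Ci
    -- The planted entry itself is replaced, so that planting leaves no trace.
    ...   | true = trans (E-cong 𝕏 λ X → E-cong 𝕏 λ Z → resp _ _ (λ l → Gr.reflexive (overwritten X Z l))) (E-mix proper-uniform C F)
      where
      overwritten : ∀ X Z l → lookup (mixWith C (X [ i ]≔ (⊖ sumOver (S - i) X)) Z) l ≡ lookup (mixWith C X Z) l
      overwritten X Z l with l Fin.≟ i
      ... | yes refl = trans (lookup-mixWith C _ Z i) (trans (cong (λ b → if b then lookup Z i else _) Ci)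
        (sym (trans (lookup-mixWith C X Z i) (cong (λ b → if b then lookup Z i else lookup X i) Ci))))
      ... | no l≢i = trans (lookup-mixWith C _ Z l) (trans (cong (λ x → if lookup C l then lookup Z l else x) (Vec.lookup∘update′ l≢i X _))
        (sym (lookup-mixWith C X Z l)))
    -- The planted entry i stays and the entry j of S is replaced, so the old value x at j survives
    -- only in the planted value - (x + rest). Redrawing x makes that value uniform, whatever the
    -- other entries are.
    ...   | false = begin
      E 𝕏 (λ X → E 𝕏 (λ Z → F (mixWith C (planted X) Z)))
        ≡⟨ E-update proper-uniform j (λ X → E 𝕏 (λ Z → F (mixWith C (planted X) Z))) ⟨
      E 𝕏 (λ X → E 𝕌 (λ x → E 𝕏 (λ Z → F (mixWith C (planted (X [ j ]≔ x)) Z))))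
        ≡⟨ E-cong 𝕏 (λ X → E-swap 𝕌 𝕏 (λ x Z → F (mixWith C (planted (X [ j ]≔ x)) Z))) ⟩
      E 𝕏 (λ X → E 𝕏 (λ Z → E 𝕌 (λ x → F (mixWith C (planted (X [ j ]≔ x)) Z))))
        ≡⟨ E-cong 𝕏 (λ X → E-cong 𝕏 (λ Z → E-cong 𝕌 (λ x → resp (mixWith C (planted (X [ j ]≔ x)) Z) (mixWith C X Z [ i ]≔ (⊖ (x ⊕ rest X))) (shape X Z x)))) ⟩
      E 𝕏 (λ X → E 𝕏 (λ Z → E 𝕌 (λ x → F (mixWith C X Z [ i ]≔ (⊖ (x ⊕ rest X))))))
        ≡⟨ E-cong 𝕏 (λ X → E-cong 𝕏 (λ Z → E-reflect (λ x → F (mixWith C X Z [ i ]≔ x)) (λ {x} {y} x≈y → resp (mixWith C X Z [ i ]≔ x) (mixWith C X Z [ i ]≔ y) (update-≈ (mixWith C X Z) x≈y)) (rest X))) ⟩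
      E 𝕏 (λ X → E 𝕏 (λ Z → E 𝕌 (λ x → F (mixWith C X Z [ i ]≔ x))))
        ≡⟨ E-mix proper-uniform C (λ Y → E 𝕌 (λ x → F (Y [ i ]≔ x))) ⟩
      E 𝕏 (λ Y → E 𝕌 (λ x → F (Y [ i ]≔ x)))
        ≡⟨ E-update proper-uniform i F ⟩
      E 𝕏 F
        ∎
      where
      open ≡-Reasoning
      planted : Vec (G r) r → Vec (G r) r
      planted X = X [ i ]≔ (⊖ sumOver (S - i) X)
      rest : Vec (G r) r → G r
      rest X = ∑ᴳ.sum (without j (summand (S - i) X))
      j≢i : j ≢ i
      j≢i refl with trans (sym Ci) Cj
      ... | ()
      update-≈ : ∀ (Y : Vec (G r) r) {x y} → x ≈ y → ∀ l → lookup (Y [ i ]≔ x) l ≈ lookup (Y [ i ]≔ y) l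
      update-≈ Y {x} {y} x≈y l with l Fin.≟ i
      ... | yes refl = Gr.trans (Gr.reflexive (Vec.lookup∘updateAt i Y)) (Gr.trans x≈y (Gr.reflexive (sym (Vec.lookup∘updateAt i Y))))
      ... | no l≢i   = Gr.reflexive (trans (Vec.lookup∘update′ l≢i Y x) (sym (Vec.lookup∘update′ l≢i Y y)))
      shape : ∀ X Z x l → lookup (mixWith C (planted (X [ j ]≔ x)) Z) l ≈ lookup (mixWith C X Z [ i ]≔ (⊖ (x ⊕ rest X))) l
      shape X Z x l with l Fin.≟ i
      ... | yes refl = Gr.trans (Gr.reflexive (trans (lookup-mixWith C _ Z i) (trans (cong (λ b → if b then lookup Z i else lookup (planted (X [ j ]≔ x)) i) Ci) (Vec.lookup∘updateAt i (X [ j ]≔ x)))))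
        (Gr.trans (Gr.⁻¹-cong (sumOver-update (S - i) X j x (trans (lookup-remove-other S j≢i) j∈S)))
        (Gr.reflexive (sym (Vec.lookup∘updateAt i (mixWith C X Z)))))
      ... | no l≢i = Gr.reflexive (trans (lookup-mixWith C _ Z l) (trans (trans (cong (λ y → if lookup C l then lookup Z l else y) (Vec.lookup∘update′ l≢i (X [ j ]≔ x) _)) other)
          (trans (sym (lookup-mixWith C X Z l)) (sym (Vec.lookup∘update′ l≢i (mixWith C X Z) _)))))
        where
        other : (if lookup C l then lookup Z l else lookup (X [ j ]≔ x) l) ≡ (if lookup C l then lookup Z l else lookup X l)
        other with l Fin.≟ j
        ... | yes refl = trans (cong (λ b → if b then lookup Z l else lookup (X [ j ]≔ x) l) Cj) (cong (λ b → if b then lookup Z l else lookup X l) (sym Cj))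
        ... | no l≢j   = cong (λ y → if lookup C l then lookup Z l else y) (Vec.lookup∘update′ l≢j X x)

-- Powers, drift along iterations, and coin patterns

pow : ℚ → ℕ → ℚ
pow q zero    = 1ℚ
pow q (suc n) = q ℚ.* pow q n

pow-nonneg : ∀ {q} n → 0ℚ ℚ.≤ q → 0ℚ ℚ.≤ pow q n
pow-nonneg zero    0≤q = 0≤1
pow-nonneg (suc n) 0≤q = *-nonneg 0≤q (pow-nonneg n 0≤q)

*-mono : ∀ {p q r s} → 0ℚ ℚ.≤ p → 0ℚ ℚ.≤ s → p ℚ.≤ q → r ℚ.≤ s → p ℚ.* r ℚ.≤ q ℚ.* s
*-mono 0≤p 0≤s p≤q r≤s = ℚ.≤-trans (*-monoˡ 0≤p r≤s) (*-monoʳ 0≤s p≤q)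

pow-mono : ∀ {p q} n → 0ℚ ℚ.≤ p → p ℚ.≤ q → pow p n ℚ.≤ pow q n
pow-mono zero    0≤p p≤q = ℚ.≤-refl
pow-mono (suc n) 0≤p p≤q = *-mono 0≤p (pow-nonneg n (ℚ.≤-trans 0≤p p≤q)) p≤q (pow-mono n 0≤p p≤q)

*-interchange : ∀ a b c d → (a ℚ.* b) ℚ.* (c ℚ.* d) ≡ (a ℚ.* c) ℚ.* (b ℚ.* d)
*-interchange = solve 4 (λ a b c d → (a :* b) :* (c :* d) := (a :* c) :* (b :* d)) refl
  where open +-*-Solver

pow-* : ∀ p q n → pow (p ℚ.* q) n ≡ pow p n ℚ.* pow q n
pow-* p q zero    = refl
pow-* p q (suc n) = trans (cong ((p ℚ.* q) ℚ.*_) (pow-* p q n)) (*-interchange p q (pow p n) (pow q n))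

pow-1 : ∀ n → pow 1ℚ n ≡ 1ℚ
pow-1 zero    = refl
pow-1 (suc n) = trans (ℚ.*-identityˡ (pow 1ℚ n)) (pow-1 n)

ι-^ : ∀ n → ι (2 ^ n) ≡ pow (ι 2) n
ι-^ zero    = refl
ι-^ (suc n) = trans (ι-* 2 (2 ^ n)) (cong (ι 2 ℚ.*_) (ι-^ n))

pow-2-½ : ∀ n → pow (ι 2) n ℚ.* pow ½ n ≡ 1ℚ
pow-2-½ n = trans (sym (pow-* (ι 2) ½ n)) (pow-1 n)

0≤½ : 0ℚ ℚ.≤ ½
0≤½ = ℚ.nonNegative⁻¹ ½

½≤1 : ½ ℚ.≤ 1ℚ
½≤1 = ℚ.≤ᵇ⇒≤ tt

pow-½-antitone : ∀ {m n} → m ≤ n → pow ½ n ℚ.≤ pow ½ m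
pow-½-antitone {n = zero}  z≤n = ℚ.≤-refl
pow-½-antitone {n = suc n} z≤n = ℚ.≤-trans (*-mono 0≤½ 0≤1 ½≤1 (pow-½-antitone {0} {n} z≤n)) (ℚ.≤-reflexive (ℚ.*-identityˡ 1ℚ))
pow-½-antitone (s≤s m≤n) = *-monoˡ 0≤½ (pow-½-antitone m≤n)

0≤p-q : ∀ {p q} → q ℚ.≤ p → 0ℚ ℚ.≤ p ℚ.- q
0≤p-q {p} {q} q≤p = ℚ.≤-trans (ℚ.≤-reflexive (sym (ℚ.+-inverseʳ q))) (ℚ.+-monoˡ-≤ (ℚ.- q) q≤p)

p-q-antitone : ∀ p {q r} → q ℚ.≤ r → p ℚ.- r ℚ.≤ p ℚ.- q
p-q-antitone p q≤r = ℚ.+-monoʳ-≤ p (ℚ.neg-antimono-≤ q≤r)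

-- Condition on the first step. With the score of one element as V, the bound serves twice: for the
-- trials of a round and for the rounds.
E-iter-+ : ∀ {f : A → Dist A} {V : A → ℚ} {c} → (∀ s → Proper (f s)) → (∀ s → E (f s) V ℚ.≤ V s ℚ.+ c) →
  ∀ n s → E (iter n f s) V ℚ.≤ V s ℚ.+ ι n ℚ.* c
E-iter-+ {V = V} {c} proper step zero s = ℚ.≤-reflexive (sym (trans (cong (V s ℚ.+_) (ℚ.*-zeroˡ c)) (ℚ.+-identityʳ (V s))))
E-iter-+ {f = f} {V} {c} proper step (suc n) s = begin
  E (f s >>= iter n f) V                       ≡⟨ E->>= (f s) (iter n f) V ⟩
  E (f s) (λ t → E (iter n f t) V)             ≤⟨ E-mono (f s) (E-iter-+ proper step n) ⟩
  E (f s) (λ t → V t ℚ.+ ι n ℚ.* c)            ≡⟨ trans (E-+ (f s) V (λ _ → ι n ℚ.* c)) (cong (E (f s) V ℚ.+_) (E-const (proper s) (ι n ℚ.* c))) ⟩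
  E (f s) V ℚ.+ ι n ℚ.* c                      ≤⟨ ℚ.+-monoˡ-≤ (ι n ℚ.* c) (step s) ⟩
  V s ℚ.+ c ℚ.+ ι n ℚ.* c                      ≡⟨ lem (V s) c (ι n) ⟩
  V s ℚ.+ (1ℚ ℚ.+ ι n) ℚ.* c                   ≡⟨ cong (λ x → V s ℚ.+ x ℚ.* c) (sym (ι-+ 1 n)) ⟩
  V s ℚ.+ ι (suc n) ℚ.* c                      ∎
  where
  open ℚ.≤-Reasoning
  open +-*-Solver
  lem : ∀ v c n → v ℚ.+ c ℚ.+ n ℚ.* c ≡ v ℚ.+ (1ℚ ℚ.+ n) ℚ.* c
  lem = solve 3 (λ v c n → v :+ c :+ n :* c := v :+ (con 1ℚ :+ n) :* c) refl

-- The multiplicative analogue, for the potential 2 ^ (- score). Independence of the steps is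
-- contained in the step bound, which holds from every state.
E-iter-* : ∀ {f : A → Dist A} {V : A → ℚ} {ρ} → 0ℚ ℚ.≤ ρ → (∀ s → E (f s) V ℚ.≤ ρ ℚ.* V s) →
  ∀ n s → E (iter n f s) V ℚ.≤ pow ρ n ℚ.* V s
E-iter-* {V = V} 0≤ρ step zero s = ℚ.≤-reflexive (sym (ℚ.*-identityˡ (V s)))
E-iter-* {f = f} {V} {ρ} 0≤ρ step (suc n) s = begin
  E (f s >>= iter n f) V                       ≡⟨ E->>= (f s) (iter n f) V ⟩
  E (f s) (λ t → E (iter n f t) V)             ≤⟨ E-mono (f s) (E-iter-* 0≤ρ step n) ⟩
  E (f s) (λ t → pow ρ n ℚ.* V t)              ≡⟨ E-* (f s) (pow ρ n) V ⟩
  pow ρ n ℚ.* E (f s) V                        ≤⟨ *-monoˡ (pow-nonneg n 0≤ρ) (step s) ⟩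
  pow ρ n ℚ.* (ρ ℚ.* V s)                      ≡⟨ trans (sym (ℚ.*-assoc (pow ρ n) ρ (V s))) (cong (ℚ._* V s) (ℚ.*-comm (pow ρ n) ρ)) ⟩
  pow ρ (suc n) ℚ.* V s                        ∎
  where open ℚ.≤-Reasoning

proper-iter : ∀ {f : A → Dist A} → (∀ s → Proper (f s)) → ∀ n s → Proper (iter n f s)
proper-iter p zero    s = ret s
proper-iter p (suc n) s = Proper->>= (p s) (proper-iter p n)

-- A cylinder event: `just b` prescribes a coin and `nothing` leaves it free, so that each
-- prescribed coin halves the probability.
meets : ∀ {n} → Vec (Maybe Bool) n → Vec Bool n → Bool
meets []                []      = true
meets (nothing ∷ K)     (b ∷ C) = meets K C
meets (just true ∷ K)   (b ∷ C) = b ∧ meets K C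
meets (just false ∷ K)  (b ∷ C) = not b ∧ meets K C

#_ : ∀ {n} → Vec (Maybe Bool) n → ℕ
# []            = 0
# (nothing ∷ K) = # K
# (just _ ∷ K)  = suc (# K)

meets-lookup : ∀ {n} (K : Vec (Maybe Bool) n) C {i b} → meets K C ≡ true → lookup K i ≡ just b → lookup C i ≡ b
meets-lookup (nothing ∷ K)    (b ∷ C)     {suc i} m eq   = meets-lookup K C m eq
meets-lookup (just true ∷ K)  (true ∷ C)  {zero}  m refl = refl
meets-lookup (just true ∷ K)  (true ∷ C)  {suc i} m eq   = meets-lookup K C m eq
meets-lookup (just false ∷ K) (false ∷ C) {zero}  m refl = refl
meets-lookup (just false ∷ K) (false ∷ C) {suc i} m eq   = meets-lookup K C m eq

E-coin : ∀ φ → E coin φ ≡ ½ ℚ.* (φ false ℚ.+ φ true)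
E-coin φ = cong (λ x → ½ ℚ.* (φ false ℚ.+ x)) (ℚ.+-identityʳ (φ true))

E-meets : ∀ {n} (K : Vec (Maybe Bool) n) → E (iid n coin) (𝟙 ∘ meets K) ≡ pow ½ (# K)
E-meets []      = refl
E-meets {suc n} (c ∷ K) = trans (E-iid n coin _) (trans (E-coin (λ b → E (iid n coin) (λ C → 𝟙 (meets (c ∷ K) (b ∷ C))))) (case c))
  where
  open +-*-Solver
  twice : ∀ x → ½ ℚ.* (x ℚ.+ x) ≡ x
  twice = solve 1 (λ x → con ½ :* (x :+ x) := x) refl
  case : ∀ c → ½ ℚ.* (E (iid n coin) (λ C → 𝟙 (meets (c ∷ K) (false ∷ C))) ℚ.+ E (iid n coin) (λ C → 𝟙 (meets (c ∷ K) (true ∷ C)))) ≡ pow ½ (# (c ∷ K))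
  case nothing      = trans (twice (E (iid n coin) (𝟙 ∘ meets K))) (E-meets K)
  case (just true)  = cong (½ ℚ.*_) (trans (cong₂ ℚ._+_ (E-0 (iid n coin)) (E-meets K)) (ℚ.+-identityˡ (pow ½ (# K))))
  case (just false) = cong (½ ℚ.*_) (trans (cong₂ ℚ._+_ (E-meets K) (E-0 (iid n coin))) (ℚ.+-identityʳ (pow ½ (# K))))

spare : Bool → Maybe Bool
spare b = if b then just false else nothing

-- The pattern that keeps the planted elements and resamples i. It fixes at most |S| + 1 coins,
-- which is where 2 ^ (- (k + 1)) comes from.
sparing : ∀ {n} → Subset n → Fin n → Vec (Maybe Bool) n
sparing S i = Vec.map spare S [ i ]≔ just true

#-spare : ∀ {n} (S : Subset n) → # (Vec.map spare S) ≡ ∣ S ∣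
#-spare []          = refl
#-spare (true ∷ S)  = cong suc (#-spare S)
#-spare (false ∷ S) = #-spare S

#-update : ∀ {n} (K : Vec (Maybe Bool) n) i b → # (K [ i ]≔ just b) ≤ suc (# K)
#-update (nothing ∷ K) zero    b = ℕ.≤-refl
#-update (just _ ∷ K)  zero    b = ℕ.n≤1+n _
#-update (nothing ∷ K) (suc i) b = #-update K i b
#-update (just _ ∷ K)  (suc i) b = s≤s (#-update K i b)

sum-∣∣ : ∀ {n} (S : Subset n) → sum (λ i → 𝟙 (lookup S i)) ≡ ι ∣ S ∣
sum-∣∣ []          = refl
sum-∣∣ (true ∷ S)  = trans (cong (1ℚ ℚ.+_) (sum-∣∣ S)) (sym (ι-+ 1 ∣ S ∣))
sum-∣∣ (false ∷ S) = trans (ℚ.+-identityˡ _) (sum-∣∣ S)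

∈-subsets : ∀ {n} (S : Subset n) → S ∈ subsets n
∈-subsets []          = here refl
∈-subsets (false ∷ S) = ∈-++⁺ˡ (∈-map⁺ (outside ∷_) (∈-subsets S))
∈-subsets {suc n} (true ∷ S) = ∈-++⁺ʳ (List.map (outside ∷_) (subsets n)) (∈-map⁺ (inside ∷_) (∈-subsets S))

subset-of-size : ∀ {k n} → k ≤ n → ∃[ S ] ∣ S ∣ ≡ k × S ∈ subsetsOfSize k n
subset-of-size {k} {n} k≤n = let S , eq = find k≤n in S , eq , ∈-filter⁺ (λ S → ∣ S ∣ ℕ.≟ k) (∈-subsets S) eq
  where
  find : ∀ {k n} → k ≤ n → Σ[ S ∈ Subset n ] ∣ S ∣ ≡ k
  find {n = zero}  z≤n = [] , refl
  find {n = suc n} z≤n = let S , eq = find {n = n} z≤n in outside ∷ S , eq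
  find (s≤s k≤n) = let S , eq = find k≤n in inside ∷ S , cong suc eq

size-of-drawn : ∀ {k n} j → ∣ List.lookup (subsetsOfSize k n) j ∣ ≡ k
size-of-drawn {k} {n} j = proj₂ (∈-filter⁻ (λ S → ∣ S ∣ ℕ.≟ k) {xs = subsets n} (∈-lookup j))

proper-uniformFrom : ∀ {x : A} {xs} → x ∈ xs → Proper (uniformFrom xs)
proper-uniformFrom {xs = x ∷ xs} _ = unif (length xs) (λ i → ret (List.lookup (x ∷ xs) i))

𝟙*≤ : ∀ b {x y} → 0ℚ ℚ.≤ y → (b ≡ true → x ℚ.≤ y) → 𝟙 b ℚ.* x ℚ.≤ y
𝟙*≤ true  {x} 0≤y x≤y = ℚ.≤-trans (ℚ.≤-reflexive (ℚ.*-identityˡ x)) (x≤y refl)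
𝟙*≤ false {x} 0≤y x≤y = ℚ.≤-trans (ℚ.≤-reflexive (ℚ.*-zeroˡ x)) 0≤y

-- Probability analysis

module Analysis {k 𝓖 Δ} (adm : Admissible k 𝓖 Δ) (𝓐 : Program) (T : ℕ → ℕ)
  (halts : KSum.RunsInTime k 𝓖 𝓐 T) (D r : ℕ) (1≤r : 1 ≤ r) where
  open GroupEnsemble 𝓖
  open KSum k 𝓖
  open Reduction adm 𝓐 T halts D using (module Ideal)
  open Ideal r
  open Resampling 𝓖 r (Admissible.nontrivial adm r 1≤r)

  𝕊 : Dist (Subset r)
  𝕊 = uniformFrom (subsetsOfSize k r)

  Y∼ : Dist (Vec (G r) r)
  Y∼ = 𝕏 k

  decision : Vec (G r) r → Dist Outcome
  decision Y = run (T r) 𝓐 (encode Y)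

  accept : Vec (G r) r → ℚ
  accept Y = E (decision Y) (𝟙 ∘ accepts)

  proper-decision : ∀ Y → Proper (decision Y)
  proper-decision Y = proper-exec (T r) 𝓐 _

  0≤accept : ∀ Y → 0ℚ ℚ.≤ accept Y
  0≤accept Y = E-nonneg (decision Y) (0≤𝟙 ∘ accepts)

  accept≤1 : ∀ Y → accept Y ℚ.≤ 1ℚ
  accept≤1 Y = E-≤const (decision Y) 0≤1 (𝟙≤1 ∘ accepts)

  accept-respects : Respects accept
  accept-respects Y Y′ Y≈Y′ = cong (λ c → E (run (T r) 𝓐 (r ∷ toList c)) (𝟙 ∘ accepts)) (codes≡ Y Y′ Y≈Y′)
    where
    codes≡ : ∀ {n} (Y Y′ : Vec (G r) n) → (∀ i → lookup Y i ≈ lookup Y′ i) → Vec.map ⟦_⟧ Y ≡ Vec.map ⟦_⟧ Y′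
    codes≡ []      []        eq = refl
    codes≡ (y ∷ Y) (y′ ∷ Y′) eq = cong₂ _∷_ (Injection.cong (code r) (eq zero)) (codes≡ Y Y′ (eq ∘ suc))

  proper-pair : Proper pair
  proper-pair = Proper->>= proper-coin λ b → Proper->>= proper-uniform λ z → ret (b , z)

  E-pairs : ∀ n φ → E (iid n pair) φ ≡ E (iid n coin) (λ C → E (iid n 𝕌) (λ Z → φ (Vec.zip C Z)))
  E-pairs zero φ = refl
  E-pairs (suc n) φ = begin
    E (iid (suc n) pair) φ
      ≡⟨ E-iid n pair φ ⟩
    E pair (λ x → E (iid n pair) (λ xs → φ (x ∷ xs)))
      ≡⟨ trans (E->>= coin (λ b → 𝕌 >>= λ z → ret (b , z)) φ′) (E-cong coin λ b → E->>= 𝕌 (λ z → ret (b , z)) φ′) ⟩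
    E coin (λ b → E 𝕌 (λ z → E (iid n pair) (λ xs → φ ((b , z) ∷ xs))))
      ≡⟨ E-cong coin (λ b → E-cong 𝕌 λ z → E-pairs n (λ xs → φ ((b , z) ∷ xs))) ⟩
    E coin (λ b → E 𝕌 (λ z → E (iid n coin) (λ C → E (iid n 𝕌) (λ Z → φ ((b , z) ∷ Vec.zip C Z)))))
      ≡⟨ E-cong coin (λ b → E-swap 𝕌 (iid n coin) (λ z C → E (iid n 𝕌) (λ Z → φ ((b , z) ∷ Vec.zip C Z)))) ⟩
    E coin (λ b → E (iid n coin) (λ C → E 𝕌 (λ z → E (iid n 𝕌) (λ Z → φ ((b , z) ∷ Vec.zip C Z)))))
      ≡⟨ trans (E-iid n coin _) (E-cong coin λ b → E-cong (iid n coin) λ C → E-iid n 𝕌 (λ Z → φ (Vec.zip (b ∷ C) Z))) ⟨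
    E (iid (suc n) coin) (λ C → E (iid (suc n) 𝕌) (λ Z → φ (Vec.zip C Z)))
      ∎
    where
    open ≡-Reasoning
    φ′ : Bool × G r → ℚ
    φ′ x = E (iid n pair) (λ xs → φ (x ∷ xs))

  mix-zip : ∀ {n} (C : Vec Bool n) (X Z : Vec (G r) n) → mix X (Vec.zip C Z) ≡ mixWith C X Z
  mix-zip []      []      []      = refl
  mix-zip (b ∷ C) (x ∷ X) (z ∷ Z) = cong (_ ∷_) (mix-zip C X Z)

  coins : Dist (Vec Bool r)
  coins = iid r coin

  -- The expected gain of element i in one trial on the input P.
  freq : Vec (G r) r → Fin r → ℚ
  freq P i = E (iid r pair) (λ cz → 𝟙 (proj₁ (lookup cz i)) ℚ.* accept (mix P cz))

  freq-coins : ∀ P i → freq P i ≡ E coins (λ C → 𝟙 (lookup C i) ℚ.* E Y∼ (λ Z → accept (mixWith C P Z)))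
  freq-coins P i = trans (E-pairs r _) (E-cong coins λ C → trans
    (E-cong Y∼ λ Z → cong₂ (λ bz Y → 𝟙 (proj₁ bz) ℚ.* accept Y) (Vec.lookup-zip i C Z) (mix-zip C P Z))
    (E-* Y∼ (𝟙 (lookup C i)) _))

  0≤freq : ∀ P i → 0ℚ ℚ.≤ freq P i
  0≤freq P i = E-nonneg (iid r pair) λ cz → *-nonneg (0≤𝟙 (proj₁ (lookup cz i))) (0≤accept (mix P cz))

  freq≤1 : ∀ P i → freq P i ℚ.≤ 1ℚ
  freq≤1 P i = E-≤const (iid r pair) 0≤1 λ cz → ℚ.≤-trans (*-mono (0≤𝟙 (proj₁ (lookup cz i))) 0≤1 (𝟙≤1 (proj₁ (lookup cz i))) (accept≤1 (mix P cz))) (ℚ.≤-reflexive (ℚ.*-identityˡ 1ℚ))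

  proper-trial : ∀ P s → Proper (trial P s)
  proper-trial P s = Proper->>= (proper-iid r proper-pair) λ cz → Proper->>= (proper-decision _) λ o → ret _

  event : Vec (Bool × G r) r → Outcome → Fin r → ℚ
  event cz o i = 𝟙 (proj₁ (lookup cz i)) ℚ.* 𝟙 (accepts o)

  -- For the score and for 2 ^ (- score) alike, the value after a trial is affine in the event that
  -- i is credited, so its mean is affine in `freq P i`.
  E-trial : ∀ P s i (V : ℕ → ℚ) c d →
    (∀ cz o → V (lookup (if accepts o then addCoins cz s else s) i) ≡ c ℚ.+ d ℚ.* event cz o i) →
    E (trial P s) (λ t → V (lookup t i)) ≡ c ℚ.+ d ℚ.* freq P i
  E-trial P s i V c d eq = begin
    E (trial P s) (λ t → V (lookup t i))
      ≡⟨ trans (E->>= (iid r pair) _ _) (E-cong (iid r pair) λ cz → trans (E->>= (decision (mix P cz)) _ _) (E-cong (decision (mix P cz)) (eq cz))) ⟩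
    E (iid r pair) (λ cz → E (decision (mix P cz)) (λ o → c ℚ.+ d ℚ.* event cz o i))
      ≡⟨ E-cong (iid r pair) (λ cz → trans (E-+ (decision (mix P cz)) _ _) (cong₂ ℚ._+_ (E-const (proper-decision (mix P cz)) c)
           (trans (E-* (decision (mix P cz)) d _) (cong (d ℚ.*_) (E-* (decision (mix P cz)) (𝟙 (proj₁ (lookup cz i))) _))))) ⟩
    E (iid r pair) (λ cz → c ℚ.+ d ℚ.* (𝟙 (proj₁ (lookup cz i)) ℚ.* accept (mix P cz)))
      ≡⟨ trans (E-+ (iid r pair) _ _) (cong₂ ℚ._+_ (E-const (proper-iid r proper-pair) c) (E-* (iid r pair) d _)) ⟩
    c ℚ.+ d ℚ.* freq P i
      ∎
    where open ≡-Reasoning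

  lookup-addCoins : ∀ cz s (i : Fin r) → lookup (addCoins cz s) i ≡ lookup s i + 𝟚 (proj₁ (lookup cz i))
  lookup-addCoins cz s i = Vec.lookup-zipWith _ i cz s

  trial-sum : ∀ P i s → E (trial P s) (λ t → ι (lookup t i)) ℚ.≤ ι (lookup s i) ℚ.+ freq P i
  trial-sum P i s = ℚ.≤-reflexive (trans (E-trial P s i ι (ι (lookup s i)) 1ℚ eq)
    (cong (ι (lookup s i) ℚ.+_) (ℚ.*-identityˡ (freq P i))))
    where
    open +-*-Solver
    lem₀ : ∀ x b → x ≡ x ℚ.+ 1ℚ ℚ.* (b ℚ.* 0ℚ)
    lem₀ = solve 2 (λ x b → x := x :+ con 1ℚ :* (b :* con 0ℚ)) refl
    lem₁ : ∀ x b → x ℚ.+ b ≡ x ℚ.+ 1ℚ ℚ.* (b ℚ.* 1ℚ)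
    lem₁ = solve 2 (λ x b → x :+ b := x :+ con 1ℚ :* (b :* con 1ℚ)) refl
    ι-𝟚 : ∀ b → ι (𝟚 b) ≡ 𝟙 b
    ι-𝟚 true  = refl
    ι-𝟚 false = refl
    eq : ∀ cz o → ι (lookup (if accepts o then addCoins cz s else s) i) ≡ ι (lookup s i) ℚ.+ 1ℚ ℚ.* event cz o i
    eq cz o with accepts o
    ... | false = lem₀ (ι (lookup s i)) (𝟙 (proj₁ (lookup cz i)))
    ... | true  = trans (cong ι (lookup-addCoins cz s i)) (trans (ι-+ (lookup s i) _) (trans (cong (ι (lookup s i) ℚ.+_) (ι-𝟚 (proj₁ (lookup cz i))))
      (lem₁ (ι (lookup s i)) (𝟙 (proj₁ (lookup cz i))))))

  -- A credit halves 2 ^ (- score), so the mean shrinks by half the probability of a credit.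
  trial-pow : ∀ P i s → E (trial P s) (λ t → pow ½ (lookup t i)) ℚ.≤ (1ℚ ℚ.- ½ ℚ.* freq P i) ℚ.* pow ½ (lookup s i)
  trial-pow P i s = ℚ.≤-reflexive (trans (E-trial P s i (pow ½) v (ℚ.- (½ ℚ.* v)) eq) (lem v (freq P i)))
    where
    v = pow ½ (lookup s i)
    open +-*-Solver
    lem : ∀ v f → v ℚ.+ ℚ.- (½ ℚ.* v) ℚ.* f ≡ (1ℚ ℚ.- ½ ℚ.* f) ℚ.* v
    lem = solve 2 (λ v f → v :+ :- (con ½ :* v) :* f := (con 1ℚ :- con ½ :* f) :* v) refl
    lem₀ : ∀ v b → v ≡ v ℚ.+ ℚ.- (½ ℚ.* v) ℚ.* (b ℚ.* 0ℚ)
    lem₀ = solve 2 (λ v b → v := v :+ :- (con ½ :* v) :* (b :* con 0ℚ)) refl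
    lem₁ : ∀ v → ½ ℚ.* v ≡ v ℚ.+ ℚ.- (½ ℚ.* v) ℚ.* (1ℚ ℚ.* 1ℚ)
    lem₁ = solve 1 (λ v → con ½ :* v := v :+ :- (con ½ :* v) :* (con 1ℚ :* con 1ℚ)) refl
    lem₂ : ∀ v → v ≡ v ℚ.+ ℚ.- (½ ℚ.* v) ℚ.* (0ℚ ℚ.* 1ℚ)
    lem₂ = solve 1 (λ v → v := v :+ :- (con ½ :* v) :* (con 0ℚ :* con 1ℚ)) refl
    eq : ∀ cz o → pow ½ (lookup (if accepts o then addCoins cz s else s) i) ≡ v ℚ.+ ℚ.- (½ ℚ.* v) ℚ.* event cz o i
    eq cz o with accepts o
    ... | false = lem₀ v (𝟙 (proj₁ (lookup cz i)))
    ... | true with proj₁ (lookup cz i) in b≡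
    ...   | true  = trans (cong (pow ½) (trans (lookup-addCoins cz s i) (trans (cong (λ b → lookup s i + 𝟚 b) b≡) (ℕ.+-comm (lookup s i) 1)))) (lem₁ v)
    ...   | false = trans (cong (pow ½) (trans (lookup-addCoins cz s i) (trans (cong (λ b → lookup s i + 𝟚 b) b≡) (ℕ.+-identityʳ (lookup s i))))) (lem₂ v)

  proper-round : ∀ P s → Proper (iter D (trial P) s)
  proper-round P = proper-iter (proper-trial P) D

  proper-scores : ∀ P → Proper (scores P)
  proper-scores P = proper-iter (proper-round P) H _

  -- Markov's inequality: the mean total score is at most H * D * freq and the threshold is H, so
  -- that the number of rounds cancels.
  high : ∀ P i → E (scores P) (λ s → 𝟙 (H ≤ᵇ lookup s i)) ℚ.≤ ι D ℚ.* freq P i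
  high P i = begin
    E (scores P) (λ s → 𝟙 (H ≤ᵇ lookup s i))
      ≤⟨ E-mono (scores P) markov ⟩
    E (scores P) (λ s → h⁻¹ ℚ.* ι (lookup s i))
      ≡⟨ E-* (scores P) h⁻¹ _ ⟩
    h⁻¹ ℚ.* E (scores P) (λ s → ι (lookup s i))
      ≤⟨ *-monoˡ (0≤1/ ⌊log₂ r ⌋) (E-iter-+ {f = iter D (trial P)} (proper-round P) (E-iter-+ {f = trial P} (proper-trial P) (trial-sum P i) D) H (replicate r 0)) ⟩
    h⁻¹ ℚ.* (ι (lookup (replicate r 0) i) ℚ.+ ι H ℚ.* (ι D ℚ.* freq P i))
      ≡⟨ cong (λ x → h⁻¹ ℚ.* (ι x ℚ.+ ι H ℚ.* (ι D ℚ.* freq P i))) (Vec.lookup-replicate i 0) ⟩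
    h⁻¹ ℚ.* (0ℚ ℚ.+ ι H ℚ.* (ι D ℚ.* freq P i))
      ≡⟨ trans (cong (h⁻¹ ℚ.*_) (ℚ.+-identityˡ _)) (sym (ℚ.*-assoc h⁻¹ (ι H) _)) ⟩
    h⁻¹ ℚ.* ι H ℚ.* (ι D ℚ.* freq P i)
      ≡⟨ trans (cong (ℚ._* (ι D ℚ.* freq P i)) (n/n≡1 ⌊log₂ r ⌋)) (ℚ.*-identityˡ _) ⟩
    ι D ℚ.* freq P i
      ∎
    where
    open ℚ.≤-Reasoning
    h⁻¹ = + 1 ℚ./ suc ⌊log₂ r ⌋
    markov : ∀ s → 𝟙 (H ≤ᵇ lookup s i) ℚ.≤ h⁻¹ ℚ.* ι (lookup s i)
    markov s with H ≤ᵇ lookup s i in eq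
    ... | false = *-nonneg (0≤1/ ⌊log₂ r ⌋) (0≤ι (lookup s i))
    ... | true  = ℚ.≤-trans (ℚ.≤-reflexive (sym (n/n≡1 ⌊log₂ r ⌋))) (*-monoˡ (0≤1/ ⌊log₂ r ⌋) (ι-mono (ℕ.≤ᵇ⇒≤ H (lookup s i) (subst Bool.T (sym eq) tt))))

  -- The trials are independent given the input, so that the expectation of
  -- 2 ^ (- score) is multiplicative.
  low : ∀ P i {ρ} → 1ℚ ℚ.- ½ ℚ.* freq P i ℚ.≤ ρ → pow ρ D ℚ.≤ pow ½ 3 →
    E (scores P) (λ s → 𝟙 (lookup s i <ᵇ H)) ℚ.≤ pow (pow ½ 2) H
  low P i {ρ} f≤ρ ρ^D≤ = begin
    E (scores P) (λ s → 𝟙 (lookup s i <ᵇ H))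
      ≤⟨ E-mono (scores P) markov ⟩
    E (scores P) (λ s → pow (ι 2) H ℚ.* pow ½ (lookup s i))
      ≡⟨ E-* (scores P) (pow (ι 2) H) _ ⟩
    pow (ι 2) H ℚ.* E (scores P) (λ s → pow ½ (lookup s i))
      ≤⟨ *-monoˡ 0≤2^H (E-iter-* {f = iter D (trial P)} (pow-nonneg D 0≤ρ) (E-iter-* {f = trial P} 0≤ρ step D) H (replicate r 0)) ⟩
    pow (ι 2) H ℚ.* (pow (pow ρ D) H ℚ.* pow ½ (lookup (replicate r 0) i))
      ≡⟨ cong (λ x → pow (ι 2) H ℚ.* (pow (pow ρ D) H ℚ.* pow ½ x)) (Vec.lookup-replicate i 0) ⟩
    pow (ι 2) H ℚ.* (pow (pow ρ D) H ℚ.* 1ℚ)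
      ≡⟨ cong (pow (ι 2) H ℚ.*_) (ℚ.*-identityʳ _) ⟩
    pow (ι 2) H ℚ.* pow (pow ρ D) H
      -- Markov's inequality costs a factor 2 per round, and the union over at most 2 ^ H elements
      -- will cost another. A contraction by 1/8 per round pays for both and leaves 1/2.
      ≤⟨ *-monoˡ 0≤2^H (pow-mono H (pow-nonneg D 0≤ρ) ρ^D≤) ⟩
    pow (ι 2) H ℚ.* pow (pow ½ 3) H
      ≡⟨ pow-* (ι 2) (pow ½ 3) H ⟨
    pow (pow ½ 2) H
      ∎
    where
    open ℚ.≤-Reasoning
    0≤2^H : 0ℚ ℚ.≤ pow (ι 2) H
    0≤2^H = pow-nonneg H (0≤ι 2)
    0≤1-½f : 0ℚ ℚ.≤ 1ℚ ℚ.- ½ ℚ.* freq P i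
    0≤1-½f = 0≤p-q (ℚ.≤-trans (*-mono 0≤½ 0≤1 ½≤1 (freq≤1 P i)) (ℚ.≤-reflexive (ℚ.*-identityˡ 1ℚ)))
    0≤ρ = ℚ.≤-trans 0≤1-½f f≤ρ
    step : ∀ s → E (trial P s) (λ t → pow ½ (lookup t i)) ℚ.≤ ρ ℚ.* pow ½ (lookup s i)
    step s = ℚ.≤-trans (trial-pow P i s) (*-monoʳ (pow-nonneg (lookup s i) 0≤½) f≤ρ)
    markov : ∀ s → 𝟙 (lookup s i <ᵇ H) ℚ.≤ pow (ι 2) H ℚ.* pow ½ (lookup s i)
    markov s with lookup s i <ᵇ H in eq
    ... | false = *-nonneg 0≤2^H (pow-nonneg (lookup s i) 0≤½)
    ... | true  = ℚ.≤-trans (ℚ.≤-reflexive (sym (pow-2-½ H)))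
      (*-monoˡ 0≤2^H (pow-½-antitone (ℕ.<⇒≤ (ℕ.<ᵇ⇒< (lookup s i) H (subst Bool.T (sym eq) tt)))))

  hits? : ∀ C S → Dec (Hits k C S)
  hits? C S = Fin.any? λ j → (lookup S j Bool.≟ true) ×-dec (lookup C j Bool.≟ true)

  spared : Vec Bool r → Subset r → ℚ
  spared C S = 𝟙 (not (does (hits? C S)))

  -- The probability that a trial on P spares S and is rejected nevertheless: the part of the
  -- decision error that deprives unplanted elements of their credit.
  missed : Vec (G r) r → Subset r → ℚ
  missed P S = E coins (λ C → spared C S ℚ.* E Y∼ (λ Z → 1ℚ ℚ.- accept (mixWith C P Z)))

  0≤1-accept : ∀ Y → 0ℚ ℚ.≤ 1ℚ ℚ.- accept Y
  0≤1-accept Y = 0≤p-q (accept≤1 Y)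

  0≤missed : ∀ P S → 0ℚ ℚ.≤ missed P S
  0≤missed P S = E-nonneg coins λ C → *-nonneg (0≤𝟙 (not (does (hits? C S)))) (E-nonneg Y∼ λ Z → 0≤1-accept (mixWith C P Z))

  proper-Y : Proper Y∼
  proper-Y = proper-iid r proper-uniform

  -- The coins spare S and resample i with probability at least 2 ^ (- (k + 1)). The algorithm then
  -- either accepts, which credits i, or rejects, which counts towards `missed`.
  freq-unplanted : ∀ P S i → ∣ S ∣ ≡ k → lookup S i ≡ false → pow ½ (suc k) ℚ.≤ freq P i ℚ.+ missed P S
  freq-unplanted P S i ∣S∣≡k i∉S = begin
    pow ½ (suc k)
      ≤⟨ pow-½-antitone (ℕ.≤-trans (#-update (Vec.map spare S) i true) (s≤s (ℕ.≤-reflexive (trans (#-spare S) ∣S∣≡k)))) ⟩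
    pow ½ (# K)
      ≡⟨ E-meets K ⟨
    E coins (𝟙 ∘ meets K)
      ≤⟨ E-mono coins pointwise ⟩
    E coins (λ C → 𝟙 (lookup C i) ℚ.* α C ℚ.+ spared C S ℚ.* E Y∼ (λ Z → 1ℚ ℚ.- accept (mixWith C P Z)))
      ≡⟨ E-+ coins _ _ ⟩
    E coins (λ C → 𝟙 (lookup C i) ℚ.* α C) ℚ.+ missed P S
      ≡⟨ cong (ℚ._+ missed P S) (freq-coins P i) ⟨
    freq P i ℚ.+ missed P S
      ∎
    where
    open ℚ.≤-Reasoning
    K = sparing S i
    α : Vec Bool r → ℚ
    α C = E Y∼ (λ Z → accept (mixWith C P Z))
    complement : ∀ C → α C ℚ.+ E Y∼ (λ Z → 1ℚ ℚ.- accept (mixWith C P Z)) ≡ 1ℚ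
    complement C = trans (sym (E-+ Y∼ _ _)) (trans (E-cong Y∼ (λ Z → lem (accept (mixWith C P Z)))) (E-const proper-Y 1ℚ))
      where
      open +-*-Solver
      lem : ∀ x → x ℚ.+ (1ℚ ℚ.- x) ≡ 1ℚ
      lem = solve 1 (λ x → x :+ (con 1ℚ :- x) := con 1ℚ) refl
    pointwise : ∀ C → 𝟙 (meets K C) ℚ.≤ 𝟙 (lookup C i) ℚ.* α C ℚ.+ spared C S ℚ.* E Y∼ (λ Z → 1ℚ ℚ.- accept (mixWith C P Z))
    pointwise C with meets K C in m
    ... | false = +-nonneg (*-nonneg (0≤𝟙 (lookup C i)) (E-nonneg Y∼ λ Z → 0≤accept (mixWith C P Z)))
      (*-nonneg (0≤𝟙 (not (does (hits? C S)))) (E-nonneg Y∼ λ Z → 0≤1-accept (mixWith C P Z)))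
    ... | true = ℚ.≤-reflexive (sym (trans (cong₂ ℚ._+_
        (trans (cong (λ b → 𝟙 b ℚ.* α C) (meets-lookup K C m (Vec.lookup∘updateAt i (Vec.map spare S)))) (ℚ.*-identityˡ (α C)))
        (trans (cong (λ b → 𝟙 (not b) ℚ.* E Y∼ (λ Z → 1ℚ ℚ.- accept (mixWith C P Z))) (dec-false (hits? C S) miss)) (ℚ.*-identityˡ _)))
      (complement C)))
      where
      miss : ¬ Hits k C S
      miss (j , j∈S , Cj) with j Fin.≟ i
      ... | yes refl with trans (sym i∉S) j∈S
      ...   | ()
      miss (j , j∈S , Cj) | no j≢i with trans (sym Cj) (meets-lookup K C {j} {false} m
        (trans (Vec.lookup∘update′ j≢i (Vec.map spare S) (just true)) (trans (Vec.lookup-map j spare S) (cong spare j∈S))))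
      ...   | ()

  Correct : Subset r → Vec ℕ r → Set
  Correct S s = ∀ i → (lookup s i <ᵇ H) ≡ lookup S i

  correct? : ∀ S s → Dec (Correct S s)
  correct? S s = Fin.all? λ i → (lookup s i <ᵇ H) Bool.≟ lookup S i

  correct : Subset r → Vec ℕ r → ℚ
  correct S s = 𝟙 (does (correct? S s))

  wrong : Subset r → Vec ℕ r → Fin r → ℚ
  wrong S s i = 𝟙 (if lookup S i then H ≤ᵇ lookup s i else lookup s i <ᵇ H)

  0≤wrong : ∀ S s i → 0ℚ ℚ.≤ wrong S s i
  0≤wrong S s i = 0≤𝟙 (if lookup S i then H ≤ᵇ lookup s i else lookup s i <ᵇ H)

  union-bound : ∀ S s → 1ℚ ℚ.≤ correct S s ℚ.+ sum (wrong S s)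
  union-bound S s = go (correct? S s)
    where
    1≡wrong : ∀ i → (lookup s i <ᵇ H) ≢ lookup S i → wrong S s i ≡ 1ℚ
    1≡wrong i ≢ with lookup S i | lookup s i <ᵇ H in eq
    ... | true  | true  = ⊥-elim (≢ refl)
    ... | false | false = ⊥-elim (≢ refl)
    ... | false | true  = refl
    ... | true  | false = cong 𝟙 (Bool.T-≡ .Equivalence.to (ℕ.≤⇒≤ᵇ {H} {lookup s i} (ℕ.≮⇒≥ λ lt → subst Bool.T eq (ℕ.<⇒<ᵇ lt))))
    go : (d : Dec (Correct S s)) → 1ℚ ℚ.≤ 𝟙 (does d) ℚ.+ sum (wrong S s)
    go (yes c) = ℚ.≤-trans (ℚ.≤-reflexive (sym (ℚ.+-identityʳ 1ℚ))) (ℚ.+-monoʳ-≤ 1ℚ (sum-nonneg {f = wrong S s} (0≤wrong S s)))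
    go (no ¬c) = let i , i-wrong = Fin.¬∀⟶∃¬ r _ (λ i → (lookup s i <ᵇ H) Bool.≟ lookup S i) ¬c in
      ℚ.≤-trans (ℚ.≤-reflexive (sym (1≡wrong i i-wrong))) (ℚ.≤-trans (term≤sum (wrong S s) i (0≤wrong S s)) (ℚ.≤-reflexive (sym (ℚ.+-identityˡ (sum (wrong S s))))))

  r≤2^H : ι r ℚ.≤ pow (ι 2) H
  r≤2^H = ℚ.≤-trans (ι-mono (ℕ.<⇒≤ (n<2^bits r))) (ℚ.≤-reflexive (ι-^ H))

  -- Half of 2 ^ (- (k + 1)): as long as `missed` is at most c, every unplanted element keeps a
  -- frequency of at least c. The inverse is the price of Markov's inequality for the inputs where
  -- `missed` is larger.
  c : ℚ
  c = pow ½ (suc (suc k))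

  c⁻¹ : ℚ
  c⁻¹ = pow (ι 2) (suc (suc k))

  module _ (amplified : pow (1ℚ ℚ.- ½ ℚ.* c) D ℚ.≤ pow ½ 3) where

    -- If `missed` is at least c, the last error term alone is at least 1. Otherwise every unplanted
    -- element is credited often, and the union bound applies. Both cases share one linear bound, so
    -- that it can be averaged over the inputs.
    success : ∀ P S → ∣ S ∣ ≡ k →
      1ℚ ℚ.≤ E (scores P) (correct S) ℚ.+ (sum (λ i → 𝟙 (lookup S i) ℚ.* (ι D ℚ.* freq P i)) ℚ.+ pow ½ H ℚ.+ c⁻¹ ℚ.* missed P S)
    success P S ∣S∣≡k with ℚ.≤-total c (missed P S)
    ... | inj₁ c≤missed = begin
      1ℚ
        ≡⟨ pow-2-½ (suc (suc k)) ⟨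
      c⁻¹ ℚ.* c
        ≤⟨ *-monoˡ (pow-nonneg (suc (suc k)) (0≤ι 2)) c≤missed ⟩
      c⁻¹ ℚ.* missed P S
        ≡⟨ ℚ.+-identityˡ _ ⟨
      0ℚ ℚ.+ c⁻¹ ℚ.* missed P S
        ≤⟨ ℚ.+-monoˡ-≤ (c⁻¹ ℚ.* missed P S) (+-nonneg (E-nonneg (scores P) (λ s → 0≤𝟙 (does (correct? S s)))) (+-nonneg (sum-nonneg λ i → *-nonneg (0≤𝟙 (lookup S i)) (*-nonneg (0≤ι D) (0≤freq P i))) (pow-nonneg H 0≤½))) ⟩
      E (scores P) (correct S) ℚ.+ (σ ℚ.+ pow ½ H) ℚ.+ c⁻¹ ℚ.* missed P S
        ≡⟨ ℚ.+-assoc (E (scores P) (correct S)) (σ ℚ.+ pow ½ H) _ ⟩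
      E (scores P) (correct S) ℚ.+ (σ ℚ.+ pow ½ H ℚ.+ c⁻¹ ℚ.* missed P S)
        ∎
      where
      open ℚ.≤-Reasoning
      σ = sum (λ i → 𝟙 (lookup S i) ℚ.* (ι D ℚ.* freq P i))
    ... | inj₂ missed≤c = begin
      1ℚ
        ≡⟨ E-const (proper-scores P) 1ℚ ⟨
      E (scores P) (λ _ → 1ℚ)
        ≤⟨ E-mono (scores P) (union-bound S) ⟩
      E (scores P) (λ s → correct S s ℚ.+ sum (wrong S s))
        ≡⟨ trans (E-+ (scores P) (correct S) _) (cong (E (scores P) (correct S) ℚ.+_) (E-sum (scores P) (λ i s → wrong S s i))) ⟩
      E (scores P) (correct S) ℚ.+ sum (λ i → E (scores P) (λ s → wrong S s i))
        ≤⟨ ℚ.+-monoʳ-≤ (E (scores P) (correct S)) (sum-mono each) ⟩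
      E (scores P) (correct S) ℚ.+ sum (λ i → 𝟙 (lookup S i) ℚ.* (ι D ℚ.* freq P i) ℚ.+ pow (pow ½ 2) H)
        ≡⟨ cong (E (scores P) (correct S) ℚ.+_) (trans (∑.∑-distrib-+ (λ i → 𝟙 (lookup S i) ℚ.* (ι D ℚ.* freq P i)) _) (cong (σ ℚ.+_) (sum-const r _))) ⟩
      E (scores P) (correct S) ℚ.+ (σ ℚ.+ ι r ℚ.* pow (pow ½ 2) H)
        ≤⟨ ℚ.+-monoʳ-≤ (E (scores P) (correct S)) (ℚ.+-monoʳ-≤ σ (ℚ.≤-trans (*-monoʳ (pow-nonneg H (pow-nonneg 2 0≤½)) r≤2^H)
             (ℚ.≤-reflexive (sym (pow-* (ι 2) (pow ½ 2) H))))) ⟩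
      E (scores P) (correct S) ℚ.+ (σ ℚ.+ pow ½ H)
        ≡⟨ cong (E (scores P) (correct S) ℚ.+_) (ℚ.+-identityʳ (σ ℚ.+ pow ½ H)) ⟨
      E (scores P) (correct S) ℚ.+ (σ ℚ.+ pow ½ H ℚ.+ 0ℚ)
        ≤⟨ ℚ.+-monoʳ-≤ (E (scores P) (correct S)) (ℚ.+-monoʳ-≤ (σ ℚ.+ pow ½ H) (*-nonneg (pow-nonneg (suc (suc k)) (0≤ι 2)) (0≤missed P S))) ⟩
      E (scores P) (correct S) ℚ.+ (σ ℚ.+ pow ½ H ℚ.+ c⁻¹ ℚ.* missed P S)
        ∎
      where
      open ℚ.≤-Reasoning
      σ = sum (λ i → 𝟙 (lookup S i) ℚ.* (ι D ℚ.* freq P i))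
      c≤freq : ∀ i → lookup S i ≡ false → c ℚ.≤ freq P i
      c≤freq i i∉S = +-cancelˡ-≤ (missed P S) (begin
        missed P S ℚ.+ c     ≤⟨ ℚ.+-monoˡ-≤ c missed≤c ⟩
        c ℚ.+ c              ≡⟨ twice (pow ½ (suc k)) ⟩
        pow ½ (suc k)        ≤⟨ freq-unplanted P S i ∣S∣≡k i∉S ⟩
        freq P i ℚ.+ missed P S  ≡⟨ ℚ.+-comm (freq P i) (missed P S) ⟩
        missed P S ℚ.+ freq P i  ∎)
        where
        open +-*-Solver
        twice : ∀ x → ½ ℚ.* x ℚ.+ ½ ℚ.* x ≡ x
        twice = solve 1 (λ x → con ½ :* x :+ con ½ :* x := x) refl
      each : ∀ i → E (scores P) (λ s → wrong S s i) ℚ.≤ 𝟙 (lookup S i) ℚ.* (ι D ℚ.* freq P i) ℚ.+ pow (pow ½ 2) H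
      each i with lookup S i in i∈S
      ... | true = begin
        E (scores P) (λ s → 𝟙 (H ≤ᵇ lookup s i))          ≤⟨ high P i ⟩
        ι D ℚ.* freq P i                                  ≡⟨ trans (sym (ℚ.*-identityˡ _)) (sym (ℚ.+-identityʳ _)) ⟩
        1ℚ ℚ.* (ι D ℚ.* freq P i) ℚ.+ 0ℚ                  ≤⟨ ℚ.+-monoʳ-≤ (1ℚ ℚ.* (ι D ℚ.* freq P i)) (pow-nonneg H (pow-nonneg 2 0≤½)) ⟩
        1ℚ ℚ.* (ι D ℚ.* freq P i) ℚ.+ pow (pow ½ 2) H     ∎
      ... | false = begin
        E (scores P) (λ s → 𝟙 (lookup s i <ᵇ H))          ≤⟨ low P i (p-q-antitone 1ℚ (*-monoˡ 0≤½ (c≤freq i i∈S))) amplified ⟩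
        pow (pow ½ 2) H                                   ≡⟨ trans (sym (ℚ.+-identityˡ _)) (cong (ℚ._+ pow (pow ½ 2) H) (sym (ℚ.*-zeroˡ (ι D ℚ.* freq P i)))) ⟩
        0ℚ ℚ.* (ι D ℚ.* freq P i) ℚ.+ pow (pow ½ 2) H     ∎

    module _ {η} (error₀ : E Y∼ accept ℚ.≤ η) (error₁ : E Y∼ (λ X → E 𝕊 (λ S → 1ℚ ℚ.- accept (plant S X))) ℚ.≤ η) where

      0≤η : 0ℚ ℚ.≤ η
      0≤η = ℚ.≤-trans (E-nonneg Y∼ 0≤accept) error₀

      -- Each coin pattern that resamples an element of S makes the new input uniform, and there
      -- acceptance is an error. The bound holds for each S separately.
      E-freq : ∀ S i → lookup S i ≡ true → E Y∼ (λ X → freq (plant S X) i) ℚ.≤ η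
      E-freq S i i∈S = begin
        E Y∼ (λ X → freq (plant S X) i)
          ≡⟨ E-cong Y∼ (λ X → freq-coins (plant S X) i) ⟩
        E Y∼ (λ X → E coins (λ C → 𝟙 (lookup C i) ℚ.* E Y∼ (λ Z → accept (mixWith C (plant S X) Z))))
          ≡⟨ E-swap Y∼ coins _ ⟩
        E coins (λ C → E Y∼ (λ X → 𝟙 (lookup C i) ℚ.* E Y∼ (λ Z → accept (mixWith C (plant S X) Z))))
          ≡⟨ E-cong coins (λ C → E-* Y∼ (𝟙 (lookup C i)) _) ⟩
        E coins (λ C → 𝟙 (lookup C i) ℚ.* E Y∼ (λ X → E Y∼ (λ Z → accept (mixWith C (plant S X) Z))))
          ≤⟨ E-≤const coins 0≤η pointwise ⟩
        η
          ∎
        where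
        open ℚ.≤-Reasoning
        pointwise : ∀ C → 𝟙 (lookup C i) ℚ.* E Y∼ (λ X → E Y∼ (λ Z → accept (mixWith C (plant S X) Z))) ℚ.≤ η
        pointwise C = 𝟙*≤ (lookup C i) 0≤η λ Ci →
          ℚ.≤-trans (ℚ.≤-reflexive (E-resample-hit k accept-respects C S (i , i∈S , Ci))) error₀

      -- Under a pattern that spares S the new input is distributed like the planted one, so
      -- rejection is as likely as without resampling; the other patterns contribute 0.
      E-missed : ∀ S → E Y∼ (λ X → missed (plant S X) S) ℚ.≤ E Y∼ (λ X → 1ℚ ℚ.- accept (plant S X))
      E-missed S = begin
        E Y∼ (λ X → missed (plant S X) S)
          ≡⟨ E-swap Y∼ coins _ ⟩
        E coins (λ C → E Y∼ (λ X → spared C S ℚ.* E Y∼ (λ Z → 1ℚ ℚ.- accept (mixWith C (plant S X) Z))))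
          ≡⟨ E-cong coins (λ C → E-* Y∼ (spared C S) _) ⟩
        E coins (λ C → spared C S ℚ.* E Y∼ (λ X → E Y∼ (λ Z → 1ℚ ℚ.- accept (mixWith C (plant S X) Z))))
          ≤⟨ E-≤const coins (E-nonneg Y∼ λ X → 0≤1-accept (plant S X)) pointwise ⟩
        E Y∼ (λ X → 1ℚ ℚ.- accept (plant S X))
          ∎
        where
        open ℚ.≤-Reasoning
        pointwise : ∀ C → spared C S ℚ.* E Y∼ (λ X → E Y∼ (λ Z → 1ℚ ℚ.- accept (mixWith C (plant S X) Z))) ℚ.≤ E Y∼ (λ X → 1ℚ ℚ.- accept (plant S X))
        pointwise C = 𝟙*≤ (not (does (hits? C S))) (E-nonneg Y∼ λ X → 0≤1-accept (plant S X)) λ eq → ℚ.≤-reflexive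
          (E-resample-miss k (λ Y Y′ Y≈Y′ → cong (λ x → 1ℚ ℚ.- x) (accept-respects Y Y′ Y≈Y′)) C S
            λ hit → case trans (sym eq) (cong not (dec-true (hits? C S) hit)) of λ ())

      -- The rejection error for this S stays in the bound, because only its average over S is known
      -- to be at most η.
      E-success : ∀ S → ∣ S ∣ ≡ k → 1ℚ ℚ.≤ E Y∼ (λ X → E (scores (plant S X)) (correct S)) ℚ.+
        (ι k ℚ.* (ι D ℚ.* η) ℚ.+ pow ½ H ℚ.+ c⁻¹ ℚ.* E Y∼ (λ X → 1ℚ ℚ.- accept (plant S X)))
      E-success S ∣S∣≡k = begin
        1ℚ
          ≡⟨ E-const proper-Y 1ℚ ⟨
        E Y∼ (λ _ → 1ℚ)
          ≤⟨ E-mono Y∼ (λ X → success (plant S X) S ∣S∣≡k) ⟩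
        E Y∼ (λ X → φ X ℚ.+ (σ X ℚ.+ pow ½ H ℚ.+ c⁻¹ ℚ.* missed (plant S X) S))
          ≡⟨ trans (E-+ Y∼ φ _) (cong (E Y∼ φ ℚ.+_) (trans (E-+ Y∼ _ _) (cong₂ ℚ._+_
               (trans (E-+ Y∼ σ _) (cong (E Y∼ σ ℚ.+_) (E-const proper-Y (pow ½ H)))) (E-* Y∼ c⁻¹ _)))) ⟩
        E Y∼ φ ℚ.+ (E Y∼ σ ℚ.+ pow ½ H ℚ.+ c⁻¹ ℚ.* E Y∼ (λ X → missed (plant S X) S))
          ≤⟨ ℚ.+-monoʳ-≤ (E Y∼ φ) (ℚ.+-mono-≤ (ℚ.+-monoˡ-≤ (pow ½ H) E-σ) (*-monoˡ (pow-nonneg (suc (suc k)) (0≤ι 2)) (E-missed S))) ⟩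
        E Y∼ φ ℚ.+ (ι k ℚ.* (ι D ℚ.* η) ℚ.+ pow ½ H ℚ.+ c⁻¹ ℚ.* E Y∼ (λ X → 1ℚ ℚ.- accept (plant S X)))
          ∎
        where
        open ℚ.≤-Reasoning
        φ σ : Vec (G r) r → ℚ
        φ X = E (scores (plant S X)) (correct S)
        σ X = sum (λ i → 𝟙 (lookup S i) ℚ.* (ι D ℚ.* freq (plant S X) i))
        each : ∀ i → E Y∼ (λ X → 𝟙 (lookup S i) ℚ.* (ι D ℚ.* freq (plant S X) i)) ℚ.≤ 𝟙 (lookup S i) ℚ.* (ι D ℚ.* η)
        each i = ℚ.≤-trans (ℚ.≤-reflexive (trans (E-* Y∼ (𝟙 (lookup S i)) _) (cong (𝟙 (lookup S i) ℚ.*_) (E-* Y∼ (ι D) _)))) bound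
          where
          bound : 𝟙 (lookup S i) ℚ.* (ι D ℚ.* E Y∼ (λ X → freq (plant S X) i)) ℚ.≤ 𝟙 (lookup S i) ℚ.* (ι D ℚ.* η)
          bound with lookup S i in i∈S
          ... | false = ℚ.≤-reflexive (trans (ℚ.*-zeroˡ (ι D ℚ.* E Y∼ (λ X → freq (plant S X) i))) (sym (ℚ.*-zeroˡ (ι D ℚ.* η))))
          ... | true  = *-monoˡ 0≤1 (*-monoˡ (0≤ι D) (E-freq S i i∈S))
        E-σ : E Y∼ σ ℚ.≤ ι k ℚ.* (ι D ℚ.* η)
        E-σ = begin
          E Y∼ σ                                            ≡⟨ E-sum Y∼ (λ i X → 𝟙 (lookup S i) ℚ.* (ι D ℚ.* freq (plant S X) i)) ⟩
          sum (λ i → E Y∼ (λ X → 𝟙 (lookup S i) ℚ.* (ι D ℚ.* freq (plant S X) i)))  ≤⟨ sum-mono each ⟩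
          sum (λ i → 𝟙 (lookup S i) ℚ.* (ι D ℚ.* η))        ≡⟨ ∑.*-distribʳ-sum (ι D ℚ.* η) (λ i → 𝟙 (lookup S i)) ⟨
          sum (λ i → 𝟙 (lookup S i)) ℚ.* (ι D ℚ.* η)        ≡⟨ cong (ℚ._* (ι D ℚ.* η)) (trans (sum-∣∣ S) (cong ι ∣S∣≡k)) ⟩
          ι k ℚ.* (ι D ℚ.* η)                               ∎

      total : k ≤ r → 1ℚ ℚ.≤ E Y∼ (λ X → E 𝕊 (λ S → E (scores (plant S X)) (correct S))) ℚ.+
        (ι k ℚ.* (ι D ℚ.* η) ℚ.+ pow ½ H ℚ.+ c⁻¹ ℚ.* η)
      total k≤r = begin
        1ℚ
          ≡⟨ E-const proper-𝕊 1ℚ ⟨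
        E 𝕊 (λ _ → 1ℚ)
          ≤⟨ mean-mono _ (λ j → E-success (List.lookup (subsetsOfSize k r) j) (size-of-drawn {k} {r} j)) ⟩
        E 𝕊 (λ S → Φ S ℚ.+ (κ ℚ.+ c⁻¹ ℚ.* ε S))
          ≡⟨ trans (E-+ 𝕊 Φ (λ S → κ ℚ.+ c⁻¹ ℚ.* ε S)) (cong (E 𝕊 Φ ℚ.+_) (trans (E-+ 𝕊 (λ _ → κ) (λ S → c⁻¹ ℚ.* ε S)) (cong₂ ℚ._+_ (E-const proper-𝕊 κ) (E-* 𝕊 c⁻¹ ε)))) ⟩
        E 𝕊 Φ ℚ.+ (κ ℚ.+ c⁻¹ ℚ.* E 𝕊 ε)
          ≤⟨ ℚ.+-monoʳ-≤ (E 𝕊 Φ) (ℚ.+-monoʳ-≤ κ (*-monoˡ (pow-nonneg (suc (suc k)) (0≤ι 2))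
               (ℚ.≤-trans (ℚ.≤-reflexive (sym (E-swap Y∼ 𝕊 (λ X S → 1ℚ ℚ.- accept (plant S X))))) error₁))) ⟩
        E 𝕊 Φ ℚ.+ (κ ℚ.+ c⁻¹ ℚ.* η)
          ≡⟨ cong (ℚ._+ (κ ℚ.+ c⁻¹ ℚ.* η)) (E-swap Y∼ 𝕊 (λ X S → E (scores (plant S X)) (correct S))) ⟨
        E Y∼ (λ X → E 𝕊 (λ S → E (scores (plant S X)) (correct S))) ℚ.+ (κ ℚ.+ c⁻¹ ℚ.* η)
          ∎
        where
        open ℚ.≤-Reasoning
        proper-𝕊 : Proper 𝕊
        proper-𝕊 = proper-uniformFrom (proj₂ (proj₂ (subset-of-size k≤r)))
        Φ ε : Subset r → ℚ
        Φ S = E Y∼ (λ X → E (scores (plant S X)) (correct S))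
        ε S = E Y∼ (λ X → 1ℚ ℚ.- accept (plant S X))
        κ = ι k ℚ.* (ι D ℚ.* η) ℚ.+ pow ½ H

-- Choice of constants, and what the density implies

1/≤positive : ∀ ε → 0ℚ ℚ.< ε → ∃[ d ] + 1 ℚ./ suc d ℚ.≤ ε
1/≤positive ε@(ℚ.mkℚ (+ suc p) d _) _ = d , ℚ.toℚᵘ-cancel-≤ (begin
  ℚ.toℚᵘ (+ 1 ℚ./ suc d)    ≃⟨ ℚ.toℚᵘ-fromℚᵘ (ℚᵘ.mkℚᵘ (+ 1) d) ⟩
  ℚᵘ.mkℚᵘ (+ 1) d           ≤⟨ ℚᵘ.*≤* (ℤ.*-monoʳ-≤-nonNeg (+ suc d) (+≤+ {1} {suc p} (s≤s z≤n))) ⟩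
  ℚᵘ.mkℚᵘ (+ suc p) d       ∎)
  where open ℚᵘ.≤-Reasoning
1/≤positive (ℚ.mkℚ (+ 0) d _)      (ℚ.*<* (ℤ.+<+ ()))
1/≤positive (ℚ.mkℚ -[1+ p ] d _)  (ℚ.*<* ())

n≤2^n : ∀ n → n ≤ 2 ^ n
n≤2^n zero    = z≤n
n≤2^n (suc n) = ℕ.+-mono-≤ (ℕ.m^n>0 2 n) (ℕ.≤-trans (n≤2^n n) (ℕ.≤-reflexive (sym (ℕ.+-identityʳ (2 ^ n)))))

-- 2 ^ (- (d + 1)) ≤ 1 / (d + 1) ≤ ε. Powers of 1/2 are convenient witnesses because their inverses
-- are natural numbers.
archimedean : ∀ ε → 0ℚ ℚ.< ε → ∃[ m ] pow ½ m ℚ.≤ ε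
archimedean ε 0<ε with 1/≤positive ε 0<ε
... | d , 1/≤ε = suc d , ℚ.≤-trans (begin
  pow ½ (suc d)                                           ≡⟨ trans (sym (ℚ.*-identityʳ _)) (cong (pow ½ (suc d) ℚ.*_) (sym (n/n≡1 d))) ⟩
  pow ½ (suc d) ℚ.* (1/n ℚ.* ι (suc d))                   ≤⟨ *-monoˡ (pow-nonneg (suc d) 0≤½) (*-monoˡ (0≤1/ d) (ℚ.≤-trans (ι-mono (n≤2^n (suc d))) (ℚ.≤-reflexive (ι-^ (suc d))))) ⟩
  pow ½ (suc d) ℚ.* (1/n ℚ.* pow (ι 2) (suc d))           ≡⟨ lem (pow ½ (suc d)) 1/n (pow (ι 2) (suc d)) ⟩
  1/n ℚ.* (pow (ι 2) (suc d) ℚ.* pow ½ (suc d))           ≡⟨ trans (cong (1/n ℚ.*_) (pow-2-½ (suc d))) (ℚ.*-identityʳ 1/n) ⟩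
  1/n                                                     ∎) 1/≤ε
  where
  open ℚ.≤-Reasoning
  1/n = + 1 ℚ./ suc d
  open +-*-Solver
  lem : ∀ a b c → a ℚ.* (b ℚ.* c) ≡ b ℚ.* (c ℚ.* a)
  lem = solve 3 (λ a b c → a :* (b :* c) := b :* (c :* a)) refl

-- Multiplied out to avoid a quotient. The induction rests on (1 - x)(1 + (n + 1) x) = 1 + n x - (n
-- + 1) x ^ 2.
bernoulli : ∀ {x} → 0ℚ ℚ.≤ x → x ℚ.≤ 1ℚ → ∀ n → pow (1ℚ ℚ.- x) n ℚ.* (1ℚ ℚ.+ ι n ℚ.* x) ℚ.≤ 1ℚ
bernoulli {x} 0≤x x≤1 zero = ℚ.≤-reflexive (trans (ℚ.*-identityˡ _) (trans (cong (1ℚ ℚ.+_) (ℚ.*-zeroˡ x)) (ℚ.+-identityʳ 1ℚ)))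
bernoulli {x} 0≤x x≤1 (suc n) = begin
  (1ℚ ℚ.- x) ℚ.* p ℚ.* (1ℚ ℚ.+ ι (suc n) ℚ.* x)
    ≡⟨ trans (cong (λ m → (1ℚ ℚ.- x) ℚ.* p ℚ.* (1ℚ ℚ.+ m ℚ.* x)) (ι-+ 1 n)) (lem₁ x p (ι n)) ⟩
  p ℚ.* (1ℚ ℚ.+ ι n ℚ.* x ℚ.- (ι n ℚ.* x ℚ.* x ℚ.+ x ℚ.* x))
    ≤⟨ *-monoˡ (pow-nonneg n (0≤p-q x≤1)) (ℚ.≤-trans (p-q-antitone (1ℚ ℚ.+ ι n ℚ.* x)
         (+-nonneg (*-nonneg (*-nonneg (0≤ι n) 0≤x) 0≤x) (*-nonneg 0≤x 0≤x))) (ℚ.≤-reflexive (ℚ.+-identityʳ _))) ⟩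
  p ℚ.* (1ℚ ℚ.+ ι n ℚ.* x)
    ≤⟨ bernoulli 0≤x x≤1 n ⟩
  1ℚ
    ∎
  where
  open ℚ.≤-Reasoning
  p = pow (1ℚ ℚ.- x) n
  open +-*-Solver
  lem₁ : ∀ x p n → (1ℚ ℚ.- x) ℚ.* p ℚ.* (1ℚ ℚ.+ (1ℚ ℚ.+ n) ℚ.* x) ≡ p ℚ.* (1ℚ ℚ.+ n ℚ.* x ℚ.- (n ℚ.* x ℚ.* x ℚ.+ x ℚ.* x))
  lem₁ = solve 3 (λ x p n → (con 1ℚ :- x) :* p :* (con 1ℚ :+ (con 1ℚ :+ n) :* x) := p :* (con 1ℚ :+ n :* x :- (n :* x :* x :+ x :* x))) refl

-- With D * x = 7 the factor 1 + D * x in Bernoulli's inequality is 8; hence the 7 in the number of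
-- trials.
pow-≤⅛ : ∀ {x} D → 0ℚ ℚ.≤ x → x ℚ.≤ 1ℚ → ι D ℚ.* x ≡ ι 7 → pow (1ℚ ℚ.- x) D ℚ.≤ pow ½ 3
pow-≤⅛ {x} D 0≤x x≤1 Dx≡7 = begin
  p                                         ≡⟨ ℚ.*-identityʳ p ⟨
  p ℚ.* (ι 8 ℚ.* pow ½ 3)                   ≡⟨ ℚ.*-assoc p (ι 8) (pow ½ 3) ⟨
  p ℚ.* ι 8 ℚ.* pow ½ 3                     ≡⟨ cong (λ y → p ℚ.* (1ℚ ℚ.+ y) ℚ.* pow ½ 3) (sym Dx≡7) ⟩
  p ℚ.* (1ℚ ℚ.+ ι D ℚ.* x) ℚ.* pow ½ 3      ≤⟨ *-monoʳ (pow-nonneg 3 0≤½) (bernoulli 0≤x x≤1 D) ⟩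
  1ℚ ℚ.* pow ½ 3                            ≡⟨ ℚ.*-identityˡ (pow ½ 3) ⟩
  pow ½ 3                                   ∎
  where
  open ℚ.≤-Reasoning
  p = pow (1ℚ ℚ.- x) D

amplification : ∀ n → ∃[ D ] pow (1ℚ ℚ.- pow ½ n) D ℚ.≤ pow ½ 3
amplification n = 7 * 2 ^ n , pow-≤⅛ (7 * 2 ^ n) (pow-nonneg n 0≤½) (pow-½-antitone {0} {n} z≤n)
  (trans (cong (ℚ._* pow ½ n) (trans (ι-* 7 (2 ^ n)) (cong (ι 7 ℚ.*_) (ι-^ n))))
    (trans (ℚ.*-assoc (ι 7) (pow (ι 2) n) (pow ½ n)) (cong (ι 7 ℚ.*_) (pow-2-½ n))))

p≤∣p∣ : ∀ p → p ℚ.≤ ℚ.∣ p ∣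
p≤∣p∣ p with ℚ.∣p∣≡p∨∣p∣≡-p p
... | inj₁ eq = ℚ.≤-reflexive (sym eq)
... | inj₂ eq = ℚ.≤-trans (ℚ.≤-reflexive (lem p)) (ℚ.≤-trans (ℚ.neg-antimono-≤ (ℚ.≤-trans (ℚ.0≤∣p∣ p) (ℚ.≤-reflexive eq))) (ℚ.0≤∣p∣ p))
  where
  open +-*-Solver
  lem : ∀ p → p ≡ ℚ.- (ℚ.- p)
  lem = solve 1 (λ p → p := :- (:- p)) refl

∣-∣-lower : ∀ {p q e} → ℚ.∣ p ℚ.- q ∣ ℚ.≤ e → q ℚ.≤ p ℚ.+ e
∣-∣-lower {p} {q} {e} ≤e = ℚ.≤-trans (ℚ.≤-reflexive (lem p q)) (ℚ.+-monoʳ-≤ p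
  (ℚ.≤-trans (p≤∣p∣ (ℚ.- (p ℚ.- q))) (ℚ.≤-trans (ℚ.≤-reflexive (ℚ.∣-p∣≡∣p∣ (p ℚ.- q))) ≤e)))
  where
  open +-*-Solver
  lem : ∀ p q → q ≡ p ℚ.+ ℚ.- (p ℚ.- q)
  lem = solve 2 (λ p q → q := p :+ :- (p :- q)) refl

½*-positive : ∀ {p} → 0ℚ ℚ.< p → 0ℚ ℚ.< ½ ℚ.* p
½*-positive {p} 0<p = ℚ.positive⁻¹ _ ⦃ ℚ.pos*pos⇒pos ½ p ⦃ ℚ.positive 0<p ⦄ ⦄

pow½-positive : ∀ n → 0ℚ ℚ.< pow ½ n
pow½-positive zero    = ℚ.positive⁻¹ 1ℚ
pow½-positive (suc n) = ½*-positive (pow½-positive n)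

½+½ : ∀ p → ½ ℚ.* p ℚ.+ ½ ℚ.* p ≡ p
½+½ = solve 1 (λ p → con ½ :* p :+ con ½ :* p := p) refl
  where open +-*-Solver

÷₀-*-cancel : ∀ p q → q ≢ 0ℚ → (p ÷₀ q) ℚ.* q ≡ p
÷₀-*-cancel p q q≢0 with q ℚ.≟ 0ℚ
... | yes q≡0 = ⊥-elim (q≢0 q≡0)
... | no q≢0′ = trans (ℚ.*-assoc p _ q) (trans (cong (p ℚ.*_) (ℚ.*-inverseˡ q ⦃ ℚ.≢-nonZero q≢0′ ⦄)) (ℚ.*-identityʳ p))

δ≤÷₀⇒δ*≤ : ∀ {δ p q} → 0ℚ ℚ.< δ → 0ℚ ℚ.≤ q → δ ℚ.≤ p ÷₀ q → δ ℚ.* q ℚ.≤ p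
δ≤÷₀⇒δ*≤ {δ} {p} {q} 0<δ 0≤q δ≤ with q ℚ.≟ 0ℚ
... | yes refl = ⊥-elim (ℚ.<-irrefl refl (ℚ.<-≤-trans 0<δ δ≤))
... | no q≢0 = ℚ.≤-trans (*-monoʳ 0≤q δ≤) (ℚ.≤-reflexive (trans (ℚ.*-assoc p _ q)
  (trans (cong (p ℚ.*_) (ℚ.*-inverseˡ q ⦃ ℚ.≢-nonZero q≢0 ⦄)) (ℚ.*-identityʳ p))))

≤÷₀ : ∀ {p q} → 0ℚ ℚ.≤ p → 0ℚ ℚ.< q → q ℚ.≤ 1ℚ → p ℚ.≤ p ÷₀ q
≤÷₀ {p} {q} 0≤p 0<q q≤1 with ℚ.≤-total p (p ÷₀ q)
... | inj₁ p≤ = p≤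
... | inj₂ ≤p = ℚ.≤-trans (ℚ.≤-reflexive (sym cancel)) (ℚ.≤-trans (*-monoˡ 0≤÷ q≤1) (ℚ.≤-reflexive (ℚ.*-identityʳ (p ÷₀ q))))
  where
  cancel : (p ÷₀ q) ℚ.* q ≡ p
  cancel = ÷₀-*-cancel p q (λ q≡0 → ℚ.<-irrefl (sym q≡0) 0<q)
  0≤÷ : 0ℚ ℚ.≤ p ÷₀ q
  0≤÷ = ℚ.*-cancelʳ-≤-pos q ⦃ ℚ.positive 0<q ⦄ (ℚ.≤-trans (ℚ.≤-reflexive (ℚ.*-zeroˡ q)) (ℚ.≤-trans 0≤p (ℚ.≤-reflexive (sym cancel))))

-- Every term of the sequence `log m` lies between ⌊log₂ m⌋ and ⌊log₂ m⌋ + 1, so a single term at a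
-- large index gives an inequality between natural numbers.
log-lower : ∀ m → 1 ≤ m → ∀ n → ι ⌊log₂ m ⌋ ℚ.≤ log m n
log-lower m 1≤m n = ℚ.≤-trans (ℚ.≤-reflexive (trans (sym (ℚ.*-identityʳ _)) (trans (cong (ι ⌊log₂ m ⌋ ℚ.*_) (sym (trans (ℚ.*-comm (ι (suc n)) _) (n/n≡1 n))))
    (sym (ℚ.*-assoc (ι ⌊log₂ m ⌋) (ι (suc n)) _)))))
  (ℚ.≤-trans (*-monoʳ (0≤1/ n) (ℚ.≤-trans (ℚ.≤-reflexive (sym (ι-* ⌊log₂ m ⌋ (suc n)))) (ι-mono bound)))
  (ℚ.≤-reflexive (sym (/≡ι* ⌊log₂ (m ^ suc n) ⌋ n))))
  where
  bound : ⌊log₂ m ⌋ * suc n ≤ ⌊log₂ (m ^ suc n) ⌋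
  bound = begin
    ⌊log₂ m ⌋ * suc n                        ≡⟨ ⌊log₂[2^n]⌋≡n (⌊log₂ m ⌋ * suc n) ⟨
    ⌊log₂ (2 ^ (⌊log₂ m ⌋ * suc n)) ⌋        ≤⟨ ⌊log₂⌋-mono-≤ (ℕ.≤-trans (ℕ.≤-reflexive (sym (ℕ.^-*-assoc 2 ⌊log₂ m ⌋ (suc n)))) (ℕ.^-monoˡ-≤ (suc n) (2^log≤n m 1≤m))) ⟩
    ⌊log₂ (m ^ suc n) ⌋                      ∎
    where
    open ℕ.≤-Reasoning

log-upper : ∀ m n → log m n ℚ.≤ ι (bits m)
log-upper m n = ℚ.≤-trans (ℚ.≤-reflexive (/≡ι* ⌊log₂ (m ^ suc n) ⌋ n))
  (ℚ.≤-trans (*-monoʳ (0≤1/ n) (ℚ.≤-trans (ι-mono bound) (ℚ.≤-reflexive (ι-* (bits m) (suc n)))))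
  (ℚ.≤-reflexive (trans (ℚ.*-assoc (ι (bits m)) (ι (suc n)) _) (trans (cong (ι (bits m) ℚ.*_) (trans (ℚ.*-comm (ι (suc n)) _) (n/n≡1 n))) (ℚ.*-identityʳ _)))))
  where
  bound : ⌊log₂ (m ^ suc n) ⌋ ≤ bits m * suc n
  bound = begin
    ⌊log₂ (m ^ suc n) ⌋                      ≤⟨ ⌊log₂⌋-mono-≤ (ℕ.≤-trans (ℕ.^-monoˡ-≤ (suc n) (ℕ.<⇒≤ (n<2^bits m))) (ℕ.≤-reflexive (ℕ.^-*-assoc 2 (bits m) (suc n)))) ⟩
    ⌊log₂ (2 ^ (bits m * suc n)) ⌋           ≡⟨ ⌊log₂[2^n]⌋≡n (bits m * suc n) ⟩
    bits m * suc n                           ∎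
    where
    open ℕ.≤-Reasoning

ratio-bound : ∀ {k l b a δ x y} → 0ℚ ℚ.< δ → pow ½ a ℚ.≤ δ → ι l ℚ.≤ y → x ℚ.≤ ι b → δ ℚ.≤ (ι k ℚ.* x) ÷₀ y → l ≤ 2 ^ a * k * b
ratio-bound {k} {l} {b} {a} {δ} {x} {y} 0<δ ½^a≤δ l≤y x≤b δ≤ = ι-cancel (begin
  ι l
    ≡⟨ trans (sym (ℚ.*-identityˡ (ι l))) (cong (ℚ._* ι l) (sym (pow-2-½ a))) ⟩
  pow (ι 2) a ℚ.* pow ½ a ℚ.* ι l
    ≡⟨ ℚ.*-assoc (pow (ι 2) a) (pow ½ a) (ι l) ⟩
  pow (ι 2) a ℚ.* (pow ½ a ℚ.* ι l)
    ≤⟨ *-monoˡ (pow-nonneg a (0≤ι 2)) (*-mono (pow-nonneg a 0≤½) 0≤y ½^a≤δ l≤y) ⟩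
  pow (ι 2) a ℚ.* (δ ℚ.* y)
    ≤⟨ *-monoˡ (pow-nonneg a (0≤ι 2)) (δ≤÷₀⇒δ*≤ 0<δ 0≤y δ≤) ⟩
  pow (ι 2) a ℚ.* (ι k ℚ.* x)
    ≤⟨ *-monoˡ (pow-nonneg a (0≤ι 2)) (*-monoˡ (0≤ι k) x≤b) ⟩
  pow (ι 2) a ℚ.* (ι k ℚ.* ι b)
    ≡⟨ trans (sym (ℚ.*-assoc (pow (ι 2) a) (ι k) (ι b))) (cong (ℚ._* ι b) (trans (cong (ℚ._* ι k) (sym (ι-^ a))) (sym (ι-* (2 ^ a) k)))) ⟩
  ι (2 ^ a * k) ℚ.* ι b
    ≡⟨ ι-* (2 ^ a * k) b ⟨
  ι (2 ^ a * k * b)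
    ∎)
  where
  open ℚ.≤-Reasoning
  0≤y : 0ℚ ℚ.≤ y
  0≤y = ℚ.≤-trans (0≤ι l) l≤y

-- One quarter of ε is the precision asked of the limit, the other is the slack in `_≤ᴿ_`.
half-apart : ∀ {ε p q} → ε ℚ.≤ q → ℚ.∣ p ℚ.- q ∣ ℚ.≤ ½ ℚ.* (½ ℚ.* ε) ℚ.+ ½ ℚ.* (½ ℚ.* ε) → ½ ℚ.* ε ℚ.≤ p
half-apart {ε} {p} {q} ε≤q close = +-cancelˡ-≤ (½ ℚ.* ε) (begin
  ½ ℚ.* ε ℚ.+ ½ ℚ.* ε       ≡⟨ ½+½ ε ⟩
  ε                         ≤⟨ ε≤q ⟩
  q                         ≤⟨ ∣-∣-lower {p} {q} close ⟩
  p ℚ.+ (½ ℚ.* (½ ℚ.* ε) ℚ.+ ½ ℚ.* (½ ℚ.* ε))  ≡⟨ cong (p ℚ.+_) (½+½ (½ ℚ.* ε)) ⟩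
  p ℚ.+ ½ ℚ.* ε             ≡⟨ ℚ.+-comm p (½ ℚ.* ε) ⟩
  ½ ℚ.* ε ℚ.+ p             ∎)
  where open ℚ.≤-Reasoning

-- r is at most r / q, and the slack 2 ^ (- (a + 1)) is at most half of 2 ^ (- a) * r because r ≥ 1.
quotient-bound : ∀ {r t a c q} → 1 ≤ r → pow ½ a ℚ.≤ c → 0ℚ ℚ.< q → q ℚ.≤ 1ℚ →
  c ℚ.* (ι r ÷₀ q) ℚ.≤ ι t ℚ.+ pow ½ (suc a) → r ≤ 2 ^ suc a * t
quotient-bound {r} {t} {a} {c} {q} 1≤r ½^a≤c 0<q q≤1 ≤t = ι-cancel (begin
  ι r
    ≡⟨ trans (sym (ℚ.*-identityˡ (ι r))) (trans (cong (ℚ._* ι r) (sym (pow-2-½ (suc a)))) (ℚ.*-assoc (pow (ι 2) (suc a)) (pow ½ (suc a)) (ι r))) ⟩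
  pow (ι 2) (suc a) ℚ.* x
    ≤⟨ *-monoˡ (pow-nonneg (suc a) (0≤ι 2)) half ⟩
  pow (ι 2) (suc a) ℚ.* ι t
    ≡⟨ trans (cong (ℚ._* ι t) (sym (ι-^ (suc a)))) (sym (ι-* (2 ^ suc a) t)) ⟩
  ι (2 ^ suc a * t)
    ∎)
  where
  open ℚ.≤-Reasoning
  x = pow ½ (suc a) ℚ.* ι r
  half : x ℚ.≤ ι t
  half = +-cancelˡ-≤ x (begin
    x ℚ.+ x
      ≡⟨ trans (cong₂ ℚ._+_ (ℚ.*-assoc ½ (pow ½ a) (ι r)) (ℚ.*-assoc ½ (pow ½ a) (ι r))) (½+½ (pow ½ a ℚ.* ι r)) ⟩
    pow ½ a ℚ.* ι r
      ≤⟨ *-mono (pow-nonneg a 0≤½) (ℚ.≤-trans (0≤ι r) (≤÷₀ (0≤ι r) 0<q q≤1)) ½^a≤c (≤÷₀ (0≤ι r) 0<q q≤1) ⟩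
    c ℚ.* (ι r ÷₀ q)
      ≤⟨ ≤t ⟩
    ι t ℚ.+ pow ½ (suc a)
      ≤⟨ ℚ.+-monoʳ-≤ (ι t) (ℚ.≤-trans (ℚ.≤-reflexive (sym (ℚ.*-identityʳ (pow ½ (suc a))))) (*-monoˡ (pow-nonneg (suc a) 0≤½) (ι-mono 1≤r))) ⟩
    ι t ℚ.+ x
      ≡⟨ ℚ.+-comm (ι t) x ⟩
    x ℚ.+ ι t
      ∎)

module _ {k 𝓖 Δ} (adm : Admissible k 𝓖 Δ) where
  open GroupEnsemble 𝓖
  open Admissible adm

  -- The density k log r / log |G| eventually exceeds half of a positive lower bound of Δ, which
  -- bounds log |G| by a multiple of log r.
  order-bound : ∃[ c ] ∃[ R ] ∀ r → R ≤ r → 1 ≤ r → ⌊log₂ order r ⌋ ≤ c * bits r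
  order-bound =
    let ε , 0<ε , N , ε≤Δ = positive
        0<½ε = ½*-positive 0<ε
        a , ½^a≤ = archimedean (½ ℚ.* ε) 0<½ε
        R , close = density (½ ℚ.* (½ ℚ.* ε)) (½*-positive 0<½ε)
    in 2 ^ a * k , R , λ r R≤r 1≤r →
      let N′ , ≤N′ = close r R≤r (½ ℚ.* (½ ℚ.* ε)) (½*-positive 0<½ε)
          n = N ⊔ N′
      in ratio-bound {k} {⌊log₂ order r ⌋} {bits r} {a} 0<½ε ½^a≤
        (log-lower (order r) (ℕ.≤-trans (s≤s z≤n) (nontrivial r 1≤r)) n) (log-upper r n)
        (half-apart (ℚ.≤-trans (ℚ.≤-reflexive (sym (ℚ.+-identityˡ ε))) (ε≤Δ n (ℕ.m≤m⊔n N N′))) (≤N′ n (ℕ.m≤n⊔m N N′)))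

  -- Below density 1 the quotient r / Δ is at least r. This pays for the r sampler runs and the
  -- writing of r codes in each trial.
  linear-bound : seq Δ <ᴿ fromℕ 1 → ∀ {T} → T =Ω (λ r → fromℕ r /ᴿ seq Δ) →
    ∃[ c ] ∃[ R ] ∀ r → R ≤ r → 1 ≤ r → r ≤ c * T r
  linear-bound (ε′ , 0<ε′ , N₁ , Δ+ε′≤1) {T} (c , 0<c , R , T≥) =
    let ε , 0<ε , N₂ , ε≤Δ = positive
        a , ½^a≤c = archimedean c 0<c
    in 2 ^ suc a , R , λ r R≤r 1≤r →
      let N₃ , ≤T = T≥ r R≤r (pow ½ (suc a)) (pow½-positive (suc a))
          n = N₁ ⊔ (N₂ ⊔ N₃)
      in quotient-bound {r} {T r} {a} 1≤r ½^a≤c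
        (ℚ.<-≤-trans 0<ε (ℚ.≤-trans (ℚ.≤-reflexive (sym (ℚ.+-identityˡ ε))) (ε≤Δ n (ℕ.≤-trans (ℕ.m≤m⊔n N₂ N₃) (ℕ.m≤n⊔m N₁ (N₂ ⊔ N₃))))))
        (ℚ.≤-trans (ℚ.≤-trans (ℚ.≤-reflexive (sym (ℚ.+-identityʳ (seq Δ n)))) (ℚ.+-monoʳ-≤ (seq Δ n) (ℚ.<⇒≤ 0<ε′))) (Δ+ε′≤1 n (ℕ.m≤m⊔n N₁ (N₂ ⊔ N₃))))
        (≤T n (ℕ.≤-trans (ℕ.m≤n⊔m N₂ N₃) (ℕ.m≤n⊔m N₁ (N₂ ⊔ N₃))))

-- Running time

module RunningTime {k 𝓖 Δ} (adm : Admissible k 𝓖 Δ) (𝓐 : Program) (T : ℕ → ℕ)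
  (halts : KSum.RunsInTime k 𝓖 𝓐 T) (D : ℕ) where
  open GroupEnsemble 𝓖
  open Admissible adm
  open Reduction adm 𝓐 T halts D
  open Regions (2 + D)

  module At (r : ℕ) (2≤r : 2 ≤ r) where
    open Correct r 2≤r
    open Ideal r using (H)
    open Layout r using (M; U; M-def)

    S : ℕ
    S = samplerTime r

    -- The order of one trial: r sampler runs and one run of the decision algorithm, slowed down by
    -- the word length.
    unit : ℕ
    unit = w * (suc r * suc S + T r)

    forTime≡ : ∀ c n → forTime c n ≡ n * stepTime c + 41 * w
    forTime≡ c zero    = refl
    forTime≡ c (suc n) = trans (cong (λ z → stepTime c + z) (forTime≡ c n)) (sym (ℕ.+-assoc (stepTime c) (n * stepTime c) (41 * w)))

    scoreTime≤ : scoreTime ≤ 307 * (w * suc r)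
    scoreTime≤ = begin
      34 * w + forTime (197 * w) r                    ≡⟨ cong (λ z → 34 * w + z) (forTime≡ (197 * w) r) ⟩
      34 * w + (r * stepTime (197 * w) + 41 * w)      ≤⟨ ℕ.m≤m+n _ (232 * w) ⟩
      34 * w + (r * stepTime (197 * w) + 41 * w) + 232 * w  ≡⟨ lem w r ⟩
      307 * (w * suc r)                               ∎
      where
      open ℕ.≤-Reasoning
      lem : ∀ w r → 34 * w + (r * (41 * w + (197 * w + 69 * w)) + 41 * w) + 232 * w ≡ 307 * (w * suc r)
      lem = solve-∀

    fillTime≤ : forTime resampleTime r ≤ 591 * (w * (suc r * suc S))
    fillTime≤ = begin
      forTime resampleTime r                          ≡⟨ forTime≡ resampleTime r ⟩
      r * stepTime resampleTime + 41 * w              ≤⟨ ℕ.m≤m+n _ (484 * w * r * S + 41 * w * r + 550 * w + 591 * w * S) ⟩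
      r * stepTime resampleTime + 41 * w + (484 * w * r * S + 41 * w * r + 550 * w + 591 * w * S) ≡⟨ lem w r S ⟩
      591 * (w * (suc r * suc S))                     ∎
      where
      open ℕ.≤-Reasoning
      lem : ∀ w r S → r * (41 * w + (66 * w + (106 * w + (107 * w * S + (65 * w + 203 * w))) + 69 * w)) + 41 * w + (484 * w * r * S + 41 * w * r + 550 * w + 591 * w * S) ≡ 591 * (w * (suc r * suc S))
      lem = solve-∀

    1≤w′ : 1 ≤ w
    1≤w′ = ℕ.≤-trans (1≤bits U) (ℕ.≤-trans (ℕ.m≤m+n (bits U) (bits r + samplerTime r)) (ℕ.≤-reflexive (sym w-def)))

    wr≤unit : w * suc r ≤ unit
    wr≤unit = ℕ.*-monoʳ-≤ w (ℕ.≤-trans (ℕ.m≤m*n (suc r) (suc S)) (ℕ.m≤m+n (suc r * suc S) (T r)))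

    w≤unit : w ≤ unit
    w≤unit = ℕ.≤-trans (ℕ.m≤m*n w (suc r)) wr≤unit

    wrS≤unit : w * (suc r * suc S) ≤ unit
    wrS≤unit = ℕ.*-monoʳ-≤ w (ℕ.m≤m+n (suc r * suc S) (T r))

    wT≤unit : w * T r ≤ unit
    wT≤unit = ℕ.*-monoʳ-≤ w (ℕ.m≤n+m (T r) (suc r * suc S))

    T≤unit : T r ≤ unit
    T≤unit = ℕ.≤-trans (ℕ.≤-trans (ℕ.≤-reflexive (sym (ℕ.*-identityˡ (T r)))) (ℕ.*-monoˡ-≤ (T r) 1≤w′)) wT≤unit

    1≤unit : 1 ≤ unit
    1≤unit = ℕ.≤-trans 1≤w′ w≤unit

    trialTime≤ : trialTime ≤ 1218 * unit
    trialTime≤ = begin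
      71 * w + ((34 * w + forTime resampleTime r) + (72 * w * T r + ((68 * w + T r + scoreTime) + 74 * w)))
        ≤⟨ ℕ.+-mono-≤ (ℕ.*-monoʳ-≤ 71 w≤unit) (ℕ.+-mono-≤ (ℕ.+-mono-≤ (ℕ.*-monoʳ-≤ 34 w≤unit) (ℕ.≤-trans fillTime≤ (ℕ.*-monoʳ-≤ 591 wrS≤unit)))
             (ℕ.+-mono-≤ (ℕ.≤-trans (ℕ.≤-reflexive (ℕ.*-assoc 72 w (T r))) (ℕ.*-monoʳ-≤ 72 wT≤unit))
               (ℕ.+-mono-≤ (ℕ.+-mono-≤ (ℕ.+-mono-≤ (ℕ.*-monoʳ-≤ 68 w≤unit) T≤unit) (ℕ.≤-trans scoreTime≤ (ℕ.*-monoʳ-≤ 307 wr≤unit))) (ℕ.*-monoʳ-≤ 74 w≤unit)))) ⟩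
      71 * unit + ((34 * unit + 591 * unit) + (72 * unit + ((68 * unit + unit + 307 * unit) + 74 * unit)))
        ≡⟨ lem unit ⟩
      1218 * unit
        ∎
      where
      open ℕ.≤-Reasoning
      lem : ∀ u → 71 * u + ((34 * u + 591 * u) + (72 * u + ((68 * u + u + 307 * u) + 74 * u))) ≡ 1218 * u
      lem = solve-∀

    roundTime≤ : roundTime ≤ (D * 1218 + 171) * unit
    roundTime≤ = begin
      (D * trialTime + 1) + (101 * w + 69 * w)
        ≤⟨ ℕ.+-mono-≤ (ℕ.+-mono-≤ (ℕ.*-monoʳ-≤ D trialTime≤) 1≤unit) (ℕ.+-mono-≤ (ℕ.*-monoʳ-≤ 101 w≤unit) (ℕ.*-monoʳ-≤ 69 w≤unit)) ⟩
      (D * (1218 * unit) + unit) + (101 * unit + 69 * unit)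
        ≡⟨ lem D unit ⟩
      (D * 1218 + 171) * unit
        ∎
      where
      open ℕ.≤-Reasoning
      lem : ∀ D u → (D * (1218 * u) + u) + (101 * u + 69 * u) ≡ (D * 1218 + 171) * u
      lem = solve-∀

    outputTime≤ : outputTime ≤ 245 * (w * suc r)
    outputTime≤ = begin
      34 * w + forTime (135 * w) r                    ≡⟨ cong (λ z → 34 * w + z) (forTime≡ (135 * w) r) ⟩
      34 * w + (r * stepTime (135 * w) + 41 * w)      ≤⟨ ℕ.m≤m+n _ (170 * w) ⟩
      34 * w + (r * stepTime (135 * w) + 41 * w) + 170 * w  ≡⟨ lem w r ⟩
      245 * (w * suc r)                               ∎
      where
      open ℕ.≤-Reasoning
      lem : ∀ w r → 34 * w + (r * (41 * w + (135 * w + 69 * w)) + 41 * w) + 170 * w ≡ 245 * (w * suc r)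
      lem = solve-∀

    mainTime≤ : mainTime ≤ (D * 1218 + 532) * (H * unit)
    mainTime≤ = begin
      34 * w + ((H * (41 * w + roundTime) + 41 * w) + outputTime)
        ≤⟨ ℕ.+-mono-≤ (ℕ.*-monoʳ-≤ 34 w≤unit) (ℕ.+-mono-≤ (ℕ.+-mono-≤ (ℕ.*-monoʳ-≤ H (ℕ.+-mono-≤ (ℕ.*-monoʳ-≤ 41 w≤unit) (roundTime≤))) (ℕ.*-monoʳ-≤ 41 w≤unit))
             (ℕ.≤-trans (outputTime≤) (ℕ.*-monoʳ-≤ 245 wr≤unit))) ⟩
      34 * unit + ((H * (41 * unit + (D * 1218 + 171) * unit) + 41 * unit) + 245 * unit)
        ≡⟨ lem₁ D H unit ⟩
      320 * unit + (D * 1218 + 212) * (H * unit)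
        ≤⟨ ℕ.+-monoˡ-≤ _ (ℕ.*-monoʳ-≤ 320 (ℕ.m≤m+n unit (⌊log₂ r ⌋ * unit))) ⟩
      320 * (H * unit) + (D * 1218 + 212) * (H * unit)
        ≡⟨ lem₂ D (H * unit) ⟩
      (D * 1218 + 532) * (H * unit)
        ∎
      where
      open ℕ.≤-Reasoning
      lem₁ : ∀ D H u → 34 * u + ((H * (41 * u + (D * 1218 + 171) * u) + 41 * u) + 245 * u) ≡ 320 * u + (D * 1218 + 212) * (H * u)
      lem₁ = solve-∀
      lem₂ : ∀ D u → 320 * u + (D * 1218 + 212) * u ≡ (D * 1218 + 532) * u
      lem₂ = solve-∀

    bits-U : bits U ≤ (12 + 2 * bits (3 + D)) * bits r
    bits-U = begin
      bits U
        ≤⟨ ℕ.≤-trans (bits-+ (suc r) (suc r * M + M)) (ℕ.+-monoʳ-≤ (bits (suc r)) (ℕ.≤-trans (bits-+ (suc r * M) M) (ℕ.+-monoˡ-≤ (bits M) (bits-* (suc r) M)))) ⟩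
      bits (suc r) + (bits (suc r) + bits M + bits M)
        ≤⟨ ℕ.+-monoʳ-≤ (bits (suc r)) (ℕ.+-mono-≤ (ℕ.+-monoʳ-≤ (bits (suc r)) bits-M) bits-M) ⟩
      bits (suc r) + (bits (suc r) + (d + (bits (suc r) + bits (suc r))) + (d + (bits (suc r) + bits (suc r))))
        ≡⟨ lem₁ (bits (suc r)) d ⟩
      6 * bits (suc r) + 2 * d * 1
        ≤⟨ ℕ.+-mono-≤ (ℕ.*-monoʳ-≤ 6 (ℕ.≤-trans (bits-+ 1 r) (ℕ.+-monoˡ-≤ (bits r) (1≤bits r)))) (ℕ.*-monoʳ-≤ (2 * d) (1≤bits r)) ⟩
      6 * (bits r + bits r) + 2 * d * bits r
        ≡⟨ lem₂ (bits r) d ⟩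
      (12 + 2 * d) * bits r
        ∎
      where
      open ℕ.≤-Reasoning
      d = bits (3 + D)
      bits-M : bits M ≤ d + (bits (suc r) + bits (suc r))
      bits-M = ℕ.≤-trans (ℕ.≤-reflexive (cong bits M-def)) (ℕ.≤-trans (bits-* (3 + D) (suc r * suc r)) (ℕ.+-monoʳ-≤ d (bits-* (suc r) (suc r))))
      lem₁ : ∀ b d → b + (b + (d + (b + b)) + (d + (b + b))) ≡ 6 * b + 2 * d * 1
      lem₁ = solve-∀
      lem₂ : ∀ b d → 6 * (b + b) + 2 * d * b ≡ (12 + 2 * d) * b
      lem₂ = solve-∀

  ^-distribʳ-* : ∀ m n e → (m * n) ^ e ≡ m ^ e * n ^ e
  ^-distribʳ-* m n zero    = refl
  ^-distribʳ-* m n (suc e) = trans (cong (m * n *_) (^-distribʳ-* m n e)) (lem m n (m ^ e) (n ^ e))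
    where
    lem : ∀ a b c d → a * b * (c * d) ≡ a * c * (b * d)
    lem = solve-∀

  log≤ : ∀ n → 1 ≤ n → ⌊log₂ n ⌋ ≤ n
  log≤ n 1≤n = ℕ.≤-trans (n≤2^n ⌊log₂ n ⌋) (2^log≤n n 1≤n)

  log≤′ : ∀ n → ⌊log₂ n ⌋ ≤ n
  log≤′ zero    = z≤n
  log≤′ (suc n) = log≤ (suc n) (s≤s z≤n)

  -- Crude but sufficient: the iterated logarithm is bounded by the logarithm itself, and log |G| by
  -- a multiple of log r.
  sampler-polylog : ∃[ c ] ∃[ e ] ∃[ R ] ∀ r → R ≤ r → 1 ≤ r → samplerTime r ≤ c * bits r ^ suc e
  sampler-polylog =
    let e , c , R₁ , sampler≤ = samplerBound
        d , R₂ , order≤ = order-bound adm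
    in c * d ^ suc e , e , R₁ ⊔ R₂ , λ r R≤r 1≤r → let lg = ⌊log₂ order r ⌋ in begin
      samplerTime r                      ≤⟨ sampler≤ r (ℕ.≤-trans (ℕ.m≤m⊔n R₁ R₂) R≤r) ⟩
      c * (lg * ⌊log₂ lg ⌋ ^ e)          ≤⟨ ℕ.*-monoʳ-≤ c (ℕ.*-monoʳ-≤ lg (ℕ.^-monoˡ-≤ e (log≤′ lg))) ⟩
      c * lg ^ suc e                     ≤⟨ ℕ.*-monoʳ-≤ c (ℕ.^-monoˡ-≤ (suc e) (order≤ r (ℕ.≤-trans (ℕ.m≤n⊔m R₁ R₂) R≤r) 1≤r)) ⟩
      c * (d * bits r) ^ suc e           ≡⟨ cong (c *_) (^-distribʳ-* d (bits r) (suc e)) ⟩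
      c * (d ^ suc e * bits r ^ suc e)   ≡⟨ ℕ.*-assoc c (d ^ suc e) (bits r ^ suc e) ⟨
      c * d ^ suc e * bits r ^ suc e     ∎
    where open ℕ.≤-Reasoning

  -- `bits r` is included to pay for comparing r with the limit of the table.
  main-quasilinear : seq Δ <ᴿ fromℕ 1 → T =Ω (λ r → fromℕ r /ᴿ seq Δ) →
    ∃[ e ] ∃[ c ] ∃[ R ] ∀ r (2≤r : 2 ≤ r) → R ≤ r → Correct.mainTime r 2≤r + bits r ≤ c * (T r * ⌊log₂ r ⌋ ^ e)
  main-quasilinear Δ<1 T≥ =
    let s , e , R₁ , sampler≤ = sampler-polylog
        a , R₂ , r≤aT = linear-bound adm Δ<1 {T} T≥
        d = 12 + 2 * bits (3 + D)
        x = suc e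
    -- One factor `bits r` is the number of rounds; the word length and the sampler time contribute
    -- the exponent x each.
    in suc (x + x) , (D * 1218 + 533) * ((d + 1 + s) * (2 * a * suc s + 1)) * 2 ^ suc (x + x) , R₁ ⊔ R₂ , λ r 2≤r R≤r →
      let open At r 2≤r
          1≤r = ℕ.≤-trans (s≤s z≤n) 2≤r
          b = bits r
          1≤b = 1≤bits r
          t = T r
          S≤ : S ≤ s * b ^ x
          S≤ = sampler≤ r (ℕ.≤-trans (ℕ.m≤m⊔n R₁ R₂) R≤r) 1≤r
          1≤b^ : ∀ n → 1 ≤ b ^ n
          1≤b^ n = ℕ.≤-trans (ℕ.≤-reflexive (sym (ℕ.^-zeroˡ n))) (ℕ.^-monoˡ-≤ n 1≤b)
          b≤b^x : b ≤ b ^ x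
          b≤b^x = ℕ.≤-trans (ℕ.≤-reflexive (sym (ℕ.*-identityʳ b))) (ℕ.*-monoʳ-≤ b (1≤b^ e))
          w≤ : Correct.w r 2≤r ≤ (d + 1 + s) * b ^ x
          w≤ = begin
            Correct.w r 2≤r                          ≡⟨ Correct.w-def r 2≤r ⟩
            bits (Layout.U r) + (b + S)              ≤⟨ ℕ.+-mono-≤ (ℕ.≤-trans bits-U (ℕ.*-monoʳ-≤ d b≤b^x)) (ℕ.+-mono-≤ b≤b^x S≤) ⟩
            d * b ^ x + (b ^ x + s * b ^ x)          ≡⟨ lem₁ d s (b ^ x) ⟩
            (d + 1 + s) * b ^ x                      ∎
          r+1≤ : suc r ≤ 2 * a * t
          r+1≤ = begin
            suc r                                    ≤⟨ ℕ.+-monoˡ-≤ r 1≤r ⟩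
            r + r                                    ≤⟨ ℕ.+-mono-≤ (r≤aT r (ℕ.≤-trans (ℕ.m≤n⊔m R₁ R₂) R≤r) 1≤r) (r≤aT r (ℕ.≤-trans (ℕ.m≤n⊔m R₁ R₂) R≤r) 1≤r) ⟩
            a * t + a * t                            ≡⟨ lem₂ a t ⟩
            2 * a * t                                ∎
          S+1≤ : suc S ≤ suc s * b ^ x
          S+1≤ = ℕ.+-mono-≤ (1≤b^ x) S≤
          unit≤ : unit ≤ (d + 1 + s) * (2 * a * suc s + 1) * (t * (b ^ x * b ^ x))
          unit≤ = begin
            Correct.w r 2≤r * (suc r * suc S + t)
              ≤⟨ ℕ.*-mono-≤ w≤ (ℕ.+-mono-≤ (ℕ.*-mono-≤ r+1≤ S+1≤) (ℕ.≤-trans (ℕ.≤-reflexive (sym (ℕ.*-identityʳ t))) (ℕ.*-monoʳ-≤ t (1≤b^ x)))) ⟩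
            (d + 1 + s) * b ^ x * (2 * a * t * (suc s * b ^ x) + t * b ^ x)
              ≡⟨ lem₃ (d + 1 + s) (b ^ x) (2 * a) t (suc s) ⟩
            (d + 1 + s) * (2 * a * suc s + 1) * (t * (b ^ x * b ^ x))
              ∎
          L = ⌊log₂ r ⌋
          -- From r ≥ 2 on, ⌊log₂ r⌋ is positive, so `bits r` can be replaced by the logarithm that
          -- `_=Õ_` allows.
          b≤2L : b ≤ 2 * L
          b≤2L = ℕ.≤-trans (ℕ.+-monoˡ-≤ L (⌊log₂⌋-mono-≤ {2} {r} 2≤r)) (ℕ.≤-reflexive (cong (λ z → L + z) (sym (ℕ.+-identityʳ L))))
      in begin
        Correct.mainTime r 2≤r + b
          ≤⟨ ℕ.+-mono-≤ (mainTime≤) (ℕ.≤-trans (ℕ.≤-reflexive (sym (ℕ.*-identityʳ b))) (ℕ.*-monoʳ-≤ b 1≤unit)) ⟩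
        (D * 1218 + 532) * (b * unit) + b * unit
          ≡⟨ lem₄ (D * 1218 + 532) (b * unit) ⟩
        (D * 1218 + 532 + 1) * (b * unit)
          ≡⟨ cong (_* (b * unit)) (ℕ.+-assoc (D * 1218) 532 1) ⟩
        (D * 1218 + 533) * (b * unit)
          ≤⟨ ℕ.*-monoʳ-≤ (D * 1218 + 533) (ℕ.*-monoʳ-≤ b unit≤) ⟩
        (D * 1218 + 533) * (b * ((d + 1 + s) * (2 * a * suc s + 1) * (t * (b ^ x * b ^ x))))
          ≡⟨ lem₅ (D * 1218 + 533) b ((d + 1 + s) * (2 * a * suc s + 1)) t (b ^ x * b ^ x) ⟩
        (D * 1218 + 533) * ((d + 1 + s) * (2 * a * suc s + 1)) * (t * (b * (b ^ x * b ^ x)))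
          ≡⟨ cong (λ y → (D * 1218 + 533) * ((d + 1 + s) * (2 * a * suc s + 1)) * (t * (b * y))) (sym (ℕ.^-distribˡ-+-* b x x)) ⟩
        (D * 1218 + 533) * ((d + 1 + s) * (2 * a * suc s + 1)) * (t * b ^ suc (x + x))
          ≤⟨ ℕ.*-monoʳ-≤ ((D * 1218 + 533) * ((d + 1 + s) * (2 * a * suc s + 1))) (ℕ.*-monoʳ-≤ t (ℕ.≤-trans (ℕ.^-monoˡ-≤ (suc (x + x)) b≤2L) (ℕ.≤-reflexive (^-distribʳ-* 2 L (suc (x + x)))))) ⟩
        (D * 1218 + 533) * ((d + 1 + s) * (2 * a * suc s + 1)) * (t * (2 ^ suc (x + x) * L ^ suc (x + x)))
          ≡⟨ lem₆ ((D * 1218 + 533) * ((d + 1 + s) * (2 * a * suc s + 1))) t (2 ^ suc (x + x)) (L ^ suc (x + x)) ⟩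
        (D * 1218 + 533) * ((d + 1 + s) * (2 * a * suc s + 1)) * 2 ^ suc (x + x) * (t * L ^ suc (x + x))
          ∎
    where
    open ℕ.≤-Reasoning
    lem₁ : ∀ d s y → d * y + (y + s * y) ≡ (d + 1 + s) * y
    lem₁ = solve-∀
    lem₂ : ∀ a t → a * t + a * t ≡ 2 * a * t
    lem₂ = solve-∀
    lem₃ : ∀ c y a t s → c * y * (a * t * (s * y) + t * y) ≡ c * (a * s + 1) * (t * (y * y))
    lem₃ = solve-∀
    lem₄ : ∀ c y → c * y + y ≡ (c + 1) * y
    lem₄ = solve-∀
    lem₅ : ∀ c b q t y → c * (b * (q * (t * y))) ≡ c * q * (t * (b * y))
    lem₅ = solve-∀
    lem₆ : ∀ c t p l → c * (t * (p * l)) ≡ c * p * (t * l)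
    lem₆ = solve-∀

-- Deterministic programs for finitely many inputs

record Det (P : Program) (m : Mem) (R : Mem → Set) : Set where
  constructor det
  field
    elapsed : ℕ
    final   : Mem
    related : R final
    -- Any fuel will do, because the table programs contain no loops.
    runs    : ∀ n t → exec n P (t , m) ≡ ret (just (t + elapsed , final))

open Det

Det-cond-suc : ∀ {e P Q m R v} → eval e m ≡ suc v → Det P m R → Det (cond e P Q) m R
Det-cond-suc {e} {m = m} e≡ (det c m′ r runs) = det (cost e m + c) m′ r λ n t →
  trans (exec-cond-suc {e = e} e≡) (trans (runs n (t + cost e m)) (cong (λ x → ret (just (x , m′))) (ℕ.+-assoc t (cost e m) c)))

Det-cond-zero : ∀ {e P Q m R} → eval e m ≡ 0 → Det Q m R → Det (cond e P Q) m R
Det-cond-zero {e} {m = m} e≡ (det c m′ r runs) = det (cost e m + c) m′ r λ n t →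
  trans (exec-cond-zero {e = e} e≡) (trans (runs n (t + cost e m)) (cong (λ x → ret (just (x , m′))) (ℕ.+-assoc t (cost e m) c)))

writeP : ∀ {n} → ℕ → Vec ℕ n → Program
writeP i []       = skip
writeP i (v ∷ vs) = store (lit i) (lit v) ⨾ writeP (suc i) vs

Det-write : ∀ {n} i (vs : Vec ℕ n) m → Det (writeP i vs) m (λ m′ → ∀ a → m′ a ≡ writeVec i vs m a)
Det-write i []       m = det 1 m (λ _ → refl) λ n t → cong (λ x → ret (just (x , m))) (ℕ.+-comm 1 t)
Det-write i (v ∷ vs) m with Det-write (suc i) vs (m [ i ↦ v ])
... | det c m′ m′≡ runs = det (bits i + bits v + bits i + bits v + c) m′ m′≡ λ n t →
  trans (runs n (t + bits i + bits v + bits i + bits v)) (cong (λ x → ret (just (x , m′))) (lem t (bits i) (bits v) c))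
  where
  lem : ∀ t i v c → t + i + v + i + v + c ≡ t + (i + v + i + v + c)
  lem = solve-∀

-- The absolute difference by truncated subtraction, since `cond` can only test for 0.
diffE : Expr → Expr → Expr
diffE e f = op add (op sub e f) (op sub f e)

diff : ℕ → ℕ → ℕ
diff x y = (x ∸ y) + (y ∸ x)

diff≡0⇒≡ : ∀ x y → diff x y ≡ 0 → x ≡ y
diff≡0⇒≡ x y eq = ℕ.≤-antisym (ℕ.m∸n≡0⇒m≤n (ℕ.m+n≡0⇒m≡0 (x ∸ y) eq)) (ℕ.m∸n≡0⇒m≤n (ℕ.m+n≡0⇒n≡0 (x ∸ y) eq))

diff-refl : ∀ x → diff x x ≡ 0
diff-refl x = cong₂ _+_ (ℕ.n∸n≡0 x) (ℕ.n∸n≡0 x)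

diffsE : ∀ {n} → ℕ → Vec ℕ n → Expr
diffsE i []       = lit 0
diffsE i (v ∷ vs) = op add (diffE (cell (lit i)) (lit v)) (diffsE (suc i) vs)

diffsE-zero : ∀ {n} i (vs : Vec ℕ n) m → (∀ j → m (i + toℕ j) ≡ lookup vs j) → eval (diffsE i vs) m ≡ 0
diffsE-zero i []       m eq = refl
diffsE-zero i (v ∷ vs) m eq = cong₂ _+_
  (trans (cong (λ x → diff x v) (trans (cong m (sym (ℕ.+-identityʳ i))) (eq zero))) (diff-refl v))
  (diffsE-zero (suc i) vs m (λ j → trans (cong m (sym (ℕ.+-suc i (toℕ j)))) (eq (suc j))))

diffsE-zero⁻ : ∀ {n} i (vs : Vec ℕ n) m → eval (diffsE i vs) m ≡ 0 → ∀ j → m (i + toℕ j) ≡ lookup vs j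
diffsE-zero⁻ i (v ∷ vs) m eq zero    = trans (cong m (ℕ.+-identityʳ i)) (diff≡0⇒≡ (m i) v (ℕ.m+n≡0⇒m≡0 (diff (m i) v) eq))
diffsE-zero⁻ i (v ∷ vs) m eq (suc j) = trans (cong m (ℕ.+-suc i (toℕ j))) (diffsE-zero⁻ (suc i) vs m (ℕ.m+n≡0⇒n≡0 (diff (m i) v) eq) j)

vectors : ∀ n r → List (Vec (Fin n) r)
vectors n zero    = [] ∷ []
vectors n (suc r) = List.cartesianProductWith _∷_ (List.allFin n) (vectors n r)

∈-vectors : ∀ {n r} (v : Vec (Fin n) r) → v ∈ vectors n r
∈-vectors []      = here refl
∈-vectors (i ∷ v) = ∈-cartesianProductWith⁺ _∷_ (∈-allFin i) (∈-vectors v)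

bounded : ∀ {A : Set} (xs : List A) (f : A → ℕ) → ∃[ b ] ∀ {x} → x ∈ xs → f x ≤ b
bounded []       f = 0 , λ ()
bounded (x ∷ xs) f with bounded xs f
... | b , ≤b = f x ⊔ b , λ { (here refl) → ℕ.m≤m⊔n (f x) b ; (there x∈) → ℕ.≤-trans (≤b x∈) (ℕ.m≤n⊔m (f x) b) }

-- Small inputs

-- The decision algorithm promises nothing for finitely many r, where the
-- search is by table lookup instead.

module Table (k : ℕ) (𝓖 : GroupEnsemble) where
  open GroupEnsemble 𝓖
  open KSum k 𝓖

  module _ {r : ℕ} where

    codes : Vec (G r) r → Vec ℕ r
    codes = Vec.map ⟦_⟧

    element : Vec (Fin (order r)) r → Vec (G r) r
    element = Vec.map (Inverse.from (enum r))

    indices : Vec (G r) r → Vec (Fin (order r)) r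
    indices = Vec.map (Inverse.to (enum r))

    codes-element : ∀ X → codes (element (indices X)) ≡ codes X
    codes-element X = trans (sym (Vec.map-∘ ⟦_⟧ (Inverse.from (enum r)) (indices X))) (trans (sym (Vec.map-∘ _ _ X))
      (Vec.map-cong (λ x → Injection.cong (code r) (Inverse.strictlyInverseʳ (enum r) x)) X))

    Solution : Vec (G r) r → Subset r → Set
    Solution X S = solves X S ≡ true

    -- The search over all subsets takes place while the program is constructed, and its result
    -- enters the program as literals.
    answer : Vec (G r) r → Subset r
    answer X with Any.any? (λ S → solves X S Bool.≟ true) (subsets r)
    ... | yes p = proj₁ (Any.satisfied p)
    ... | no _  = ∅

    answer-solves : ∀ X S → Solution X S → Solution X (answer X)
    answer-solves X S sol with Any.any? (λ S → solves X S Bool.≟ true) (subsets r)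
    ... | yes p = proj₂ (Any.satisfied p)
    ... | no ¬p = ⊥-elim (¬p (Any.map (λ { refl → sol }) (∈-subsets S)))

    module Gr = AbelianGroup (group r)
    module ∑ᴳ = CommutativeMonoidSum Gr.commutativeMonoid

    -- The table holds one representative per group element, so an input meets its entry only up to
    -- equal codes.
    solves-cong : ∀ {X Y} → codes X ≡ codes Y → ∀ S → Solution X S → Solution Y S
    solves-cong {X} {Y} eq S sol = trans (cong ((∣ S ∣ ≡ᵇ k) ∧_) (does-cong (sumOver S X ≈? 0ᴳ) (sumOver S Y ≈? 0ᴳ) sums≈)) sol
      where
      X≈Y : ∀ i → lookup X i ≈ lookup Y i
      X≈Y i = Injection.injective (code r) (trans (sym (Vec.lookup-map i ⟦_⟧ X)) (trans (cong (λ c → lookup c i) eq) (Vec.lookup-map i ⟦_⟧ Y)))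
      sums≈ : sumOver S X ≈ sumOver S Y
      sums≈ = ∑ᴳ.sum-cong-≋ {r} λ i → pick i (lookup S i)
        where
        pick : ∀ i b → (if b then lookup X i else 0ᴳ) ≈ (if b then lookup Y i else 0ᴳ)
        pick i true  = X≈Y i
        pick i false = Gr.refl
      does-cong : ∀ {x y : G r} (d : Dec (x ≈ 0ᴳ)) (e : Dec (y ≈ 0ᴳ)) → x ≈ y → does e ≡ does d
      does-cong (yes p) e x≈y = dec-true e (Gr.trans (Gr.sym x≈y) p)
      does-cong (no ¬p) e x≈y = dec-false e (λ q → ¬p (Gr.trans x≈y q))

    decode-write : ∀ (S : Subset r) {m m′} → (∀ a → m′ a ≡ writeVec 1 (Vec.map 𝟚 S) m a) → decode r m′ ≡ S
    decode-write S {m} {m′} m′≡ = trans (Vec.tabulate-cong bit) (Vec.tabulate∘lookup S)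
      where
      bit : ∀ i → (if m′ (suc (toℕ i)) ≡ᵇ 0 then outside else inside) ≡ lookup S i
      bit i rewrite m′≡ (suc (toℕ i)) | writeVec-lookup 1 (Vec.map 𝟚 S) m i | Vec.lookup-map i 𝟚 S with lookup S i
      ... | true  = refl
      ... | false = refl

    tableP : List (Vec (G r) r) → Program
    tableP []       = skip
    tableP (X ∷ Xs) = cond (diffsE 1 (codes X)) (tableP Xs) (writeP 1 (Vec.map 𝟚 (answer X)))

    Solved : Vec (G r) r → Mem → Set
    Solved X m = ∀ S → Solution X S → Solution X (decode r m)

    Det-table : ∀ X Xs → Any.Any (λ Y → codes Y ≡ codes X) Xs → Det (tableP Xs) (initial (encode X)) (Solved X)
    Det-table X (Y ∷ Xs) found with eval (diffsE 1 (codes Y)) (initial (encode X)) in eq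
    ... | zero = Det-cond-zero eq (det (elapsed w′) (final w′) solved (runs w′))
      where
      w′ = Det-write 1 (Vec.map 𝟚 (answer Y)) (initial (encode X))
      Y≡X : codes Y ≡ codes X
      Y≡X = lookup-injective λ j → trans (sym (diffsE-zero⁻ 1 (codes Y) _ eq j)) (initial-lookup (codes X) j)
        where
        lookup-injective : ∀ {n} {us vs : Vec ℕ n} → (∀ j → lookup us j ≡ lookup vs j) → us ≡ vs
        lookup-injective {us = us} {vs} eq = trans (sym (Vec.tabulate∘lookup us)) (trans (Vec.tabulate-cong eq) (Vec.tabulate∘lookup vs))
      solved : Solved X (final w′)
      solved S sol = subst (Solution X) (sym (decode-write (answer Y) (related w′)))
        (solves-cong Y≡X (answer Y) (answer-solves Y S (solves-cong (sym Y≡X) S sol)))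
    ... | suc v with found
    ...   | there found′ = Det-cond-suc eq (Det-table X Xs found′)
    ...   | here Y≡X with trans (sym eq) (diffsE-zero 1 (codes Y) (initial (encode X)) λ j → trans (initial-lookup (codes X) j) (cong (λ c → lookup c j) (sym Y≡X)))
    ...     | ()

    allInputs : List (Vec (G r) r)
    allInputs = List.map element (vectors (order r) r)

    found : ∀ X → Any.Any (λ Y → codes Y ≡ codes X) allInputs
    found X = Any.map (λ eq → trans (cong codes (sym eq)) (codes-element X)) (∈-map⁺ element (∈-vectors (indices X)))

  tablesP : ℕ → Program
  tablesP zero    = skip
  tablesP (suc n) = cond (diffE (cell (lit 0)) (lit n)) (tablesP n) (tableP (allInputs {n}))

  Det-tables : ∀ R {r} (X : Vec (G r) r) → r < R → Det (tablesP R) (initial (encode X)) (Solved X)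
  Det-tables (suc n) {r} X r<R with diff r n in eq
  ... | suc v = Det-cond-suc eq (Det-tables n X (ℕ.≤∧≢⇒< (ℕ.≤-pred r<R) λ r≡n → case trans (sym eq) (trans (cong (diff r) (sym r≡n)) (diff-refl r)) of λ ()))
  ... | zero with diff≡0⇒≡ r n eq
  ...   | refl = Det-cond-zero eq (Det-table X allInputs (found X))

  smallE : ℕ → Expr
  smallE R = op sub (lit R) (cell (lit 0))

  withTables : ℕ → Program → Program
  withTables R P = cond (smallE R) (tablesP R) P

  Det-withTables : ∀ R P {r} (X : Vec (G r) r) → r < R → Det (withTables R P) (initial (encode X)) (Solved X)
  Det-withTables (suc R) P {r} X r<R = Det-cond-suc {v = R ∸ r} (ℕ.+-∸-assoc 1 (ℕ.≤-pred r<R)) (Det-tables (suc R) X r<R)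

  -- The carrier may have infinitely many representatives; the maximum is taken over vectors of
  -- indices, which yield the same encodings as all inputs.
  tableTime : ∀ R P r → ∃[ b ] (r < R → ∀ X → ∃[ c ] ∃[ m ] c ≤ b × Solved {r} X m × ∀ n → run n (withTables R P) (encode X) ≡ ret (just (c , m)))
  tableTime R P r with r ℕ.<? R
  ... | no r≮R = 0 , λ r<R → ⊥-elim (r≮R r<R)
  ... | yes r<R with bounded (vectors (order r) r) (λ v → elapsed (Det-withTables R P (element v) r<R))
  ...   | b , ≤b = b , λ _ X → let d = Det-withTables R P (element (indices X)) r<R in
    elapsed d , final d , ≤b (∈-vectors (indices X)) ,
    (λ S sol → solves-cong (codes-element X) (decode r (final d)) (related d S (solves-cong (sym (codes-element X)) S sol))) ,
    λ n → trans (cong (λ c → exec n (withTables R P) (0 , initial (r ∷ toList c))) (sym (codes-element X))) (runs d n 0)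

-- Error budget and assembly

Triple-halts : ∀ {m P b n} {μ : Dist A} {R : A → Mem → Set} → Triple m P b μ R → b ≤ n →
  Always (Maybe.Any (λ (t , _) → t ≤ b)) (exec n P (0 , m))
Triple-halts {m = m} {P} {b} {n} tr b≤n = Always-map (exec n P (0 , m)) (λ { (just (t , m)) (a , t≤b , _) → Maybe.just t≤b }) (always (from tr n 0 b≤n))

module Budget (ε : ℚ) (0<ε : 0ℚ ℚ.< ε) (n : ℕ) where

  -- n will be k * D + 2 ^ (k + 2), the total factor of η in the error bound. Division by 2 ^ n
  -- instead of n is enough, as n ≤ 2 ^ n.
  η : ℚ
  η = pow ½ n ℚ.* (½ ℚ.* ε)

  0<η : 0ℚ ℚ.< η
  0<η = ℚ.positive⁻¹ η ⦃ ℚ.pos*pos⇒pos (pow ½ n) ⦃ ℚ.positive (pow½-positive n) ⦄ (½ ℚ.* ε) ⦃ ℚ.positive (½*-positive 0<ε) ⦄ ⦄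

  n*η≤ : ι n ℚ.* η ℚ.≤ ½ ℚ.* ε
  n*η≤ = begin
    ι n ℚ.* (pow ½ n ℚ.* (½ ℚ.* ε))          ≡⟨ ℚ.*-assoc (ι n) (pow ½ n) (½ ℚ.* ε) ⟨
    ι n ℚ.* pow ½ n ℚ.* (½ ℚ.* ε)            ≤⟨ *-monoʳ (ℚ.<⇒≤ (½*-positive 0<ε)) (*-monoʳ (pow-nonneg n 0≤½) (ℚ.≤-trans (ι-mono (n≤2^n n)) (ℚ.≤-reflexive (ι-^ n)))) ⟩
    pow (ι 2) n ℚ.* pow ½ n ℚ.* (½ ℚ.* ε)    ≡⟨ trans (cong (ℚ._* (½ ℚ.* ε)) (pow-2-½ n)) (ℚ.*-identityˡ (½ ℚ.* ε)) ⟩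
    ½ ℚ.* ε                                  ∎
    where open ℚ.≤-Reasoning

budget : ∀ k D ε {η x c} → c ≡ pow (ι 2) (suc (suc k)) → ι (k * D + 2 ^ suc (suc k)) ℚ.* η ℚ.≤ ½ ℚ.* ε → x ℚ.≤ ½ ℚ.* ε →
  ι k ℚ.* (ι D ℚ.* η) ℚ.+ x ℚ.+ c ℚ.* η ℚ.≤ ε
budget k D ε {η} {x} {c} c≡ nη≤ x≤ = begin
  ι k ℚ.* (ι D ℚ.* η) ℚ.+ x ℚ.+ c ℚ.* η                     ≡⟨ lem (ι k) (ι D) η x c ⟩
  (ι k ℚ.* ι D ℚ.+ c) ℚ.* η ℚ.+ x                           ≡⟨ cong (λ y → y ℚ.* η ℚ.+ x) (sym (trans (ι-+ (k * D) (2 ^ suc (suc k))) (cong₂ ℚ._+_ (ι-* k D) (trans (ι-^ (suc (suc k))) (sym c≡))))) ⟩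
  ι (k * D + 2 ^ suc (suc k)) ℚ.* η ℚ.+ x                   ≤⟨ ℚ.+-mono-≤ nη≤ x≤ ⟩
  ½ ℚ.* ε ℚ.+ ½ ℚ.* ε                                       ≡⟨ ½+½ ε ⟩
  ε                                                         ∎
  where
  open ℚ.≤-Reasoning
  open +-*-Solver
  lem : ∀ k D η x c → k ℚ.* (D ℚ.* η) ℚ.+ x ℚ.+ c ℚ.* η ≡ (k ℚ.* D ℚ.+ c) ℚ.* η ℚ.+ x
  lem = solve 5 (λ k D η x c → k :* (D :* η) :+ x :+ c :* η := (k :* D :+ c) :* η :+ x) refl

-- A quarter of δ goes to the distance of x from 1, a quarter to the slack of that comparison, and
-- half to the slack of the other.
nearly-1 : ∀ {δ x p} → 0ℚ ℚ.< δ → absᴿ (x -ᴿ fromℕ 1) ≤ᴿ fromℚ (½ ℚ.* (½ ℚ.* δ)) → x ≤ᴿ fromℚ p → 1ℚ ℚ.≤ p ℚ.+ δ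
nearly-1 {δ} {x} {p} 0<δ close x≤p =
  let 0<¼δ = ½*-positive (½*-positive 0<δ)
      N₁ , close′ = close (½ ℚ.* (½ ℚ.* δ)) 0<¼δ
      N₂ , x≤p′ = x≤p (½ ℚ.* δ) (½*-positive 0<δ)
  in chain (x (N₁ ⊔ N₂)) (close′ (N₁ ⊔ N₂) (ℕ.m≤m⊔n N₁ N₂)) (x≤p′ (N₁ ⊔ N₂) (ℕ.m≤n⊔m N₁ N₂))
  where
  chain : ∀ y → ℚ.∣ y ℚ.- 1ℚ ∣ ℚ.≤ ½ ℚ.* (½ ℚ.* δ) ℚ.+ ½ ℚ.* (½ ℚ.* δ) → y ℚ.≤ p ℚ.+ ½ ℚ.* δ → 1ℚ ℚ.≤ p ℚ.+ δ
  chain y y≈1 y≤p = begin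
    1ℚ                                             ≤⟨ ∣-∣-lower {y} {1ℚ} y≈1 ⟩
    y ℚ.+ (½ ℚ.* (½ ℚ.* δ) ℚ.+ ½ ℚ.* (½ ℚ.* δ))    ≡⟨ cong (y ℚ.+_) (½+½ (½ ℚ.* δ)) ⟩
    y ℚ.+ ½ ℚ.* δ                                  ≤⟨ ℚ.+-monoˡ-≤ (½ ℚ.* δ) y≤p ⟩
    p ℚ.+ ½ ℚ.* δ ℚ.+ ½ ℚ.* δ                      ≡⟨ trans (ℚ.+-assoc p (½ ℚ.* δ) (½ ℚ.* δ)) (cong (p ℚ.+_) (½+½ δ)) ⟩
    p ℚ.+ δ                                        ∎
    where open ℚ.≤-Reasoning

module Search (k : ℕ) (𝓖 : GroupEnsemble) where
  open GroupEnsemble 𝓖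
  open KSum k 𝓖

  E-D₁ : ∀ r φ → E (D₁ r) φ ≡ E (D₀ r) (λ X → E (uniformFrom (subsetsOfSize k r)) (λ S → φ (plant S X)))
  E-D₁ r φ = trans (E->>= (D₀ r) (λ X → uniformFrom (subsetsOfSize k r) >>= λ S → ret (plant S X)) φ)
    (E-cong (D₀ r) λ X → E->>= (uniformFrom (subsetsOfSize k r)) (λ S → ret (plant S X)) φ)

  Pr-run : ∀ {A : Set} (d : Dist A) (f : A → Dist Outcome) (g : A → Outcome → Bool) →
    Pr (do x ← d
           o ← f x
           ret (g x o))
    ≡ E d (λ x → E (f x) (𝟙 ∘ g x))
  Pr-run d f g = trans (Pr≡E (d >>= λ x → f x >>= λ o → ret (g x o))) (trans (E->>= d (λ x → f x >>= λ o → ret (g x o)) 𝟙)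
    (E-cong d λ x → E->>= (f x) (λ o → ret (g x o)) 𝟙))

  planted-solution : ∀ {r} → 2 ≤ order r → ∀ S (X : Vec (G r) r) → ∣ S ∣ ≡ k → solves (plant S X) S ≡ true
  planted-solution {r} nontriv S X ∣S∣≡k = cong₂ _∧_ (trans (cong (_≡ᵇ k) ∣S∣≡k) (≡ᵇ-refl k))
    (dec-true (sumOver S (plant S X) ≈? 0ᴳ) (Resampling.sumOver-plant 𝓖 r nontriv k S X))

module Errors {k 𝓖 Δ} (adm : Admissible k 𝓖 Δ) (𝓐 : Program) (T : ℕ → ℕ)
  (halts : KSum.RunsInTime k 𝓖 𝓐 T) (D r : ℕ) (1≤r : 1 ≤ r) (η : ℚ) where
  open GroupEnsemble 𝓖
  open KSum k 𝓖
  open Analysis adm 𝓐 T halts D r 1≤r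
  open Reduction adm 𝓐 T halts D using (module Ideal)
  open Ideal r using (accepts)
  open Search k 𝓖

  rejection acceptance : ℚ
  rejection = Pr (do X ← D₀ r
                     o ← run (T r) 𝓐 (encode X)
                     ret (holds (outputs 0) o))
  acceptance = Pr (do X ← D₁ r
                      o ← run (T r) 𝓐 (encode X)
                      ret (holds (outputs 1) o))

  -- Output 0 and acceptance exclude each other, so their probabilities sum to at most 1.
  error₀ : 1ℚ ℚ.≤ rejection ℚ.+ η → E Y∼ accept ℚ.≤ η
  error₀ 1≤ = +-cancelˡ-≤ rejection (begin
    rejection ℚ.+ E Y∼ accept                                 ≡⟨ trans (cong (ℚ._+ E Y∼ accept) (Pr-run (D₀ r) decision (λ _ → holds (outputs 0)))) (sym (E-+ Y∼ rejected accept)) ⟩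
    E Y∼ (λ X → rejected X ℚ.+ accept X)                      ≤⟨ E-≤const Y∼ 0≤1 (λ X → ℚ.≤-trans (ℚ.≤-reflexive (sym (E-+ (decision X) (𝟙 ∘ holds (outputs 0)) (𝟙 ∘ accepts)))) (E-≤const (decision X) 0≤1 exclusive)) ⟩
    1ℚ                                                        ≤⟨ 1≤ ⟩
    rejection ℚ.+ η                                           ∎)
    where
    open ℚ.≤-Reasoning
    rejected : Vec (G r) r → ℚ
    rejected X = E (decision X) (𝟙 ∘ holds (outputs 0))
    exclusive : ∀ o → 𝟙 (holds (outputs 0) o) ℚ.+ 𝟙 (accepts o) ℚ.≤ 1ℚ
    exclusive nothing = 0≤1
    exclusive (just (t , m)) with m 0 ≡ᵇ 0
    ... | true  = ℚ.≤-refl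
    ... | false = ℚ.≤-refl

  -- Output 1 is one way of accepting, so it is no more likely than acceptance.
  error₁ : 1ℚ ℚ.≤ acceptance ℚ.+ η → E Y∼ (λ X → E 𝕊 (λ S → 1ℚ ℚ.- accept (plant S X))) ℚ.≤ η
  error₁ 1≤ = +-cancelˡ-≤ acceptance (begin
    acceptance ℚ.+ E Y∼ (λ X → E 𝕊 (λ S → 1ℚ ℚ.- accept (plant S X)))   ≡⟨ cong₂ ℚ._+_ (Pr-run (D₁ r) decision (λ _ → holds (outputs 1))) (sym (E-D₁ r (λ X → 1ℚ ℚ.- accept X))) ⟩
    E (D₁ r) accepted ℚ.+ E (D₁ r) (λ X → 1ℚ ℚ.- accept X)     ≡⟨ E-+ (D₁ r) accepted (λ X → 1ℚ ℚ.- accept X) ⟨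
    E (D₁ r) (λ X → accepted X ℚ.+ (1ℚ ℚ.- accept X))          ≤⟨ E-≤const (D₁ r) 0≤1 (λ X → ℚ.≤-trans (ℚ.+-monoˡ-≤ (1ℚ ℚ.- accept X) (E-mono (decision X) implied)) (ℚ.≤-reflexive (lem (accept X)))) ⟩
    1ℚ                                                         ≤⟨ 1≤ ⟩
    acceptance ℚ.+ η                                           ∎)
    where
    open ℚ.≤-Reasoning
    accepted : Vec (G r) r → ℚ
    accepted X = E (decision X) (𝟙 ∘ holds (outputs 1))
    lem : ∀ x → x ℚ.+ (1ℚ ℚ.- x) ≡ 1ℚ
    lem = solve 1 (λ x → x :+ (con 1ℚ :- x) := con 1ℚ) refl
      where open +-*-Solver
    implied : ∀ o → 𝟙 (holds (outputs 1) o) ℚ.≤ 𝟙 (accepts o)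
    implied nothing = ℚ.≤-refl
    implied (just (t , m)) with m 0
    ... | zero        = ℚ.≤-refl
    ... | suc zero    = ℚ.≤-refl
    ... | suc (suc _) = 0≤1

module Final {k 𝓖 Δ} (adm : Admissible k 𝓖 Δ) (𝓐 : Program) (T : ℕ → ℕ)
  (halts : KSum.RunsInTime k 𝓖 𝓐 T) (D R : ℕ) (2≤R : 2 ≤ R) where
  open GroupEnsemble 𝓖
  open KSum k 𝓖
  open Admissible adm using (nontrivial)
  open Reduction adm 𝓐 T halts D
  open Table k 𝓖 using (withTables; smallE; tableTime; Solved)
  open Search k 𝓖

  𝓑 : Program
  𝓑 = withTables R mainP

  largeTime : ∀ r → 2 ≤ r → ℕ
  largeTime r 2≤r = 6 * bits r + Correct.mainTime r 2≤r

  choose : ∀ r → Dec (r < R) → ℕ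
  choose r (yes _)  = proj₁ (tableTime R mainP r)
  choose r (no r≮R) = largeTime r (ℕ.≤-trans 2≤R (ℕ.≮⇒≥ r≮R))

  T′ : ℕ → ℕ
  T′ r = choose r (r ℕ.<? R)

  T′-small : ∀ {r} → r < R → T′ r ≡ proj₁ (tableTime R mainP r)
  T′-small {r} r<R = go (r ℕ.<? R)
    where
    go : ∀ d → choose r d ≡ proj₁ (tableTime R mainP r)
    go (yes _)  = refl
    go (no r≮R) = ⊥-elim (r≮R r<R)

  T′-large : ∀ {r} → R ≤ r → ∃[ 2≤r ] T′ r ≡ largeTime r 2≤r
  T′-large {r} R≤r = go (r ℕ.<? R)
    where
    go : ∀ d → ∃[ 2≤r ] choose r d ≡ largeTime r 2≤r
    go (yes r<R) = ⊥-elim (ℕ.<⇒≱ r<R R≤r)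
    go (no r≮R)  = _ , refl

  Triple-𝓑 : ∀ r 2≤r → R ≤ r → (X : Vec (G r) r) → Triple (initial (encode X)) 𝓑 (largeTime r 2≤r) (Ideal.scores r X)
    (λ s m → ∀ i → m (suc (toℕ i)) ≡ bits r ∸ lookup s i)
  Triple-𝓑 r 2≤r R≤r X = Triple-cond-zero {e = smallE R} (ℕ.m≤n⇒m∸n≡0 R≤r) cost≤ (Correct.Triple-main r 2≤r X)
    where
    open ℕ.≤-Reasoning
    cost≤ : cost (smallE R) (initial (encode X)) ≤ 6 * bits r
    cost≤ = begin
      bits R + (1 + 1 + bits r) + bits R + bits r
        ≤⟨ ℕ.+-monoˡ-≤ (bits r) (ℕ.+-mono-≤ (ℕ.+-mono-≤ R≤ (ℕ.+-monoˡ-≤ (bits r) (ℕ.+-mono-≤ (1≤bits r) (1≤bits r)))) R≤) ⟩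
      bits r + (bits r + bits r + bits r) + bits r + bits r
        ≡⟨ lem (bits r) ⟩
      6 * bits r
        ∎
      where
      R≤ : bits R ≤ bits r
      R≤ = bits-mono R≤r
      lem : ∀ b → b + (b + b + b) + b + b ≡ 6 * b
      lem = solve-∀

  runsInTime : RunsInTime 𝓑 T′
  runsInTime r 1≤r X = go (r ℕ.<? R)
    where
    go : Dec (r < R) → HaltsWithin 𝓑 (encode X) (T′ r)
    go (yes r<R) with proj₂ (tableTime R mainP r) r<R X
    ... | c , m , c≤ , _ , runs = subst (Always (Maybe.Any (λ (t , _) → t ≤ T′ r))) (sym (runs (T′ r)))
      (Maybe.just (subst (c ≤_) (sym (T′-small r<R)) c≤))
    go (no r≮R) with T′-large (ℕ.≮⇒≥ r≮R)
    ... | 2≤r , eq = subst (λ b → Always (Maybe.Any (λ (t , _) → t ≤ b)) (run b 𝓑 (encode X))) (sym eq)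
      (Triple-halts (Triple-𝓑 r 2≤r (ℕ.≮⇒≥ r≮R) X) ℕ.≤-refl)

  successful : ∀ r → Vec (G r) r → Outcome → Bool
  successful r X = holds (solves X ∘ decode r)

  Pr-search : ℕ → ℚ
  Pr-search r = Pr (do X ← D₁ r
                       o ← run (T′ r) 𝓑 (encode X)
                       ret (successful r X o))

  Pr-search≡ : ∀ r → Pr-search r ≡ E (D₀ r) (λ X → E (uniformFrom (subsetsOfSize k r)) (λ S →
    E (run (T′ r) 𝓑 (encode (plant S X))) (𝟙 ∘ successful r (plant S X))))
  Pr-search≡ r = trans (Pr-run (D₁ r) (λ X → run (T′ r) 𝓑 (encode X)) (successful r))
    (E-D₁ r (λ X → E (run (T′ r) 𝓑 (encode X)) (𝟙 ∘ successful r X)))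

  search-small : ∀ r → 1 ≤ r → k ≤ r → r < R → Pr-search r ≡ 1ℚ
  search-small r 1≤r k≤r r<R = trans (Pr-search≡ r) (trans
    (E-cong (D₀ r) λ X → trans (mean-cong _ (λ j → certain X (List.lookup (subsetsOfSize k r) j) (size-of-drawn {k} {r} j))) (E-const proper-𝕊 1ℚ))
    (E-const (proper-iid r (Resampling.proper-uniform 𝓖 r (nontrivial r 1≤r))) 1ℚ))
    where
    proper-𝕊 : Proper (uniformFrom (subsetsOfSize k r))
    proper-𝕊 = proper-uniformFrom (proj₂ (proj₂ (subset-of-size k≤r)))
    certain : ∀ X S → ∣ S ∣ ≡ k → E (run (T′ r) 𝓑 (encode (plant S X))) (𝟙 ∘ successful r (plant S X)) ≡ 1ℚ
    certain X S ∣S∣≡k with proj₂ (tableTime R mainP r) r<R (plant S X)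
    ... | c , m , _ , solved , runs = trans (cong (λ d → E d (𝟙 ∘ successful r (plant S X))) (runs (T′ r)))
      (cong 𝟙 (solved S (planted-solution (nontrivial r 1≤r) S X ∣S∣≡k)))

  -- Correct scores decode to S itself, which solves the planted instance; the refinement carries
  -- this lower bound from the ideal scores to the machine.
  search-large : ∀ r (1≤r : 1 ≤ r) → R ≤ r →
    E (D₀ r) (λ X → E (uniformFrom (subsetsOfSize k r)) (λ S → E (Ideal.scores r (plant S X)) (Analysis.correct adm 𝓐 T halts D r 1≤r S))) ℚ.≤ Pr-search r
  search-large r 1≤r R≤r = ℚ.≤-trans
    (E-mono (D₀ r) λ X → mean-mono _ λ j → let S = List.lookup (subsetsOfSize k r) j in
      transfer (plant S X) S (planted-solution (nontrivial r 1≤r) S X (size-of-drawn {k} {r} j)))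
    (ℚ.≤-reflexive (sym (Pr-search≡ r)))
    where
    open Analysis adm 𝓐 T halts D r 1≤r using (correct; correct?; Correct)
    decoded : ∀ S s m → Correct S s → (∀ i → m (suc (toℕ i)) ≡ bits r ∸ lookup s i) → decode r m ≡ S
    decoded S s m cor m≡ = trans (Vec.tabulate-cong λ i → trans (bit (m≡ i)) (cor i)) (Vec.tabulate∘lookup S)
      where
      sign : ∀ h x → (if (h ∸ x) ≡ᵇ 0 then outside else inside) ≡ (x <ᵇ h)
      sign zero    zero    = refl
      sign zero    (suc x) = refl
      sign (suc h) zero    = refl
      sign (suc h) (suc x) = sign h x
      bit : ∀ {i v} → v ≡ bits r ∸ lookup s i → (if v ≡ᵇ 0 then outside else inside) ≡ (lookup s i <ᵇ bits r)
      bit {i} refl = sign (bits r) (lookup s i)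
    transfer : ∀ P S → solves P S ≡ true → E (Ideal.scores r P) (correct S) ℚ.≤ E (run (T′ r) 𝓑 (encode P)) (𝟙 ∘ successful r P)
    transfer P S solution with T′-large R≤r
    ... | 2≤r , eq = lower (from (Triple-𝓑 r 2≤r R≤r P) (T′ r) 0 (ℕ.≤-reflexive (sym eq))) (correct S) (𝟙 ∘ successful r P)
      (λ o → 0≤𝟙 (successful r P o)) λ { s (just (t , m)) (_ , m≡) → pointwise s m m≡ (correct? S s) }
      where
      pointwise : ∀ s m → (∀ i → m (suc (toℕ i)) ≡ bits r ∸ lookup s i) → (d : Dec (Correct S s)) →
        𝟙 (does d) ℚ.≤ 𝟙 (solves P (decode r m))
      pointwise s m m≡ (no _)    = 0≤𝟙 (solves P (decode r m))
      pointwise s m m≡ (yes cor) = ℚ.≤-reflexive (cong 𝟙 (sym (trans (cong (solves P) (decoded S s m cor m≡)) solution)))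

  quasilinear : seq Δ <ᴿ fromℕ 1 → T =Ω (λ r → fromℕ r /ᴿ seq Δ) → T′ =Õ T
  quasilinear Δ<1 T≥ = let e , c , R₁ , main≤ = RunningTime.main-quasilinear adm 𝓐 T halts D Δ<1 T≥ in
    e , 6 * c , R ⊔ R₁ , λ r R≤r →
      let 2≤r , eq = T′-large (ℕ.≤-trans (ℕ.m≤m⊔n R R₁) R≤r) in
      bound {bits r} {Correct.mainTime r 2≤r} {c} {T r * ⌊log₂ r ⌋ ^ e} eq (main≤ r 2≤r (ℕ.≤-trans (ℕ.m≤n⊔m R R₁) R≤r))
    where
    bound : ∀ {b t c u x} → x ≡ 6 * b + t → t + b ≤ c * u → x ≤ 6 * c * u
    bound {b} {t} {c} {u} {x} refl t+b≤ = begin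
      6 * b + t          ≤⟨ ℕ.m≤m+n (6 * b + t) (5 * t) ⟩
      6 * b + t + 5 * t  ≡⟨ lem b t ⟩
      6 * (t + b)        ≤⟨ ℕ.*-monoʳ-≤ 6 t+b≤ ⟩
      6 * (c * u)        ≡⟨ ℕ.*-assoc 6 c u ⟨
      6 * c * u          ∎
      where
      open ℕ.≤-Reasoning
      lem : ∀ b t → 6 * b + t + 5 * t ≡ 6 * (t + b)
      lem = solve-∀

  found : ∀ {ε η} → 0ℚ ℚ.< ε → 0ℚ ℚ.< η → pow (1ℚ ℚ.- pow ½ (suc (suc (suc k)))) D ℚ.≤ pow ½ 3 →
    ι (k * D + 2 ^ suc (suc k)) ℚ.* η ℚ.≤ ½ ℚ.* ε → (∀ r → R ≤ r → pow ½ (bits r) ℚ.≤ ½ ℚ.* ε) →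
    (α : ℕ → ℝ) → (∀ r → R ≤ r → absᴿ (seq (α r) -ᴿ fromℕ 1) ≤ᴿ fromℚ (½ ℚ.* (½ ℚ.* η))) →
    SolvesDecision 𝓐 T α → ∀ r → 1 ≤ r → k ≤ r → 1ℚ ℚ.≤ Pr-search r ℚ.+ ε
  found {ε} {η} 0<ε 0<η amplified n*η≤ ½^H≤ α close decides r 1≤r k≤r = go (r ℕ.<? R)
    where
    go : Dec (r < R) → 1ℚ ℚ.≤ Pr-search r ℚ.+ ε
    go (yes r<R) = ℚ.≤-trans (ℚ.≤-reflexive (trans (sym (search-small r 1≤r k≤r r<R)) (sym (ℚ.+-identityʳ (Pr-search r))))) (ℚ.+-monoʳ-≤ (Pr-search r) (ℚ.<⇒≤ 0<ε))
    go (no r≮R) = ℚ.≤-trans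
      (Analysis.total adm 𝓐 T halts D r 1≤r amplified {η}
        (error₀ (nearly-1 {η} {seq (α r)} {rejection} 0<η (close r R≤r) (proj₁ (decides r 1≤r k≤r))))
        (error₁ (nearly-1 {η} {seq (α r)} {acceptance} 0<η (close r R≤r) (proj₂ (decides r 1≤r k≤r)))) k≤r)
      (ℚ.+-mono-≤ (search-large r 1≤r R≤r) (budget k D ε {η} {pow ½ (bits r)} {Analysis.c⁻¹ adm 𝓐 T halts D r 1≤r} refl n*η≤ (½^H≤ r R≤r)))
      where
      open Errors adm 𝓐 T halts D r 1≤r η
      R≤r : R ≤ r
      R≤r = ℕ.≮⇒≥ r≮R

theorem4p13 : (k : ℕ) (𝓖 : GroupEnsemble) (Δ : ℝ) →
    Admissible k 𝓖 Δ →
    seq Δ <ᴿ fromℕ 1 →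
    (T : ℕ → ℕ) →
    T =Ω (λ r → fromℕ r /ᴿ seq Δ) →
    (Σ[ A ∈ Program ] KSum.RunsInTime k 𝓖 A T ×
    Σ[ ε ∈ (ℕ → ℝ) ] Converges (λ r → seq (ε r)) (fromℕ 1) ×
    KSum.SolvesDecision k 𝓖 A T ε) →
    (γ : ℝ) → seq γ <ᴿ fromℕ 1 →
    Σ[ B ∈ Program ] Σ[ T′ ∈ (ℕ → ℕ) ] T′ =Õ T ×
    KSum.RunsInTime k 𝓖 B T′ ×
    KSum.SolvesPlantedSearch k 𝓖 B T′ (λ _ → γ)
theorem4p13 k 𝓖 Δ adm Δ<1 T T≥ (𝓐 , halts , success , success→1 , decides) γ (ε , 0<ε , N , γ+ε≤1) =
  -- ε is the gap that γ < 1 leaves. One half of it covers 2 ^ (- H) from the union bound, the other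
  -- half the terms in the decision error.
  assemble (amplification (suc (suc (suc k)))) (archimedean (½ ℚ.* ε) (½*-positive 0<ε))
  where
  below : ∀ {g p e} → g ℚ.+ ε ℚ.≤ 1ℚ → 1ℚ ℚ.≤ p ℚ.+ ε → 0ℚ ℚ.≤ e → g ℚ.≤ p ℚ.+ e
  below {g} {p} {e} g+ε≤1 1≤p+ε 0≤e = ℚ.≤-trans (+-cancelˡ-≤ ε (subst₂ ℚ._≤_ (ℚ.+-comm g ε) (ℚ.+-comm p ε) (ℚ.≤-trans g+ε≤1 1≤p+ε)))
    (ℚ.≤-trans (ℚ.≤-reflexive (sym (ℚ.+-identityʳ p))) (ℚ.+-monoʳ-≤ p 0≤e))
  assemble : ∃[ D ] pow (1ℚ ℚ.- pow ½ (suc (suc (suc k)))) D ℚ.≤ pow ½ 3 → ∃[ h ] pow ½ h ℚ.≤ ½ ℚ.* ε →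
    Σ[ B ∈ Program ] Σ[ T′ ∈ (ℕ → ℕ) ] T′ =Õ T × KSum.RunsInTime k 𝓖 B T′ × KSum.SolvesPlantedSearch k 𝓖 B T′ (λ _ → γ)
  assemble (D , amplified) (h , ½^h≤) = 𝓑 , T′ , quasilinear Δ<1 T≥ , runsInTime , λ r 1≤r k≤r e 0<e →
      N , λ n N≤n → below {seq γ n} {Pr-search r} {e} (γ+ε≤1 n N≤n)
        (found 0<ε 0<η amplified n*η≤ (λ r R≤r → ℚ.≤-trans (pow-½-antitone (h≤bits r R≤r)) ½^h≤) success
          (λ r R≤r → proj₂ close r (ℕ.≤-trans (ℕ.m≤m⊔n (proj₁ close) (2 ^ h)) (ℕ.≤-trans (ℕ.m≤n⊔m 2 (proj₁ close ⊔ 2 ^ h)) R≤r)))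
          decides r 1≤r k≤r) (ℚ.<⇒≤ 0<e)
    where
    open Budget ε 0<ε (k * D + 2 ^ suc (suc k))
    close = success→1 (½ ℚ.* (½ ℚ.* η)) (½*-positive (½*-positive 0<η))
    R : ℕ
    -- From R on, the memory layout has its r ≥ 2, the decision error is within the budget, and 2 ^
    -- (- H) is at most ε / 2; below R the table answers.
    R = 2 ⊔ (proj₁ close ⊔ 2 ^ h)
    open Final adm 𝓐 T halts D R (ℕ.m≤m⊔n 2 (proj₁ close ⊔ 2 ^ h))
    h≤bits : ∀ r → R ≤ r → h ≤ bits r
    h≤bits r R≤r = ℕ.m≤n⇒m≤1+n (ℕ.≤-trans (ℕ.≤-reflexive (sym (⌊log₂[2^n]⌋≡n h)))
      (⌊log₂⌋-mono-≤ (ℕ.≤-trans (ℕ.m≤n⊔m (proj₁ close) (2 ^ h)) (ℕ.≤-trans (ℕ.m≤n⊔m 2 (proj₁ close ⊔ 2 ^ h)) R≤r))))
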